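{- Every D3-reducible graph $G$ is planar, and every triangle (3-cycle) in $G$ is a face of its unique planar embedding.
   Context: All graphs are finite and simple. The D3 reductions are the following two operations on a graph $G$. (D3a) Let $p,q,r$ be three vertices of degree three that induce a triangle in $G$ and whose neighbors outside $\{p,q,r\}$ are three distinct vertices; replace $p,q,r$ by a single new vertex adjacent to exactly those three outside neighbors. (D3b) Let $p,q,r$ be three vertices of degree three that induce a path with middle vertex $q$, and suppose there is a single vertex $s$ adjacent to all three of $p,q,r$; delete $q$ and add a new edge from $p$ to $r$. A graph is D3-reducible if it can be transformed into a graph isomorphic to $K_4$ by a finite sequence of D3 reductions. (D3-reducible graphs are 3-vertex-connected, so a planar embedding, if it exists, is unique up to the choice of outer face; its faces are well defined.) -}

module Defs where

open import Data.Nat using (ℕ; zero; suc; _+_; _*_; _≤ᵇ_; _<ᵇ_)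
open import Data.Fin using (Fin; toℕ; _≟_)
open import Data.Bool using (Bool; true; false; _∧_; not; if_then_else_)
open import Data.List using (List; []; _∷_; map; concatMap; allFin; upTo)
open import Data.Product using (Σ; ∃; _×_; _,_; proj₁; proj₂)
open import Data.Sum using (_⊎_)
open import Relation.Nullary using (¬_; does)
open import Relation.Binary.PropositionalEquality using (_≡_; _≢_; refl)
open import Relation.Binary.Construct.Closure.ReflexiveTransitive using (Star)
open import Function.Bundles using (_⇔_; _⤖_; Bijection)

record Graph : Set where
  field
    n      : ℕ
    adj    : Fin n → Fin n → Bool
    sym    : ∀ u v → adj u v ≡ adj v u
    irrefl : ∀ u → adj u u ≡ false

open Graph public

V : Graph → Set
V G = Fin (n G)

Adj : (G : Graph) → V G → V G → Set
Adj G u v = adj G u v ≡ true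

countB : {A : Set} → (A → Bool) → List A → ℕ
countB p []       = 0
countB p (x ∷ xs) = if p x then suc (countB p xs) else countB p xs

degree : (G : Graph) → V G → ℕ
degree G v = countB (adj G v) (allFin (n G))

allB : {A : Set} → (A → Bool) → List A → Bool
allB p []       = true
allB p (x ∷ xs) = p x ∧ allB p xs

iter : {A : Set} → (A → A) → ℕ → A → A
iter f zero    x = x
iter f (suc k) x = f (iter f k x)

_≅_ : Graph → Graph → Set
G ≅ H = Σ (V G ⤖ V H) λ f →
          ∀ u v → adj H (Bijection.to f u) (Bijection.to f v) ≡ adj G u v

k4adj : Fin 4 → Fin 4 → Bool
k4adj u v = not (does (u ≟ v))

k4sym : ∀ u v → k4adj u v ≡ k4adj v u
k4sym Fin.zero Fin.zero = refl
k4sym Fin.zero (Fin.suc Fin.zero) = refl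
k4sym Fin.zero (Fin.suc (Fin.suc Fin.zero)) = refl
k4sym Fin.zero (Fin.suc (Fin.suc (Fin.suc Fin.zero))) = refl
k4sym (Fin.suc Fin.zero) Fin.zero = refl
k4sym (Fin.suc Fin.zero) (Fin.suc Fin.zero) = refl
k4sym (Fin.suc Fin.zero) (Fin.suc (Fin.suc Fin.zero)) = refl
k4sym (Fin.suc Fin.zero) (Fin.suc (Fin.suc (Fin.suc Fin.zero))) = refl
k4sym (Fin.suc (Fin.suc Fin.zero)) Fin.zero = refl
k4sym (Fin.suc (Fin.suc Fin.zero)) (Fin.suc Fin.zero) = refl
k4sym (Fin.suc (Fin.suc Fin.zero)) (Fin.suc (Fin.suc Fin.zero)) = refl
k4sym (Fin.suc (Fin.suc Fin.zero)) (Fin.suc (Fin.suc (Fin.suc Fin.zero))) = refl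
k4sym (Fin.suc (Fin.suc (Fin.suc Fin.zero))) Fin.zero = refl
k4sym (Fin.suc (Fin.suc (Fin.suc Fin.zero))) (Fin.suc Fin.zero) = refl
k4sym (Fin.suc (Fin.suc (Fin.suc Fin.zero))) (Fin.suc (Fin.suc Fin.zero)) = refl
k4sym (Fin.suc (Fin.suc (Fin.suc Fin.zero))) (Fin.suc (Fin.suc (Fin.suc Fin.zero))) = refl

k4irrefl : ∀ u → k4adj u u ≡ false
k4irrefl Fin.zero = refl
k4irrefl (Fin.suc Fin.zero) = refl
k4irrefl (Fin.suc (Fin.suc Fin.zero)) = refl
k4irrefl (Fin.suc (Fin.suc (Fin.suc Fin.zero))) = refl

K4 : Graph
K4 = record { n = 4 ; adj = k4adj ; sym = k4sym ; irrefl = k4irrefl }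

-- D3 reductions (result determined up to isomorphism)

In3 : {A : Set} → A → A → A → A → Set
In3 p q r w = w ≡ p ⊎ w ≡ q ⊎ w ≡ r

-- (D3a): p,q,r of degree 3 inducing a triangle, with three distinct outside
-- neighbours; H is G with {p,q,r} identified to one new vertex x whose
-- neighbours are exactly the outside neighbours of p,q,r.
-- φ is the quotient map V(G) → V(H).
D3a : Graph → Graph → Set
D3a G H =
  Σ (V G) λ p → Σ (V G) λ q → Σ (V G) λ r →
  Σ (V G → V H) λ φ →
    ( degree G p ≡ 3 × degree G q ≡ 3 × degree G r ≡ 3
    × Adj G p q × Adj G q r × Adj G p r
    -- the outside neighbours are three distinct vertices: no vertex outside
    -- {p,q,r} is adjacent to two distinct members of {p,q,r}
    × (∀ w x y → In3 p q r x → In3 p q r y → x ≢ y →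
         Adj G w x → Adj G w y → In3 p q r w) )
  × ( (∀ h → ∃ λ u → φ u ≡ h)
    × (∀ u v → (φ u ≡ φ v) ⇔ (u ≡ v ⊎ (In3 p q r u × In3 p q r v)))
    × (∀ u v → Adj H (φ u) (φ v) ⇔
         (φ u ≢ φ v × Σ (V G) λ u′ → Σ (V G) λ v′ →
            φ u′ ≡ φ u × φ v′ ≡ φ v × Adj G u′ v′)) )

-- (D3b): p,q,r of degree 3 inducing a path with middle q, s adjacent to all
-- three; H is G with q deleted and edge pr added.
-- ψ is the embedding V(H) → V(G) onto V(G) ∖ {q}.
D3b : Graph → Graph → Set
D3b G H =
  Σ (V G) λ p → Σ (V G) λ q → Σ (V G) λ r → Σ (V G) λ s →
  Σ (V H → V G) λ ψ →
    ( degree G p ≡ 3 × degree G q ≡ 3 × degree G r ≡ 3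
    × Adj G p q × Adj G q r × p ≢ r × adj G p r ≡ false
    × Adj G s p × Adj G s q × Adj G s r )
  × ( (∀ a b → ψ a ≡ ψ b → a ≡ b)
    × (∀ a → ψ a ≢ q)
    × (∀ u → u ≢ q → ∃ λ a → ψ a ≡ u)
    × (∀ a b → Adj H a b ⇔
         (Adj G (ψ a) (ψ b) ⊎ (ψ a ≡ p × ψ b ≡ r) ⊎ (ψ a ≡ r × ψ b ≡ p))) )

D3Step : Graph → Graph → Set
D3Step G H = D3a G H ⊎ D3b G H

D3Reducible : Graph → Set
D3Reducible G = Σ Graph λ H → Star D3Step G H × H ≅ K4

Connected : Graph → Set
Connected G = ∀ u v → Star (Adj G) u v

-- ρ u v = successor of neighbour v in the cyclic order around u
IsRotation : (G : Graph) → (V G → V G → V G) → Set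
IsRotation G ρ =
    (∀ u v → Adj G u v → Adj G u (ρ u v))
  × (∀ u v w → Adj G u v → Adj G u w → ∃ λ k → iter (ρ u) k v ≡ w)

Dart : Graph → Set
Dart G = V G × V G

darts : (G : Graph) → List (Dart G)
darts G = concatMap (λ u → map (λ v → (u , v)) (allFin (n G))) (allFin (n G))

faceStep : (G : Graph) → (V G → V G → V G) → Dart G → Dart G
faceStep G ρ (u , v) = (v , ρ v u)

key : (G : Graph) → Dart G → ℕ
key G (u , v) = toℕ u * n G + toℕ v

-- d is the key-minimal dart of its face orbit (orbits have < n*n darts)
isFaceRep : (G : Graph) → (V G → V G → V G) → Dart G → Bool
isFaceRep G ρ d =
  adj G (proj₁ d) (proj₂ d) ∧
  allB (λ k → key G d ≤ᵇ key G (iter (faceStep G ρ) k d)) (upTo (n G * n G))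

numFaces : (G : Graph) → (V G → V G → V G) → ℕ
numFaces G ρ = countB (isFaceRep G ρ) (darts G)

numEdges : Graph → ℕ
numEdges G = countB (λ d → adj G (proj₁ d) (proj₂ d) ∧ (toℕ (proj₁ d) <ᵇ toℕ (proj₂ d))) (darts G)

-- planar (genus 0) embedding: Euler's formula V − E + F = 2
IsPlanarEmbedding : (G : Graph) → (V G → V G → V G) → Set
IsPlanarEmbedding G ρ = IsRotation G ρ × (n G + numFaces G ρ ≡ numEdges G + 2)

Planar : Graph → Set
Planar G = Connected G × Σ (V G → V G → V G) (IsPlanarEmbedding G)

Triangle : (G : Graph) → V G → V G → V G → Set
Triangle G a b c = Adj G a b × Adj G b c × Adj G a c

FaceCycle : (G : Graph) → (V G → V G → V G) → V G → V G → V G → Set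
FaceCycle G ρ x y z =
    faceStep G ρ (x , y) ≡ (y , z)
  × faceStep G ρ (y , z) ≡ (z , x)
  × faceStep G ρ (z , x) ≡ (x , y)

TriangleIsFace : (G : Graph) → (V G → V G → V G) → V G → V G → V G → Set
TriangleIsFace G ρ a b c = FaceCycle G ρ a b c ⊎ FaceCycle G ρ a c b

{-# OPTIONS --safe #-}
-- Induction along the reductions. A colouring of the darts that is constant along faces and uses
-- k colours shows that a rotation has at least k faces. With K = E + 2 - n, the induction carries
-- three facts: some rotation has a colouring with K colours; no rotation has one with more; and
-- whenever K colours occur, every triangle is a face and the two faces along an edge have only
-- the ends of that edge in common. Undoing a reduction increases K by one. Conversely, a rotation
-- of the larger graph restricts to the smaller one by deleting a single edge (q s in D3b, the loop
-- left by contracting two sides of the triangle in D3a), and this merges at most two colours. So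
-- the bound is inherited, and if it is attained then the deleted edge had different faces on its
-- two sides and the colouring of the smaller graph is again maximal. In D3b the edge q s must
-- split the face p r s, for otherwise both faces along p r would contain s. In D3a the triangle
-- p q r must be a face, for otherwise some edge would have the same face on both sides.

module Submission where

open import Defs hiding (sym)
open import Data.Bool using (Bool; true; false; _∧_; if_then_else_; T)
open import Data.Bool.Properties using () renaming (_≟_ to _≟ᵇ_)
open import Data.Empty using (⊥-elim)
open import Data.Fin using (Fin; zero; suc; punchIn; punchOut; splitAt; join; toℕ; combine; inject≤)
import Data.Fin.Properties as Fin
open import Data.List as List using (List; []; _∷_; map; _++_; concatMap; allFin; upTo; cartesianProduct)
open import Data.List.Membership.Propositional using (_∈_)
open import Data.List.Membership.Propositional.Properties using (∈-allFin; ∈-cartesianProduct⁺; ∈-upTo⁺)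
open import Data.List.Relation.Unary.All using (lookup)
open import Data.List.Relation.Unary.AllPairs using (_∷_)
open import Data.List.Relation.Unary.Any using (here; there)
open import Data.List.Relation.Unary.Unique.Propositional using (Unique)
import Data.List.Relation.Unary.Unique.Propositional.Properties as Unique
open import Data.Nat as ℕ using (ℕ; zero; suc; _+_; _*_; _≤_; _<_; _<ᵇ_; s≤s)
open import Data.Nat.DivMod using (_/_; _%_; m≡m%n+[m/n]*n; m%n<n)
import Data.Nat.Properties as ℕ
open import Data.Product as Product using (Σ; ∃; ∃₂; _×_; _,_; proj₁; proj₂)
open import Data.Sum as Sum using (_⊎_; inj₁; inj₂; [_,_]′)
open import Data.Sum.Properties using (inj₁-injective; inj₂-injective)
open import Data.Unit using (⊤; tt)
open import Function using (_∘_)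
open import Function.Bundles using (Equivalence; Bijection; _⇔_)
open import Relation.Binary.Construct.Closure.ReflexiveTransitive using (Star; ε; _◅_; _◅◅_)
open import Relation.Binary.Definitions using (DecidableEquality; tri<; tri≈; tri>)
open import Relation.Binary.PropositionalEquality hiding ([_])
open import Relation.Nullary using (¬_; Dec; yes; no; does; ¬?; _×-dec_; _⊎-dec_; _→-dec_; contradiction)
open import Relation.Nullary.Decidable using (map′; from-yes; dec-true)

-- Why `K` grows by exactly one: subdividing an edge and contracting a non-loop edge leave the
-- number of faces alone. Undoing D3b subdivides `p r` by `q` and then adds `q s`; undoing D3a adds
-- a loop at the contracted vertex and then expands it. So each step adds a single edge inside one
-- face. The obstacle is that face orbits change shape under these operations and are awkward to
-- follow. A colouring with a lower bound on its number of colours can instead be pulled back,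
-- merged or refined pointwise, and optimality recovers the faces. Orbits are counted only in
-- `Faces`, which serves the base case and the final translation. Uniqueness of the embedding is
-- never stated as such: rigidity is claimed for every rotation that attains `K`, hence for every
-- planar embedding. Adjacency is a relation on an arbitrary type, so that the reductions can be
-- carried out on named vertices, where a case distinction over edges is pattern matching. At a
-- vertex of degree three there are two cyclic orders; mirror cases are removed by renaming
-- vertices.

RotationAt : {V : Set} → (V → Set) → (V → V) → Set
RotationAt N f = (∀ {v} → N v → N (f v)) × (∀ {v w} → N v → N w → Star (λ x y → f x ≡ y) v w)

Rotation : {V : Set} → (V → V → Set) → (V → V → V) → Set
Rotation A ρ = ∀ u → RotationAt (A u) (ρ u)

-- A surjective colouring of the faces; a colour may be shared by several faces, so that
-- k is only a lower bound for the number of faces.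
record Colouring {V : Set} (A : V → V → Set) (ρ : V → V → V) (k : ℕ) : Set where
  field
    colour     : V → V → Fin k
    invariant  : ∀ {u v} → A u v → colour u v ≡ colour v (ρ v u)
    surjective : ∀ i → ∃₂ λ u v → A u v × colour u v ≡ i

open Colouring

Face : {V : Set} → (V → V → V) → V → V → V → Set
Face ρ x y z = ρ y x ≡ z × ρ z y ≡ x × ρ x z ≡ y

Facial : {V : Set} → (V → V → V) → V → V → V → Set
Facial ρ a b c = Face ρ a b c ⊎ Face ρ a c b

facial-rotate : {V : Set} (ρ : V → V → V) {a b c : V} → Facial ρ a b c → Facial ρ b c a
facial-rotate ρ (inj₁ (e₁ , e₂ , e₃)) = inj₁ (e₂ , e₃ , e₁)
facial-rotate ρ (inj₂ (e₁ , e₂ , e₃)) = inj₂ (e₃ , e₁ , e₂)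

-- A vertex counts as lying on a face when some dart leaving it has the colour of that face, so
-- `faces-meet` speaks of the faces on the two sides of `u v`. Colours stand in for faces; for a
-- maximal colouring the two notions agree by `colour-class`.
record Rigid {V : Set} (A : V → V → Set) (ρ : V → V → V) {k : ℕ} (c : Colouring A ρ k) : Set where
  field
    triangles  : ∀ {x y z} → A x y → A y z → A x z → Facial ρ x y z
    faces-meet : ∀ {u v w x y} → A u v → A w x → A w y →
                 colour c w x ≡ colour c u v → colour c w y ≡ colour c v u → w ≡ u ⊎ w ≡ v

open Rigid

-- K stands for the number E + 2 - n of faces of a planar embedding.
record Whitney {V : Set} (A : V → V → Set) (K : ℕ) : Set where
  field
    embedding : ∃ λ ρ → Rotation A ρ × Colouring A ρ K
    euler     : ∀ {ρ k} → Rotation A ρ → Colouring A ρ k → k ≤ K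
    rigid     : ∀ {ρ} → Rotation A ρ → (c : Colouring A ρ K) → Rigid A ρ c

open Whitney

-- Orbits of a rotation at one vertex.

-- One step of `f` may become no step, one step or several steps of `T`; this is how transitivity
-- survives the deletion or insertion of a neighbour.
star-map : {V W : Set} {N : V → Set} {f : V → V} {T : W → W → Set} (h : V → W) →
           (∀ {x} → N x → N (f x)) → (∀ {x} → N x → Star T (h x) (h (f x))) →
           ∀ {x y} → N x → Star (λ x y → f x ≡ y) x y → Star T (h x) (h y)
star-map h closed step Nx ε          = ε
star-map h closed step Nx (refl ◅ s) = step Nx ◅◅ star-map h closed step (closed Nx) s

star-iter : {V : Set} {f : V → V} → ∀ {x y} → Star (λ x y → f x ≡ y) x y → ∃ λ k → iter f k x ≡ y
star-iter ε = 0 , refl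
star-iter {f = f} {x} (refl ◅ s) with star-iter s
... | k , e = suc k , trans (lemma k) e
  where
  lemma : ∀ k → f (iter f k x) ≡ iter f k (f x)
  lemma zero    = refl
  lemma (suc k) = cong f (lemma k)

iter-star : {V : Set} {f : V → V} → ∀ k {x y} → iter f k x ≡ y → Star (λ x y → f x ≡ y) x y
iter-star zero    refl = ε
iter-star (suc k) refl = iter-star k refl ◅◅ (refl ◅ ε)

iter-+ : {V : Set} (f : V → V) → ∀ a b x → iter f (a + b) x ≡ iter f a (iter f b x)
iter-+ f zero    b x = refl
iter-+ f (suc a) b x = cong f (iter-+ f a b x)

-- The orbit of z is traversed until one of x, y is reached; since both are sent to z, the
-- other one would never be reached.
predecessor : {V : Set} {f : V → V} {x y z : V} → f x ≡ z → f y ≡ z →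
       ∀ n i j → i + j ≤ n → iter f i z ≡ x → iter f j z ≡ y → x ≡ y
predecessor′ : {V : Set} {f : V → V} {x y z : V} → f x ≡ z → f y ≡ z →
        ∀ n i j → i + j ≤ n → i < j → iter f i z ≡ x → iter f j z ≡ y → x ≡ y

predecessor fx fy n i j b ei ej with ℕ.<-cmp i j
... | tri≈ _ refl _ = trans (sym ei) ej
... | tri< i<j _ _  = predecessor′ fx fy n i j b i<j ei ej
... | tri> _ _ j<i  = sym (predecessor′ fy fx n j i (subst (_≤ n) (ℕ.+-comm i j) b) j<i ej ei)

predecessor′ {f = f} {x} {y} {z} fx fy zero i (suc j) b i<j ei ej =
  contradiction (ℕ.≤-trans (ℕ.m≤n+m (suc j) i) b) (λ ())
predecessor′ {f = f} {x} {y} {z} fx fy (suc n) i j b i<j ei ej with ℕ.m≤n⇒∃[o]m+o≡n i<j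
... | d , refl = predecessor fx fy n i d (ℕ.≤-pred (ℕ.≤-trans le b)) ei (trans (sym shift) ej)
  where
  le : suc (i + d) ≤ i + (suc i + d)
  le = ℕ.m≤n+m (suc i + d) i
  shift : iter f (suc i + d) z ≡ iter f d z
  shift = begin
    iter f (suc i + d) z        ≡⟨ cong (λ k → iter f k z) (ℕ.+-comm (suc i) d) ⟩
    iter f (d + suc i) z        ≡⟨ iter-+ f d (suc i) z ⟩
    iter f d (f (iter f i z))   ≡⟨ cong (iter f d) (trans (cong f ei) fx) ⟩
    iter f d z                  ∎
    where open ≡-Reasoning

-- Both points are reachable from their common image, which is the situation of `predecessor`. Only
-- reachability is used, so the neighbourhood may be any type.
rotation-injective : {V : Set} {N : V → Set} {f : V → V} → RotationAt N f →
                     ∀ {x y} → N x → N y → f x ≡ f y → x ≡ y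
rotation-injective {f = f} (closed , reach) {x} {y} Nx Ny eq
  with star-iter (reach (closed Ny) Nx) | star-iter (reach (closed Ny) Ny)
... | i , ei | j , ej = predecessor {f = f} eq refl (i + j) i j ℕ.≤-refl ei ej

rotation-moves : {V : Set} {N : V → Set} {f : V → V} → RotationAt N f →
                 ∀ {x y} → N x → N y → x ≢ y → f x ≢ x
rotation-moves {f = f} (closed , reach) {x} {y} Nx Ny x≢y fx = x≢y (fixed (reach Nx Ny))
  where
  fixed : ∀ {w} → Star (λ a b → f a ≡ b) x w → x ≡ w
  fixed ε        = refl
  fixed (e ◅ s) with trans (sym fx) e
  ... | refl = fixed s

Cycle₃ : {V : Set} → (V → V) → V → V → V → Set
Cycle₃ f x y z = f x ≡ y × f y ≡ z × f z ≡ x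

-- The source of all case distinctions on orientation: a cubic vertex has two cyclic orders, mirror
-- images of each other.
rotation₃ : {V : Set} {N : V → Set} {f : V → V} → RotationAt N f →
            ∀ {x y z} → N x → N y → N z → x ≢ y → y ≢ z → x ≢ z →
            (∀ {v} → N v → v ≡ x ⊎ v ≡ y ⊎ v ≡ z) →
            Cycle₃ f x y z ⊎ Cycle₃ f x z y
rotation₃ {N = N} {f} rot {x} {y} {z} Nx Ny Nz x≢y y≢z x≢z nbrs with nbrs (proj₁ rot Nx)
... | inj₁ e        = contradiction e (rotation-moves rot Nx Ny x≢y)
... | inj₂ (inj₁ e) = inj₁ (e , fy , fz)
  where
  fz : f z ≡ x
  fz with nbrs (proj₁ rot Nz)
  ... | inj₁ e′        = e′
  ... | inj₂ (inj₁ e′) = contradiction (rotation-injective rot Nx Nz (trans e (sym e′))) x≢z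
  ... | inj₂ (inj₂ e′) = contradiction e′ (rotation-moves rot Nz Ny (y≢z ∘ sym))
  fy : f y ≡ z
  fy with nbrs (proj₁ rot Ny)
  ... | inj₁ e′        = contradiction (rotation-injective rot Ny Nz (trans e′ (sym fz))) y≢z
  ... | inj₂ (inj₁ e′) = contradiction e′ (rotation-moves rot Ny Nz y≢z)
  ... | inj₂ (inj₂ e′) = e′
... | inj₂ (inj₂ e) = inj₂ (e , fz , fy)
  where
  fy : f y ≡ x
  fy with nbrs (proj₁ rot Ny)
  ... | inj₁ e′        = e′
  ... | inj₂ (inj₁ e′) = contradiction e′ (rotation-moves rot Ny Nz y≢z)
  ... | inj₂ (inj₂ e′) = contradiction (rotation-injective rot Nx Ny (trans e (sym e′))) x≢y
  fz : f z ≡ y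
  fz with nbrs (proj₁ rot Nz)
  ... | inj₁ e′        = contradiction (rotation-injective rot Ny Nz (trans fy (sym e′))) y≢z
  ... | inj₂ (inj₁ e′) = e′
  ... | inj₂ (inj₂ e′) = contradiction e′ (rotation-moves rot Nz Ny (y≢z ∘ sym))

cycle₃-rotation : {V : Set} {N : V → Set} {f : V → V} {x y z : V} → Cycle₃ f x y z →
                  N x → N y → N z → (∀ {v} → N v → v ≡ x ⊎ v ≡ y ⊎ v ≡ z) → RotationAt N f
cycle₃-rotation {V} {N} {f} {x} {y} {z} (fx , fy , fz) Nx Ny Nz nbrs = closed , reach
  where
  closed : ∀ {v} → N v → N (f v)
  closed Nv with nbrs Nv
  ... | inj₁ refl        = subst N (sym fx) Ny
  ... | inj₂ (inj₁ refl) = subst N (sym fy) Nz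
  ... | inj₂ (inj₂ refl) = subst N (sym fz) Nx
  to-x : ∀ {v} → N v → Star (λ a b → f a ≡ b) v x
  to-x Nv with nbrs Nv
  ... | inj₁ refl        = ε
  ... | inj₂ (inj₁ refl) = fy ◅ fz ◅ ε
  ... | inj₂ (inj₂ refl) = fz ◅ ε
  from-x : ∀ {v} → N v → Star (λ a b → f a ≡ b) x v
  from-x Nv with nbrs Nv
  ... | inj₁ refl        = ε
  ... | inj₂ (inj₁ refl) = fx ◅ ε
  ... | inj₂ (inj₂ refl) = fx ◅ fy ◅ ε
  reach : ∀ {v w} → N v → N w → Star (λ a b → f a ≡ b) v w
  reach Nv Nw = to-x Nv ◅◅ from-x Nw

-- Transport along relabellings.

-- An isomorphism of adjacency relations that ignores isolated vertices.
record _≃_ {V W : Set} (A : V → V → Set) (B : W → W → Set) : Set where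
  field
    to       : V → W
    from     : W → V
    to-adj   : ∀ {u v} → A u v → B (to u) (to v)
    from-adj : ∀ {u v} → B u v → A (from u) (from v)
    from-to  : ∀ {u v} → A u v → from (to u) ≡ u × from (to v) ≡ v
    to-from  : ∀ {u v} → B u v → to (from u) ≡ u × to (from v) ≡ v

≃-sym : {V W : Set} {A : V → V → Set} {B : W → W → Set} → A ≃ B → B ≃ A
≃-sym i = record
  { to = from ; from = to ; to-adj = from-adj ; from-adj = to-adj ; from-to = to-from ; to-from = from-to }
  where open _≃_ i

module Pull {V W : Set} {A : V → V → Set} {B : W → W → Set} (i : A ≃ B) where
  open _≃_ i

  pull : (W → W → W) → V → V → V
  pull ρ u v = from (ρ (to u) (to v))

  pull-rotation : ∀ {ρ} → Rotation B ρ → Rotation A (pull ρ)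
  pull-rotation {ρ} rot u = closed , reach
    where
    back : ∀ {v w} → A u v → B (to u) w → A u (from w)
    back Auv Buw = subst (λ x → A x _) (proj₁ (from-to Auv)) (from-adj Buw)
    closed : ∀ {v} → A u v → A u (pull ρ u v)
    closed Auv = back Auv (proj₁ (rot (to u)) (to-adj Auv))
    reach : ∀ {v w} → A u v → A u w → Star (λ x y → pull ρ u x ≡ y) v w
    reach {v} {w} Auv Auw = subst₂ (Star _) (proj₂ (from-to Auv)) (proj₂ (from-to Auw))
      (star-map {N = B (to u)} {f = ρ (to u)} from (proj₁ (rot (to u)))
        (λ Bx → cong (from ∘ ρ (to u)) (proj₂ (to-from Bx)) ◅ ε)
        (to-adj Auv) (proj₂ (rot (to u)) (to-adj Auv) (to-adj Auw)))

  pull-colouring : ∀ {ρ k} → (∀ {u v} → B u v → B v u) → Rotation B ρ →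
                   Colouring B ρ k → Colouring A (pull ρ) k
  pull-colouring {ρ} symB rot c = record
    { colour     = λ u v → colour c (to u) (to v)
    ; invariant  = λ {u} {v} Auv → trans (invariant c (to-adj Auv))
        (cong (colour c (to v)) (sym (proj₂ (to-from (proj₁ (rot (to v)) (symB (to-adj Auv)))))))
    ; surjective = surj }
    where
    surj : ∀ i → ∃₂ λ u v → A u v × colour c (to u) (to v) ≡ i
    surj i with surjective c i
    ... | u , v , Buv , e = from u , from v , from-adj Buv ,
          trans (cong₂ (colour c) (proj₁ (to-from Buv)) (proj₂ (to-from Buv))) e

  push-face : ∀ {ρ} → Rotation B ρ → ∀ {x y z} → B x y → B y x → B y z → B z y → B x z → B z x →
              Face (pull ρ) (from x) (from y) (from z) → Face ρ x y z
  push-face {ρ} rot {x} {y} {z} xy yx yz zy xz zx (e₁ , e₂ , e₃) =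
    half yx yz e₁ , half zy zx e₂ , half xz xy e₃
    where
    half : ∀ {x y z} → B y x → B y z → pull ρ (from y) (from x) ≡ from z → ρ y x ≡ z
    half {x} {y} {z} yx yz e = begin
      ρ y x                                  ≡⟨ sym (proj₂ (to-from (proj₁ (rot y) yx))) ⟩
      to (from (ρ y x))                      ≡⟨ cong to (sym (cong₂ (λ a b → from (ρ a b)) (proj₁ (to-from yx)) (proj₂ (to-from yx)))) ⟩
      to (pull ρ (from y) (from x))          ≡⟨ cong to e ⟩
      to (from z)                            ≡⟨ proj₂ (to-from yz) ⟩
      z                                      ∎
      where open ≡-Reasoning

  -- Rigidity travels against `pull`: it is established for the relabelled rotation and wanted for
  -- the original one. Only darts of `B` occur in the claim, so `to-from` is enough to return.
  push-rigid : ∀ {ρ k} (symB : ∀ {u v} → B u v → B v u) (rot : Rotation B ρ) (c : Colouring B ρ k) →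
               Rigid A (pull ρ) (pull-colouring symB rot c) → Rigid B ρ c
  push-rigid {ρ} symB rot c r = record { triangles = tri ; faces-meet = fm }
    where
    tri : ∀ {x y z} → B x y → B y z → B x z → Facial ρ x y z
    tri xy yz xz with triangles r (from-adj xy) (from-adj yz) (from-adj xz)
    ... | inj₁ f = inj₁ (push-face rot xy (symB xy) yz (symB yz) xz (symB xz) f)
    ... | inj₂ f = inj₂ (push-face rot xz (symB xz) (symB yz) yz xy (symB xy) f)
    same-colour : ∀ {u v} → B u v → colour c (to (from u)) (to (from v)) ≡ colour c u v
    same-colour b = cong₂ (colour c) (proj₁ (to-from b)) (proj₂ (to-from b))
    fm : ∀ {u v w x y} → B u v → B w x → B w y →
         colour c w x ≡ colour c u v → colour c w y ≡ colour c v u → w ≡ u ⊎ w ≡ v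
    fm {u} {v} {w} uv wx wy e₁ e₂
      with faces-meet r (from-adj uv) (from-adj wx) (from-adj wy)
             (trans (same-colour wx) (trans e₁ (sym (same-colour uv))))
             (trans (same-colour wy) (trans e₂ (sym (same-colour (symB uv)))))
    ... | inj₁ e = inj₁ (trans (sym (proj₁ (to-from wx))) (trans (cong to e) (proj₁ (to-from uv))))
    ... | inj₂ e = inj₂ (trans (sym (proj₁ (to-from wx))) (trans (cong to e) (proj₂ (to-from uv))))

≃-whitney : {V W : Set} {A : V → V → Set} {B : W → W → Set} {K : ℕ} →
            (∀ {u v} → A u v → A v u) → A ≃ B → Whitney A K → Whitney B K
≃-whitney {A = A} {B} {K} symA i w = record
  { embedding = let ρ , rot , c = embedding w in
      I.pull ρ , I.pull-rotation rot , I.pull-colouring symA rot c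
  ; euler     = λ rot c → euler w (J.pull-rotation rot) (J.pull-colouring symB rot c)
  ; rigid     = λ rot c → J.push-rigid symB rot c
      (rigid w (J.pull-rotation rot) (J.pull-colouring symB rot c)) }
  where
  open _≃_ i
  module I = Pull (≃-sym i)
  module J = Pull i
  symB : ∀ {u v} → B u v → B v u
  symB uv = subst₂ B (proj₂ (to-from uv)) (proj₁ (to-from uv)) (to-adj (symA (from-adj uv)))

-- Maximal colourings and the merging of colours.

-- A colouring with the maximal number of colours separates the faces: recolouring a closed
-- part of a colour class would give a colouring with more colours.
colour-class : {V : Set} {A : V → V → Set} {ρ : V → V → V} {K : ℕ} →
  (∀ {k} → Colouring A ρ k → k ≤ K) → (c : Colouring A ρ K) → (S : V → V → Bool) →
  (∀ {u v} → A u v → S u v ≡ S v (ρ v u)) →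
  ∀ {u v u′ v′} → A u v → A u′ v′ → S u v ≡ true → colour c u′ v′ ≡ colour c u v → S u′ v′ ≡ true
colour-class {V} {A} {ρ} {K} bound c S inv {u} {v} {u′} {v′} uv uv′ Suv same
  with S u′ v′ in Suv′
... | true  = refl
... | false = contradiction (bound split) (ℕ.<-irrefl refl)
  where
  i : Fin K
  i = colour c u v

  recolour : Bool → Fin K → Fin (suc K)
  recolour true  j with j Fin.≟ i
  ... | yes _ = zero
  ... | no _  = suc j
  recolour false j = suc j

  recolour-≢ : ∀ b {j} → j ≢ i → recolour b j ≡ suc j
  recolour-≢ true {j} j≢i with j Fin.≟ i
  ... | yes e = contradiction e j≢i
  ... | no _  = refl
  recolour-≢ false j≢i = refl

  recolour-≡ : recolour true i ≡ zero
  recolour-≡ with i Fin.≟ i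
  ... | yes _ = refl
  ... | no ne = contradiction refl ne

  surj : ∀ j → ∃₂ λ x y → A x y × recolour (S x y) (colour c x y) ≡ j
  surj zero    = u , v , uv , trans (cong (λ b → recolour b i) Suv) recolour-≡
  surj (suc j) with j Fin.≟ i
  ... | yes refl = u′ , v′ , uv′ , trans (cong (λ b → recolour b _) Suv′) (cong suc same)
  ... | no j≢i with surjective c j
  ...   | x , y , xy , refl = x , y , xy , recolour-≢ (S x y) j≢i

  split : Colouring A ρ (suc K)
  split = record
    { colour     = λ x y → recolour (S x y) (colour c x y)
    ; invariant  = λ xy → cong₂ recolour (inv xy) (invariant c xy)
    ; surjective = surj }

data OnTriangle {V : Set} (x y z : V) : V → V → Set where
  side₁ : OnTriangle x y z x y
  side₂ : OnTriangle x y z y z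
  side₃ : OnTriangle x y z z x

-- The three sides of a facial triangle are closed under the face step, and also backwards because
-- rotations are injective, so `colour-class` applies to them. `S` is their characteristic function,
-- passed in because `V` carries no decidable equality.
face-colour : {V : Set} {A : V → V → Set} {ρ : V → V → V} {K : ℕ} →
  (∀ {u v} → A u v → A v u) → Rotation A ρ →
  (∀ {k} → Colouring A ρ k → k ≤ K) → (c : Colouring A ρ K) →
  ∀ {x y z} → Face ρ x y z → A x y → A y z → A z x →
  (S : V → V → Bool) → (∀ {u v} → OnTriangle x y z u v → S u v ≡ true) →
  (∀ u v → S u v ≡ true → OnTriangle x y z u v) →
  ∀ {u v} → A u v → colour c u v ≡ colour c x y → OnTriangle x y z u v
face-colour {A = A} {ρ} symA rot bound c {x} {y} {z} (ρyx , ρzy , ρxz) xy yz zx S complete sound {u} {v} uv same =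
  sound u v (colour-class bound c S closed xy uv (complete side₁) same)
  where
  forward : ∀ {u v} → OnTriangle x y z u v → OnTriangle x y z v (ρ v u)
  forward side₁ = subst (OnTriangle x y z y) (sym ρyx) side₂
  forward side₂ = subst (OnTriangle x y z z) (sym ρzy) side₃
  forward side₃ = subst (OnTriangle x y z x) (sym ρxz) side₁
  backward : ∀ {u v w} → A v u → ρ v u ≡ w → OnTriangle x y z v w → OnTriangle x y z u v
  backward vu e side₁ with rotation-injective (rot x) vu (symA zx) (trans e (sym ρxz))
  ... | refl = side₃
  backward vu e side₂ with rotation-injective (rot y) vu (symA xy) (trans e (sym ρyx))
  ... | refl = side₁
  backward vu e side₃ with rotation-injective (rot z) vu (symA yz) (trans e (sym ρzy))
  ... | refl = side₂
  closed : ∀ {u v} → A u v → S u v ≡ S v (ρ v u)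
  closed {u} {v} uv with S u v in e | S v (ρ v u) in e′
  ... | true  | true  = refl
  ... | false | false = refl
  ... | true  | false = trans (sym (complete (forward (sound u v e)))) e′
  ... | false | true  = trans (sym e) (complete (backward (symA uv) refl (sound v (ρ v u) e′)))

-- If an edge had the same face on both sides, then the end of the next edge of that face
-- would lie on both sides.
two-sided : {V : Set} {A : V → V → Set} {ρ : V → V → V} {k : ℕ} →
  (∀ {u v} → A u v → A v u) → Rotation A ρ → (c : Colouring A ρ k) → Rigid A ρ c →
  ∀ {u v} → A u v → ρ v u ≢ u → ρ v u ≢ v → colour c u v ≢ colour c v u
two-sided {A = A} {ρ} symA rot c r {u} {v} uv w≢u w≢v same
  with faces-meet r uv ww ww (sym e) (trans (sym e) same)
  where
  vw : A v (ρ v u)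
  vw = proj₁ (rot v) (symA uv)
  ww : A (ρ v u) (ρ (ρ v u) v)
  ww = proj₁ (rot (ρ v u)) (symA vw)
  e : colour c u v ≡ colour c (ρ v u) (ρ (ρ v u) v)
  e = trans (invariant c uv) (invariant c vw)
... | inj₁ w≡u = w≢u w≡u
... | inj₂ w≡v = w≢v w≡v

-- The quotient of `Fin k` that identifies `i` with `j`: the index `i` is removed and sent to where
-- `j` goes, and `punchIn i` is a section.
glue : ∀ {k} (i j : Fin k) → i ≢ j →
       ∃ λ k′ → k ≡ suc k′ × Σ (Fin k → Fin k′) λ m → m i ≡ m j × (∀ t → ∃ λ y → m y ≡ t)
glue {suc k} i j i≢j = k , refl , m , trans m-i (sym m-j) , λ t → punchIn i t , m-in t
  where
  m : Fin (suc k) → Fin k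
  m x with i Fin.≟ x
  ... | yes _  = punchOut i≢j
  ... | no i≢x = punchOut i≢x
  m-i : m i ≡ punchOut i≢j
  m-i with i Fin.≟ i
  ... | yes _ = refl
  ... | no ne = contradiction refl ne
  m-j : m j ≡ punchOut i≢j
  m-j with i Fin.≟ j
  ... | yes e = contradiction e i≢j
  ... | no _  = Fin.punchOut-cong i refl
  m-in : ∀ t → m (punchIn i t) ≡ t
  m-in t with i Fin.≟ punchIn i t
  ... | yes e = contradiction (sym e) (Fin.punchInᵢ≢i i t)
  ... | no _  = trans (Fin.punchOut-cong i refl) (Fin.punchOut-punchIn i)

-- Bound and equality case together. If `i` and `j` are already equal, the identity is an admissible
-- gluing and no colour is lost, so `k ≤ K`; otherwise `glue` loses exactly one.
merge-bound : ∀ {K k} {i j : Fin k} →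
  (∀ {k′} (m : Fin k → Fin k′) → m i ≡ m j → (∀ t → ∃ λ y → m y ≡ t) → k′ ≤ K) →
  k ≤ suc K × (k ≡ suc K → i ≢ j)
merge-bound {K} {k} {i} {j} bound = le , λ { refl refl → ℕ.<-irrefl refl (bound (λ x → x) refl (λ t → t , refl)) }
  where
  le : k ≤ suc K
  le with i Fin.≟ j
  ... | yes refl = ℕ.m≤n⇒m≤1+n (bound (λ x → x) refl (λ t → t , refl))
  ... | no i≢j with glue i j i≢j
  ...   | k′ , refl , m , e , surj = s≤s (bound m e surj)

-- Counting by enumerations.

T-true : ∀ {b} → T b → b ≡ true
T-true {true} _ = refl

record Enumeration {A : Set} (P : A → Set) (k : ℕ) : Set where
  field
    enum      : Fin k → A
    sound     : ∀ i → P (enum i)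
    injective : ∀ {i j} → enum i ≡ enum j → i ≡ j
    complete  : ∀ {x} → P x → ∃ λ i → enum i ≡ x

open Enumeration

enumeration-≤ : {A : Set} {P : A → Set} {k l : ℕ} → Enumeration P k → Enumeration P l → k ≤ l
enumeration-≤ e f = Fin.injective⇒≤ {f = λ i → proj₁ (complete f (sound e i))} λ {i} {j} eq →
  injective e (trans (sym (proj₂ (complete f (sound e i))))
    (trans (cong (enum f) eq) (proj₂ (complete f (sound e j)))))

enumeration-unique : {A : Set} {P : A → Set} {k l : ℕ} → Enumeration P k → Enumeration P l → k ≡ l
enumeration-unique e f = ℕ.≤-antisym (enumeration-≤ e f) (enumeration-≤ f e)

reindex : {A B : Set} {P : A → Set} {Q : B → Set} {k : ℕ} (f : A → B) (g : B → A) →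
          (∀ x → P x → Q (f x)) → (∀ x → P x → g (f x) ≡ x) →
          (∀ y → Q y → P (g y)) → (∀ y → Q y → f (g y) ≡ y) →
          Enumeration P k → Enumeration Q k
reindex f g f-Q gf g-P fg e = record
  { enum      = f ∘ enum e
  ; sound     = λ i → f-Q _ (sound e i)
  ; injective = λ {i} {j} eq → injective e (trans (sym (gf _ (sound e i))) (trans (cong g eq) (gf _ (sound e j))))
  ; complete  = λ Qy → let i , eq = complete e (g-P _ Qy) in i , trans (cong f eq) (fg _ Qy) }

sum-enumeration : {A B : Set} {P : A → Set} {Q : B → Set} {k l : ℕ} →
                  Enumeration P k → Enumeration Q l → Enumeration [ P , Q ]′ (k + l)
sum-enumeration {P = P} {Q} {k} {l} e f = record
  { enum = en ∘ splitAt k ; sound = sd ∘ splitAt k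
  ; injective = λ {i} {j} eq → trans (sym (Fin.join-splitAt k l i))
      (trans (cong (join k l) (inj (splitAt k i) (splitAt k j) eq)) (Fin.join-splitAt k l j))
  ; complete = λ {x} Px → let i , eq = com x Px in
      join k l i , trans (cong en (Fin.splitAt-join k l i)) eq }
  where
  en : Fin k ⊎ Fin l → _
  en = Sum.map (enum e) (enum f)
  sd : ∀ i → [ P , Q ]′ (en i)
  sd (inj₁ i) = sound e i
  sd (inj₂ i) = sound f i
  inj : ∀ i j → en i ≡ en j → i ≡ j
  inj (inj₁ i) (inj₁ j) eq = cong inj₁ (injective e (inj₁-injective eq))
  inj (inj₂ i) (inj₂ j) eq = cong inj₂ (injective f (inj₂-injective eq))
  com : ∀ x → [ P , Q ]′ x → ∃ λ i → en i ≡ x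
  com (inj₁ x) Px = let i , eq = complete e Px in inj₁ i , cong inj₁ eq
  com (inj₂ y) Qy = let i , eq = complete f Qy in inj₂ i , cong inj₂ eq

fin-enumeration : ∀ n → Enumeration {Fin n} (λ _ → ⊤) n
fin-enumeration n = record
  { enum = λ i → i ; sound = λ _ → tt ; injective = λ eq → eq ; complete = λ {x} _ → x , refl }

count-enumeration : {A : Set} (f : A → Bool) (xs : List A) → Unique xs →
                    Enumeration (λ x → x ∈ xs × f x ≡ true) (countB f xs)
count-enumeration f [] _ = record
  { enum = λ () ; sound = λ () ; injective = λ {} ; complete = λ { (() , _) } }
count-enumeration f (x ∷ xs) (x∉xs ∷ unique) with f x in px
... | false = reindex (λ y → y) (λ y → y) (λ { _ (y∈ , py) → there y∈ , py }) (λ _ _ → refl)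
        (λ { _ (here refl , py) → contradiction (trans (sym px) py) (λ ()) ; _ (there y∈ , py) → y∈ , py })
        (λ _ _ → refl) (count-enumeration f xs unique)
... | true = record { enum = en ; sound = sd ; injective = inj _ _ ; complete = com }
  where
  e = count-enumeration f xs unique
  en : Fin (suc (countB f xs)) → _
  en zero    = x
  en (suc i) = enum e i
  sd : ∀ i → en i ∈ x ∷ xs × f (en i) ≡ true
  sd zero    = here refl , px
  sd (suc i) = there (proj₁ (sound e i)) , proj₂ (sound e i)
  inj : ∀ i j → en i ≡ en j → i ≡ j
  inj zero zero eq = refl
  inj zero (suc j) eq = contradiction eq (lookup x∉xs (proj₁ (sound e j)))
  inj (suc i) zero eq = contradiction (sym eq) (lookup x∉xs (proj₁ (sound e i)))
  inj (suc i) (suc j) eq = cong suc (injective e eq)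
  com : ∀ {y} → y ∈ x ∷ xs × f y ≡ true → ∃ λ i → en i ≡ y
  com (here refl , _) = zero , refl
  com (there y∈ , py) = let i , eq = complete e (y∈ , py) in suc i , eq

full-count : {A : Set} (f : A → Bool) (xs : List A) → Unique xs → (∀ x → x ∈ xs) →
             Enumeration (λ x → f x ≡ true) (countB f xs)
full-count f xs unique all = reindex (λ x → x) (λ x → x) (λ _ → proj₂) (λ _ _ → refl) (λ x px → all x , px)
  (λ _ _ → refl) (count-enumeration f xs unique)

neighbours : (G : Graph) (v : V G) → Enumeration (Adj G v) (degree G v)
neighbours G v = full-count (adj G v) (allFin (n G)) (Unique.allFin⁺ (n G)) ∈-allFin

darts-cartesian : (G : Graph) → darts G ≡ cartesianProduct (allFin (n G)) (allFin (n G))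
darts-cartesian G = go (allFin (n G))
  where
  go : ∀ us → concatMap (λ u → map (λ v → u , v) (allFin (n G))) us ≡ cartesianProduct us (allFin (n G))
  go []       = refl
  go (u ∷ us) = cong (map (λ v → u , v) (allFin (n G)) ++_) (go us)

darts-unique : (G : Graph) → Unique (darts G)
darts-unique G = subst Unique (sym (darts-cartesian G))
  (Unique.cartesianProduct⁺ (Unique.allFin⁺ (n G)) (Unique.allFin⁺ (n G)))

darts-complete : (G : Graph) (d : Dart G) → d ∈ darts G
darts-complete G d = subst (d ∈_) (sym (darts-cartesian G)) (∈-cartesianProduct⁺ (∈-allFin _) (∈-allFin _))

Darts : {V : Set} (A : V → V → Set) → V × V → Set
Darts A (u , v) = A u v

-- `numEdges` counts the darts with the smaller end first; the others are their reversals. That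
-- order is not respected by relabellings, whereas the set of darts is, so edge numbers are compared
-- through their doubles.
graph-darts : (G : Graph) → Enumeration (Darts (Adj G)) (numEdges G + numEdges G)
graph-darts G = reindex f g f-Q gf g-P fg (sum-enumeration edges edges)
  where
  up : Dart G → Bool
  up (u , v) = adj G u v ∧ (toℕ u <ᵇ toℕ v)
  edges : Enumeration (λ d → up d ≡ true) (numEdges G)
  edges = full-count up (darts G) (darts-unique G) (darts-complete G)
  f : Dart G ⊎ Dart G → Dart G
  f (inj₁ d) = d
  f (inj₂ d) = Product.swap d
  g : Dart G → Dart G ⊎ Dart G
  g (u , v) = if toℕ u <ᵇ toℕ v then inj₁ (u , v) else inj₂ (v , u)
  split : ∀ u v → up (u , v) ≡ true → Adj G u v × (toℕ u <ᵇ toℕ v) ≡ true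
  split u v e with adj G u v
  ... | true = refl , e
  unsplit : ∀ {u v} → Adj G u v → (toℕ u <ᵇ toℕ v) ≡ true → up (u , v) ≡ true
  unsplit e l = cong₂ _∧_ e l
  reverse : ∀ {u v} → Adj G u v → Adj G v u
  reverse {u} {v} e = trans (Graph.sym G v u) e
  flip-< : ∀ u v → Adj G u v → (toℕ u <ᵇ toℕ v) ≡ false → (toℕ v <ᵇ toℕ u) ≡ true
  flip-< u v uv l with ℕ.<-cmp (toℕ u) (toℕ v)
  ... | tri< u<v _ _ = contradiction (trans (sym (T-true (ℕ.<⇒<ᵇ u<v))) l) (λ ())
  ... | tri> _ _ v<u = T-true (ℕ.<⇒<ᵇ v<u)
  ... | tri≈ _ u≡v _ with Fin.toℕ-injective u≡v
  ...   | refl = contradiction (trans (sym uv) (irrefl G u)) (λ ())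
  <-asym : ∀ a b → (a <ᵇ b) ≡ true → (b <ᵇ a) ≡ false
  <-asym zero    (suc b) _ = refl
  <-asym (suc a) (suc b) l = <-asym a b l
  f-Q : ∀ x → [ (λ d → up d ≡ true) , (λ d → up d ≡ true) ]′ x → Darts (Adj G) (f x)
  f-Q (inj₁ (u , v)) e = proj₁ (split u v e)
  f-Q (inj₂ (u , v)) e = reverse (proj₁ (split u v e))
  gf : ∀ x → [ (λ d → up d ≡ true) , (λ d → up d ≡ true) ]′ x → g (f x) ≡ x
  gf (inj₁ (u , v)) e rewrite proj₂ (split u v e) = refl
  gf (inj₂ (u , v)) e rewrite <-asym (toℕ u) (toℕ v) (proj₂ (split u v e)) = refl
  g-P : ∀ d → Darts (Adj G) d → [ (λ d → up d ≡ true) , (λ d → up d ≡ true) ]′ (g d)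
  g-P (u , v) e with toℕ u <ᵇ toℕ v in l
  ... | true  = unsplit e l
  ... | false = unsplit (reverse e) (flip-< u v e l)
  fg : ∀ d → Darts (Adj G) d → f (g d) ≡ d
  fg (u , v) e with toℕ u <ᵇ toℕ v
  ... | true  = refl
  ... | false = refl

≃-darts : {V W : Set} {A : V → V → Set} {B : W → W → Set} {m : ℕ} → A ≃ B →
          Enumeration (Darts A) m → Enumeration (Darts B) m
≃-darts i = reindex (Product.map to to) (Product.map from from) (λ _ → to-adj)
  (λ _ e → cong₂ _,_ (proj₁ (from-to e)) (proj₂ (from-to e))) (λ _ → from-adj)
  (λ _ e → cong₂ _,_ (proj₁ (to-from e)) (proj₂ (to-from e)))
  where open _≃_ i

third : {A : Set} {P : A → Set} → Enumeration P 3 → ∀ {x y} → P x → P y → x ≢ y →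
        ∃ λ z → P z × z ≢ x × z ≢ y × (∀ {w} → P w → w ≡ x ⊎ w ≡ y ⊎ w ≡ z)
third {P = P} e Px Py x≢y with complete e Px | complete e Py
... | i , refl | j , refl with third-index i j (λ i≡j → x≢y (cong (enum e) i≡j))
  where
  third-index : ∀ (i j : Fin 3) → i ≢ j → ∃ λ k → k ≢ i × k ≢ j × (∀ l → l ≡ i ⊎ l ≡ j ⊎ l ≡ k)
  third-index zero zero ne = contradiction refl ne
  third-index (suc zero) (suc zero) ne = contradiction refl ne
  third-index (suc (suc zero)) (suc (suc zero)) ne = contradiction refl ne
  third-index zero (suc zero) _ = suc (suc zero) , (λ ()) , (λ ()) ,
    λ { zero → inj₁ refl ; (suc zero) → inj₂ (inj₁ refl) ; (suc (suc zero)) → inj₂ (inj₂ refl) }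
  third-index zero (suc (suc zero)) _ = suc zero , (λ ()) , (λ ()) ,
    λ { zero → inj₁ refl ; (suc (suc zero)) → inj₂ (inj₁ refl) ; (suc zero) → inj₂ (inj₂ refl) }
  third-index (suc zero) zero _ = suc (suc zero) , (λ ()) , (λ ()) ,
    λ { (suc zero) → inj₁ refl ; zero → inj₂ (inj₁ refl) ; (suc (suc zero)) → inj₂ (inj₂ refl) }
  third-index (suc zero) (suc (suc zero)) _ = zero , (λ ()) , (λ ()) ,
    λ { (suc zero) → inj₁ refl ; (suc (suc zero)) → inj₂ (inj₁ refl) ; zero → inj₂ (inj₂ refl) }
  third-index (suc (suc zero)) zero _ = suc zero , (λ ()) , (λ ()) ,
    λ { (suc (suc zero)) → inj₁ refl ; zero → inj₂ (inj₁ refl) ; (suc zero) → inj₂ (inj₂ refl) }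
  third-index (suc (suc zero)) (suc zero) _ = zero , (λ ()) , (λ ()) ,
    λ { (suc (suc zero)) → inj₁ refl ; (suc zero) → inj₂ (inj₁ refl) ; zero → inj₂ (inj₂ refl) }
...   | k , k≢i , k≢j , cover = enum e k , sound e k ,
        (λ eq → k≢i (injective e eq)) , (λ eq → k≢j (injective e eq)) ,
        λ Pw → let l , eq = complete e Pw in
          Sum.map (λ c → trans (sym eq) (cong (enum e) c))
            (Sum.map (λ c → trans (sym eq) (cong (enum e) c)) (λ c → trans (sym eq) (cong (enum e) c))) (cover l)

double-injective : ∀ m n → m + m ≡ n + n → m ≡ n
double-injective zero    zero    _ = refl
double-injective (suc m) (suc n) e = cong suc (double-injective m n
  (ℕ.suc-injective (trans (sym (ℕ.+-suc m m)) (trans (ℕ.suc-injective e) (ℕ.+-suc n n)))))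

-- Face orbits and `numFaces`.

true-T : ∀ {b} → b ≡ true → T b
true-T refl = tt

allB-sound : {A : Set} (f : A → Bool) (xs : List A) → allB f xs ≡ true → ∀ {x} → x ∈ xs → f x ≡ true
allB-sound f (y ∷ ys) e x∈ with f y in fy
allB-sound f (y ∷ ys) e (here refl) | true = fy
allB-sound f (y ∷ ys) e (there x∈)  | true = allB-sound f ys e x∈

allB-complete : {A : Set} (f : A → Bool) (xs : List A) → (∀ x → f x ≡ true) → allB f xs ≡ true
allB-complete f []       all = refl
allB-complete f (x ∷ xs) all = cong₂ _∧_ (all x) (allB-complete f xs all)

∧-true : ∀ {a b} → a ∧ b ≡ true → a ≡ true × b ≡ true
∧-true {true} e = refl , e

bounded-minimum : (f : ℕ → ℕ) (N : ℕ) → ∃ λ k → ∀ j → j ≤ N → f k ≤ f j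
bounded-minimum f zero = 0 , λ { zero _ → ℕ.≤-refl }
bounded-minimum f (suc N) with bounded-minimum f N
... | k , min with ℕ.≤-total (f k) (f (suc N))
...   | inj₁ le = k , λ j j≤ → [ (λ j< → min j (ℕ.≤-pred j<)) , (λ { refl → le }) ]′ (ℕ.m≤n⇒m<n∨m≡n j≤)
...   | inj₂ ge = suc N , λ j j≤ → [ (λ j< → ℕ.≤-trans ge (min j (ℕ.≤-pred j<))) , (λ { refl → ℕ.≤-refl }) ]′ (ℕ.m≤n⇒m<n∨m≡n j≤)

module Faces (G : Graph) (ρ : V G → V G → V G) (rot : Rotation (Adj G) ρ) where

  φ : Dart G → Dart G
  φ = faceStep G ρ

  Proper : Dart G → Set
  Proper = Darts (Adj G)

  adj-sym : ∀ {u v} → Adj G u v → Adj G v u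
  adj-sym {u} {v} e = trans (Graph.sym G v u) e

  φ-proper : ∀ {d} → Proper d → Proper (φ d)
  φ-proper {u , v} e = proj₁ (rot v) (adj-sym e)

  iter-proper : ∀ k {d} → Proper d → Proper (iter φ k d)
  iter-proper zero    e = e
  iter-proper (suc k) e = φ-proper {iter φ k _} (iter-proper k e)

  φ-injective : ∀ {d d′} → Proper d → Proper d′ → φ d ≡ φ d′ → d ≡ d′
  φ-injective {u , v} {u′ , v′} e e′ eq with cong proj₁ eq
  ... | refl = cong (_, v) (rotation-injective (rot v) (adj-sym e) (adj-sym e′) (cong proj₂ eq))

  iter-injective : ∀ k {d d′} → Proper d → Proper d′ → iter φ k d ≡ iter φ k d′ → d ≡ d′
  iter-injective zero    e e′ eq = eq
  iter-injective (suc k) e e′ eq = iter-injective k e e′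
    (φ-injective {iter φ k _} {iter φ k _} (iter-proper k e) (iter-proper k e′) eq)

  code : Dart G → Fin (n G * n G)
  code (u , v) = combine u v

  code-injective : ∀ {d d′} → code d ≡ code d′ → d ≡ d′
  code-injective {u , v} {u′ , v′} eq = let e , e′ = Fin.combine-injective u v u′ v′ eq in cong₂ _,_ e e′

  key-code : ∀ d → key G d ≡ toℕ (code d)
  key-code (u , v) = trans (cong (_+ toℕ v) (ℕ.*-comm (toℕ u) (n G))) (sym (Fin.toℕ-combine u v))

  key-injective : ∀ {d d′} → key G d ≡ key G d′ → d ≡ d′
  key-injective {d} {d′} eq = code-injective (Fin.toℕ-injective (trans (sym (key-code d)) (trans eq (key-code d′))))

  -- Among `n * n + 1` iterates two coincide, and injectivity of the face step cancels the common
  -- initial part, so the orbit returns to `d` itself.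
  period : ∀ {d} → Proper d → ∃ λ P → suc P ≤ n G * n G × iter φ (suc P) d ≡ d
  period {d} e with Fin.pigeonhole (ℕ.n<1+n (n G * n G)) (λ i → code (iter φ (toℕ i) d))
  ... | i , j , i<j , eq with ℕ.m≤n⇒∃[o]m+o≡n i<j
  ...   | P , si+P≡j = P , ℕ.≤-trans (ℕ.m≤n+m (suc P) (toℕ i)) (ℕ.≤-trans (ℕ.≤-reflexive i+sP≡j) (ℕ.≤-pred (Fin.toℕ<n j)))
    , iter-injective (toℕ i) (iter-proper (suc P) e) e
        (trans (sym (iter-+ φ (toℕ i) (suc P) d))
          (trans (cong (λ k → iter φ k d) i+sP≡j) (sym (code-injective eq))))
    where
    i+sP≡j : toℕ i + suc P ≡ toℕ j
    i+sP≡j = trans (ℕ.+-suc (toℕ i) P) si+P≡j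

  iter-multiple : ∀ {d} P → iter φ P d ≡ d → ∀ k → iter φ (k * P) d ≡ d
  iter-multiple P eq zero    = refl
  iter-multiple P eq (suc k) = trans (iter-+ φ P (k * P) _) (trans (cong (iter φ P) (iter-multiple P eq k)) eq)

  -- Reduction of `k` modulo the period. Hence the `n * n` iterates inspected by `isFaceRep` cover
  -- the whole orbit.
  reach-small : ∀ {d} → Proper d → ∀ k → ∃ λ j → suc j ≤ n G * n G × iter φ j d ≡ iter φ k d
  reach-small {d} e k with period e
  ... | P , P≤ , eq = k % suc P , ℕ.≤-trans (m%n<n k (suc P)) P≤ , (begin
      iter φ (k % suc P) d                                        ≡⟨ cong (iter φ (k % suc P)) (sym (iter-multiple (suc P) eq (k / suc P))) ⟩
      iter φ (k % suc P) (iter φ (k / suc P * suc P) d)           ≡⟨ sym (iter-+ φ (k % suc P) (k / suc P * suc P) d) ⟩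
      iter φ (k % suc P + k / suc P * suc P) d                    ≡⟨ cong (λ j → iter φ j d) (sym (m≡m%n+[m/n]*n k (suc P))) ⟩
      iter φ k d                                                  ∎)
    where open ≡-Reasoning

  reach-back : ∀ {d} → Proper d → ∀ k → ∃ λ j → iter φ j (iter φ k d) ≡ d
  reach-back {d} e k with period e
  -- `suc P` is a period, and `k * P + k` is a multiple of it.
  ... | P , _ , eq = k * P , trans (sym (iter-+ φ (k * P) k d))
    (trans (cong (λ j → iter φ j d) (trans (ℕ.+-comm (k * P) k) (sym (ℕ.*-suc k P)))) (iter-multiple (suc P) eq k))

  IsRep : Dart G → Set
  IsRep d = isFaceRep G ρ d ≡ true

  rep-minimal : ∀ {d} → IsRep d → ∀ k → key G d ≤ key G (iter φ k d)
  rep-minimal {d} r k = let proper , all = ∧-true r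
                            j , j< , eq = reach-small proper k in
    ℕ.≤-trans (ℕ.≤ᵇ⇒≤ _ _ (true-T (allB-sound _ (upTo (n G * n G)) all (∈-upTo⁺ j<))))
      (ℕ.≤-reflexive (cong (key G) eq))

  rep-unique : ∀ {d} → IsRep d → ∀ k → IsRep (iter φ k d) → d ≡ iter φ k d
  rep-unique {d} r k r′ = let j , eq = reach-back (proj₁ (∧-true r)) k in
    key-injective (ℕ.≤-antisym (rep-minimal r k)
      (ℕ.≤-trans (rep-minimal r′ j) (ℕ.≤-reflexive (cong (key G) eq))))

  rep : ∀ {d} → Proper d → ∃ λ k → IsRep (iter φ k d)
  rep {d} e with bounded-minimum (λ k → key G (iter φ k d)) (n G * n G)
  ... | k , min = k , cong₂ _∧_ (iter-proper k e) (allB-complete _ (upTo (n G * n G)) λ j →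
    T-true (ℕ.≤⇒≤ᵇ (minimal j)))
    where
    minimal : ∀ j → key G (iter φ k d) ≤ key G (iter φ j (iter φ k d))
    minimal j = let i , i< , eq = reach-small e (j + k) in
      ℕ.≤-trans (min i (ℕ.<⇒≤ i<)) (ℕ.≤-reflexive (cong (key G) (trans eq (iter-+ φ j k d))))

  reps : Enumeration IsRep (numFaces G ρ)
  reps = full-count (isFaceRep G ρ) (darts G) (darts-unique G) (darts-complete G)

  face : ∀ {d} → Proper d → Fin (numFaces G ρ)
  face e = proj₁ (complete reps (proj₂ (rep e)))

  face-rep : ∀ {d} (e : Proper d) → enum reps (face e) ≡ iter φ (proj₁ (rep e)) d
  face-rep e = proj₂ (complete reps (proj₂ (rep e)))

  -- `reach-back` leads from the representative `i` to `d`, and from there on to the chosen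
  -- representative; both lie on one orbit, so `rep-unique` identifies them.
  face-of-rep : ∀ {d} (e : Proper d) i k → iter φ k d ≡ enum reps i → face e ≡ i
  face-of-rep {d} e i k eq = injective reps (trans (face-rep e) (sym same))
    where
    a = proj₁ (rep e)
    back = reach-back e k
    path : iter φ (a + proj₁ back) (enum reps i) ≡ iter φ a d
    path = trans (iter-+ φ a (proj₁ back) (enum reps i))
             (cong (iter φ a) (trans (cong (iter φ (proj₁ back)) (sym eq)) (proj₂ back)))
    same : enum reps i ≡ iter φ a d
    same = trans (rep-unique (sound reps i) (a + proj₁ back) (subst IsRep (sym path) (proj₂ (rep e)))) path

  face-φ : ∀ {d} (e : Proper d) (e′ : Proper (φ d)) → face e ≡ face e′
  face-φ {d} e e′ = face-of-rep e (face e′) (proj₁ (rep e′) + 1)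
    (trans (iter-+ φ (proj₁ (rep e′)) 1 d) (sym (face-rep e′)))

  colour-iter : ∀ {k} (c : Colouring (Adj G) ρ k) j {d} → Proper d →
                colour c (proj₁ (iter φ j d)) (proj₂ (iter φ j d)) ≡ colour c (proj₁ d) (proj₂ d)
  colour-iter c zero    e = refl
  colour-iter c (suc j) {d} e = trans (sym (invariant c (iter-proper j e))) (colour-iter c j e)

  -- Choose a dart of each colour and take its face. The representative of that face still has the
  -- colour, so distinct colours give distinct faces.
  colours≤faces : ∀ {k} → Colouring (Adj G) ρ k → k ≤ numFaces G ρ
  colours≤faces {k} c = Fin.injective⇒≤ {f = λ i → face {dart i} (proper i)} λ {i} {j} eq →
    trans (sym (colour-rep i)) (trans (cong (λ t → colour c (proj₁ (enum reps t)) (proj₂ (enum reps t))) eq) (colour-rep j))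
    where
    dart : Fin k → Dart G
    dart i = let u , v , _ = surjective c i in u , v
    proper : ∀ i → Proper (dart i)
    proper i = let _ , _ , e , _ = surjective c i in e
    colour-rep : ∀ i → let d = enum reps (face {dart i} (proper i)) in colour c (proj₁ d) (proj₂ d) ≡ i
    colour-rep i = trans (cong (λ d → colour c (proj₁ d) (proj₂ d)) (face-rep {dart i} (proper i)))
      (trans (colour-iter c (proj₁ (rep {dart i} (proper i))) (proper i)) (proj₂ (proj₂ (proj₂ (surjective c i)))))

  module _ (junk : V G → V G → Fin (numFaces G ρ)) where
    -- A colouring must also be defined on pairs that are not adjacent, and `Fin (numFaces G ρ)`
    -- might be empty; hence `junk`. The Boolean and its equation are separate arguments so that
    -- adjacency can be matched on.
    γ : (u v : V G) (b : Bool) → adj G u v ≡ b → Fin (numFaces G ρ)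
    γ u v true  e = face {u , v} e
    γ u v false _ = junk u v

    γ-face : ∀ u v b (e : adj G u v ≡ b) (e′ : Adj G u v) → γ u v b e ≡ face {u , v} e′
    γ-face u v true  e e′ = face-of-rep {u , v} e (face {u , v} e′) (proj₁ (rep {u , v} e′)) (sym (face-rep {u , v} e′))
    γ-face u v false e e′ = contradiction (trans (sym e) e′) (λ ())

    face-colouring : Colouring (Adj G) ρ (numFaces G ρ)
    face-colouring = record
      { colour     = λ u v → γ u v (adj G u v) refl
      ; invariant  = λ {u} {v} e → let e′ = φ-proper {u , v} e in
          trans (γ-face u v _ refl e) (trans (face-φ {u , v} e e′) (sym (γ-face v (ρ v u) _ refl e′)))
      ; surjective = λ i → let u , v = enum reps i ; e = proj₁ (∧-true (sound reps i)) in
          u , v , e , trans (γ-face u v _ refl e) (face-of-rep {u , v} e i 0 refl) }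

-- Undoing D3b.

module PathReduction where

  -- (D3b) on labelled vertices: X supplies the vertices other than p, q, r, s, of which S are the
  -- neighbours of s, and p°, r° are the third neighbours of p and r.
  data PathG (X : Set) : Set where
    p q r s : PathG X
    old     : X → PathG X

  data PathH (X : Set) : Set where
    p r s : PathH X
    old   : X → PathH X

  emb : {X : Set} → PathH X → PathG X
  emb p       = p
  emb r       = r
  emb s       = s
  emb (old v) = old v

  -- The dart of `H` from `u` to `v` corresponds to the dart of `G` from `emb u` to `lift u v`. The
  -- edge `p r` is subdivided by `q`, and each of its darts is represented by its first half.
  lift : {X : Set} → PathH X → PathH X → PathG X
  lift p r = q
  lift r p = q
  lift _ v = emb v

  -- Junk at (s , q), (old u , q) and on the diagonal.
  drop : {X : Set} → PathH X → PathG X → PathH X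
  drop p q       = r
  drop r q       = p
  drop _ q       = p
  drop _ p       = p
  drop _ r       = r
  drop _ s       = s
  drop _ (old v) = old v

  record Frame : Set₁ where
    field
      X     : Set
      R     : X → X → Set
      S     : X → Set
      p° r° : X
      R-sym : ∀ {u v} → R u v → R v u

  module Path (P : Frame) where
    open Frame P

    data G : PathG X → PathG X → Set where
      pq : G p q
      qp : G q p
      qr : G q r
      rq : G r q
      qs : G q s
      sq : G s q
      ps : G p s
      sp : G s p
      rs : G r s
      sr : G s r
      po : G p (old p°)
      op : G (old p°) p
      ro : G r (old r°)
      or : G (old r°) r
      so : ∀ {v} → S v → G s (old v)
      os : ∀ {v} → S v → G (old v) s
      oo : ∀ {u v} → R u v → G (old u) (old v)

    data H : PathH X → PathH X → Set where
      pr : H p r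
      rp : H r p
      ps : H p s
      sp : H s p
      rs : H r s
      sr : H s r
      po : H p (old p°)
      op : H (old p°) p
      ro : H r (old r°)
      or : H (old r°) r
      so : ∀ {v} → S v → H s (old v)
      os : ∀ {v} → S v → H (old v) s
      oo : ∀ {u v} → R u v → H (old u) (old v)

    G-sym : ∀ {u v} → G u v → G v u
    G-sym pq = qp
    G-sym qp = pq
    G-sym qr = rq
    G-sym rq = qr
    G-sym qs = sq
    G-sym sq = qs
    G-sym ps = sp
    G-sym sp = ps
    G-sym rs = sr
    G-sym sr = rs
    G-sym po = op
    G-sym op = po
    G-sym ro = or
    G-sym or = ro
    G-sym (so e) = os e
    G-sym (os e) = so e
    G-sym (oo e) = oo (R-sym e)

    H-sym : ∀ {u v} → H u v → H v u
    H-sym pr = rp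
    H-sym rp = pr
    H-sym ps = sp
    H-sym sp = ps
    H-sym rs = sr
    H-sym sr = rs
    H-sym po = op
    H-sym op = po
    H-sym ro = or
    H-sym or = ro
    H-sym (so e) = os e
    H-sym (os e) = so e
    H-sym (oo e) = oo (R-sym e)

    q-nbrs : ∀ {v} → G q v → v ≡ p ⊎ v ≡ r ⊎ v ≡ s
    q-nbrs qp = inj₁ refl
    q-nbrs qr = inj₂ (inj₁ refl)
    q-nbrs qs = inj₂ (inj₂ refl)

    lift-adj : ∀ {u v} → H u v → G (emb u) (lift u v)
    lift-adj pr = pq
    lift-adj rp = rq
    lift-adj ps = ps
    lift-adj sp = sp
    lift-adj rs = rs
    lift-adj sr = sr
    lift-adj po = po
    lift-adj op = op
    lift-adj ro = ro
    lift-adj or = or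
    lift-adj (so e) = so e
    lift-adj (os e) = os e
    lift-adj (oo e) = oo e

    drop-lift : ∀ {u v} → H u v → drop u (lift u v) ≡ v
    drop-lift pr = refl
    drop-lift rp = refl
    drop-lift ps = refl
    drop-lift sp = refl
    drop-lift rs = refl
    drop-lift sr = refl
    drop-lift po = refl
    drop-lift op = refl
    drop-lift ro = refl
    drop-lift or = refl
    drop-lift (so e) = refl
    drop-lift (os e) = refl
    drop-lift (oo e) = refl

    -- The darts of G whose source is not q, other than s → q, correspond to the darts of H.
    data LiftedDart : PathH X → PathG X → Set where
      kept : ∀ {u v} → H u v → LiftedDart u (lift u v)
      s→q  : LiftedDart s q

    dart : ∀ u {v} → G (emb u) v → LiftedDart u v
    dart p pq = kept {p} pr
    dart p ps = kept {p} ps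
    dart p po = kept {p} po
    dart r rq = kept {r} rp
    dart r rs = kept {r} rs
    dart r ro = kept {r} ro
    dart s sp = kept {s} sp
    dart s sr = kept {s} sr
    dart s (so e) = kept {s} (so e)
    dart s sq = s→q
    dart (old u) op = kept op
    dart (old u) or = kept or
    dart (old u) (os e) = kept (os e)
    dart (old u) (oo e) = kept (oo e)

    descend : ∀ u v → G (emb u) (emb v) → H u v
    descend p s ps = ps
    descend s p sp = sp
    descend r s rs = rs
    descend s r sr = sr
    descend p (old _) po = po
    descend (old _) p op = op
    descend r (old _) ro = ro
    descend (old _) r or = or
    descend s (old _) (so e) = so e
    descend (old _) s (os e) = os e
    descend (old _) (old _) (oo e) = oo e

    module Restrict {ρ : PathG X → PathG X → PathG X} (rot : Rotation G ρ) where

      ρsq≢q : ρ s q ≢ q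
      ρsq≢q = rotation-moves (rot s) sq sp (λ ())

      -- Deletion of `q s` from the rotation at `s`: the neighbour `q` is skipped in favour of its
      -- successor. One skip is enough because the successor is not `q` again.
      shrink : PathH X → PathG X → PathH X
      shrink s q = drop s (ρ s q)
      shrink u v = drop u v

      ρᴴ : PathH X → PathH X → PathH X
      ρᴴ u v = shrink u (ρ (emb u) (lift u v))

      shrink-lift : ∀ {u v} → H u v → shrink u (lift u v) ≡ v
      shrink-lift pr = refl
      shrink-lift rp = refl
      shrink-lift ps = refl
      shrink-lift sp = refl
      shrink-lift rs = refl
      shrink-lift sr = refl
      shrink-lift po = refl
      shrink-lift op = refl
      shrink-lift ro = refl
      shrink-lift or = refl
      shrink-lift (so e) = refl
      shrink-lift (os e) = refl
      shrink-lift (oo e) = refl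

      s-dart : ∀ {v} → G s v → v ≢ q → ∃ λ w → H s w × v ≡ lift s w
      s-dart sp _ = _ , sp , refl
      s-dart sr _ = _ , sr , refl
      s-dart (so e) _ = _ , so e , refl
      s-dart sq ne = contradiction refl ne

      shrink-ρsq : ∃ λ w → H s w × ρ s q ≡ lift s w × shrink s q ≡ w
      shrink-ρsq with s-dart (proj₁ (rot s) sq) ρsq≢q
      ... | w , e , eq = w , e , eq , trans (cong (drop s) eq) (drop-lift e)

      shrink-adj : ∀ u {v} → G (emb u) v → H u (shrink u v)
      shrink-adj u e with dart u e
      ... | kept f = subst (H u) (sym (shrink-lift f)) f
      ... | s→q with shrink-ρsq
      ...   | w , f , _ , eq = subst (H s) (sym eq) f

      rotation : Rotation H ρᴴ
      rotation u = (λ e → shrink-adj u (proj₁ (rot (emb u)) (lift-adj e))) , reach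
        where
        step : ∀ {v} → G (emb u) v → Star (λ x y → ρᴴ u x ≡ y) (shrink u v) (shrink u (ρ (emb u) v))
        step e with dart u e
        ... | kept f = cong (shrink u ∘ ρ (emb u) ∘ lift u) (shrink-lift f) ◅ ε
        -- The skipped neighbour contributes an empty step, since `q` and its successor shrink to
        -- the same vertex.
        ... | s→q with shrink-ρsq
        ...   | w , f , eq , eq′ = subst (Star _ (shrink s q))
                  (trans eq′ (trans (sym (shrink-lift f)) (cong (shrink s) (sym eq)))) ε
        reach : ∀ {v w} → H u v → H u w → Star (λ x y → ρᴴ u x ≡ y) v w
        reach e f = subst₂ (Star _) (shrink-lift e) (shrink-lift f)
          (star-map {N = G (emb u)} (shrink u) (proj₁ (rot (emb u))) step (lift-adj e)
            (proj₂ (rot (emb u)) (lift-adj e) (lift-adj f)))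

      module Colours {k : ℕ} (c : Colouring G ρ k) (ρqp : ρ q p ≡ r) (ρqr : ρ q r ≡ s) (ρqs : ρ q s ≡ p) where

        γ : PathG X → PathG X → Fin k
        γ = colour c

        next : ∀ {u v w} → G u v → ρ v u ≡ w → γ u v ≡ γ v w
        next e refl = invariant c e

        -- Deleting the edge q s merges the faces on its two sides.
        module Merge {k′ : ℕ} (m : Fin k → Fin k′) (m-glues : m (γ q s) ≡ m (γ s q))
                     (m-surj : ∀ t → ∃ λ y → m y ≡ t) where

          γᴴ : PathH X → PathH X → Fin k′
          γᴴ u v = m (γ (emb u) (lift u v))

          γ-shrink : ∀ u {v} → G (emb u) v → γᴴ u (shrink u v) ≡ m (γ (emb u) v)
          γ-shrink u e with dart u e
          ... | kept f = cong (γᴴ u) (shrink-lift f)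
          ... | s→q with shrink-ρsq
          ...   | w , f , eq , eq′ = begin
            m (γ s (lift s (shrink s q)))  ≡⟨ cong (λ t → m (γ s t)) (trans (cong (lift s) eq′) (sym eq)) ⟩
            m (γ s (ρ s q))                ≡⟨ cong m (sym (invariant c qs)) ⟩
            m (γ q s)                      ≡⟨ m-glues ⟩
            m (γ s q)                      ∎
            where open ≡-Reasoning

          inv : ∀ {u v} → H u v → γᴴ u v ≡ m (γ (emb v) (ρ (emb v) (lift v u)))
          inv pr = cong m (trans (next pq ρqp) (invariant c qr))
          -- In this direction the face of `G` runs into the deleted edge, along `r q s`; the gluing
          -- carries it across to `s q p`.
          inv rp = trans (cong m (next rq ρqr)) (trans m-glues (cong m (trans (next sq ρqs) (invariant c qp))))
          inv ps = cong m (invariant c ps)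
          inv sp = cong m (invariant c sp)
          inv rs = cong m (invariant c rs)
          inv sr = cong m (invariant c sr)
          inv po = cong m (invariant c po)
          inv op = cong m (invariant c op)
          inv ro = cong m (invariant c ro)
          inv or = cong m (invariant c or)
          inv (so e) = cong m (invariant c (so e))
          inv (os e) = cong m (invariant c (os e))
          inv (oo e) = cong m (invariant c (oo e))

          hit : ∀ u {v} → G (emb u) v → ∃₂ λ x y → H x y × γᴴ x y ≡ m (γ (emb u) v)
          hit u e = u , _ , shrink-adj u e , γ-shrink u e

          -- Darts leaving `q` have no counterpart in `H`, but the next dart of the same face leaves
          -- a vertex that is kept.
          hit-q : ∀ u → G q (emb u) → ∃₂ λ x y → H x y × γᴴ x y ≡ m (γ q (emb u))
          hit-q u e with hit u (proj₁ (rot (emb u)) (G-sym e))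
          ... | x , y , f , eq = x , y , f , trans eq (cong m (sym (invariant c e)))

          hits : ∀ {u v} → G u v → ∃₂ λ x y → H x y × γᴴ x y ≡ m (γ u v)
          hits {p} e = hit p e
          hits {r} e = hit r e
          hits {s} e = hit s e
          hits {old u} e = hit (old u) e
          hits qp = hit-q p qp
          hits qr = hit-q r qr
          hits qs = hit-q s qs

          surj : ∀ t → ∃₂ λ x y → H x y × γᴴ x y ≡ t
          surj t with m-surj t
          ... | t′ , refl with surjective c t′
          ...   | u , v , e , refl = hits e

          colouring : Colouring H ρᴴ k′
          colouring = record
            { colour     = γᴴ
            ; invariant  = λ {u} {v} e → trans (inv e)
                (sym (γ-shrink v (proj₁ (rot (emb v)) (lift-adj (H-sym e)))))
            ; surjective = surj }

        bound : ∀ {K} → Whitney H K → k ≤ suc K × (k ≡ suc K → γ q s ≢ γ s q)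
        bound w = merge-bound λ m glues surj → euler w rotation (Merge.colouring m glues surj)

      module Rigidity {K : ℕ} (w : Whitney H K) (c : Colouring G ρ (suc K))
                      (euler-G : ∀ {k} → Colouring G ρ k → k ≤ suc K)
                      (ρqp : ρ q p ≡ r) (ρqr : ρ q r ≡ s) (ρqs : ρ q s ≡ p) where
        open Colours c ρqp ρqr ρqs

        qs≢sq : γ q s ≢ γ s q
        qs≢sq = proj₂ (bound w) refl

        glued : Σ (Fin (suc K) → Fin K) λ m → m (γ q s) ≡ m (γ s q) × (∀ t → ∃ λ y → m y ≡ t)
        glued with glue (γ q s) (γ s q) qs≢sq
        ... | _ , refl , m = m

        m : Fin (suc K) → Fin K
        m = proj₁ glued

        m-glues : m (γ q s) ≡ m (γ s q)
        m-glues = proj₁ (proj₂ glued)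

        open Merge m m-glues (proj₂ (proj₂ glued))

        rᴴ : Rigid H ρᴴ colouring
        rᴴ = rigid w rotation colouring

        shrink-p-s : ∀ {v} → G p v → shrink p v ≡ s → v ≡ s
        shrink-p-s ps _ = refl

        shrink-r-p : ∀ {v} → G r v → shrink r v ≡ p → v ≡ q
        shrink-r-p rq _ = refl

        shrink-s-r : ∀ {v} → G s v → shrink s v ≡ r → v ≡ r ⊎ (v ≡ q × ρ s q ≡ r)
        shrink-s-r sr _ = inj₁ refl
        shrink-s-r sq eq with shrink-ρsq
        ... | w , f , eq₁ , eq₂ with trans (sym eq₂) eq
        ...   | refl = inj₂ (refl , eq₁)

        m-rp : γᴴ r p ≡ m (γ s q)
        m-rp = trans (cong m (next rq ρqr)) m-glues

        -- The two faces at q s, as the triangle p r s of H is a face and is the one split by q s.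
        faces : ρ p q ≡ s × ρ s p ≡ q × ρ s q ≡ r × ρ r s ≡ q
        faces with triangles rᴴ pr rs ps
        ... | inj₁ (e₁ , e₂ , e₃) with faces-meet rᴴ pr sp (shrink-adj s sq)
                  (sym (trans (invariant colouring pr) (trans (cong (γᴴ r) e₁)
                    (trans (invariant colouring rs) (cong (γᴴ s) e₂)))))
                  (trans (γ-shrink s sq) (sym m-rp))
        ...   | inj₁ ()
        ...   | inj₂ ()
        faces | inj₂ (e₁ , e₂ , e₃) with shrink-p-s (proj₁ (rot p) pq) e₃ | shrink-r-p (proj₁ (rot r) rs) e₂
                                       | shrink-s-r (proj₁ (rot s) sp) e₁
        ... | ρpq | ρrs | inj₂ (ρsp , ρsq) = ρpq , ρsp , ρsq , ρrs
        -- If `r` followed `p` directly at `s`, a single face would run through `s q p s r q s`,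
        -- along both sides of `q s`.
        ... | ρpq | ρrs | inj₁ ρsp = contradiction
          (sym (trans (next sq ρqs) (trans (next qp ρpq) (trans (next ps ρsp) (trans (next sr ρrs) (next rq ρqr))))))
          qs≢sq

        ρpq : ρ p q ≡ s
        ρpq = proj₁ faces
        ρsp : ρ s p ≡ q
        ρsp = proj₁ (proj₂ faces)
        ρsq : ρ s q ≡ r
        ρsq = proj₁ (proj₂ (proj₂ faces))
        ρrs : ρ r s ≡ q
        ρrs = proj₂ (proj₂ (proj₂ faces))

        lift-old : ∀ u v → G (emb u) (emb v) → lift u v ≡ emb v
        lift-old p s _ = refl
        lift-old p (old _) _ = refl
        lift-old r s _ = refl
        lift-old r (old _) _ = refl
        lift-old s _ _ = refl
        lift-old (old _) _ _ = refl

        unshrink : ∀ y {v z} → G (emb y) v → shrink y v ≡ z → v ≡ lift y z ⊎ (y ≡ s × v ≡ q)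
        unshrink y e refl with dart y e
        ... | kept f = inj₁ (cong (lift y) (sym (shrink-lift f)))
        ... | s→q    = inj₂ (refl , refl)

        -- `ρᴴ` and `ρ` turn differently only where `q` is skipped, which happens at `s` between `p`
        -- and `r`. A triangle of `G` with that turn would need the edge `p r`.
        ascend : ∀ x y z → G (emb y) (emb x) → G (emb y) (emb z) → G (emb x) (emb z) →
                 ρᴴ y x ≡ z → ρ (emb y) (emb x) ≡ emb z
        ascend x y z yx yz xz e
          with unshrink y (proj₁ (rot (emb y)) yx) (trans (cong (shrink y ∘ ρ (emb y)) (sym (lift-old y x yx))) e)
        ... | inj₁ e′ = trans e′ (lift-old y z yz)
        ... | inj₂ (refl , ρsx) = ⊥-elim (p-r-nonadjacent (subst₂ G x≡p z≡r xz))
          where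
          p-r-nonadjacent : ¬ G p r
          p-r-nonadjacent ()
          x≡p : emb x ≡ p
          x≡p = rotation-injective (rot s) yx sp (trans ρsx (sym ρsp))
          z≡r : emb z ≡ r
          z≡r = cong emb (trans (sym e) (trans (cong (shrink s) ρsx) (cong (drop s) ρsq)))

        ascend-face : ∀ x y z → G (emb x) (emb y) → G (emb y) (emb z) → G (emb x) (emb z) →
                      Face ρᴴ x y z → Face ρ (emb x) (emb y) (emb z)
        ascend-face x y z xy yz xz (e₁ , e₂ , e₃) =
          ascend x y z (G-sym xy) yz xz e₁ ,
          ascend y z x (G-sym yz) (G-sym xz) (G-sym xy) e₂ ,
          ascend z x y xz xy (G-sym yz) e₃

        q-triangle : ∀ {x y} → G q x → G x y → G q y → Facial ρ q x y
        q-triangle qp ps qs = inj₁ (ρpq , ρsp , ρqs)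
        q-triangle qs sp qp = inj₂ (ρpq , ρsp , ρqs)
        q-triangle qs sr qr = inj₁ (ρsq , ρrs , ρqr)
        q-triangle qr rs qs = inj₂ (ρsq , ρrs , ρqr)

        view : (v : PathG X) → v ≡ q ⊎ ∃ λ u → v ≡ emb u
        view p       = inj₂ (p , refl)
        view q       = inj₁ refl
        view r       = inj₂ (r , refl)
        view s       = inj₂ (s , refl)
        view (old v) = inj₂ (old v , refl)

        triangle : ∀ {x y z} → G x y → G y z → G x z → Facial ρ x y z
        triangle {x} {y} {z} xy yz xz with view x | view y | view z
        ... | inj₁ refl | _ | _ = q-triangle xy yz xz
        ... | inj₂ _ | inj₁ refl | _ = facial-rotate ρ (facial-rotate ρ (q-triangle yz (G-sym xz) (G-sym xy)))
        ... | inj₂ _ | inj₂ _ | inj₁ refl = facial-rotate ρ (q-triangle (G-sym xz) xy (G-sym yz))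
        ... | inj₂ (x , refl) | inj₂ (y , refl) | inj₂ (z , refl)
          with triangles rᴴ (descend x y xy) (descend y z yz) (descend x z xz)
        ...   | inj₁ f = inj₁ (ascend-face x y z xy yz xz f)
        ...   | inj₂ f = inj₂ (ascend-face x z y xz (G-sym yz) xy f)

        p-face r-face : PathG X → PathG X → Bool
        p-face q p = true
        p-face p s = true
        p-face s q = true
        p-face _ _ = false
        r-face q s = true
        r-face s r = true
        r-face r q = true
        r-face _ _ = false

        p-face-complete : ∀ {u v} → OnTriangle q p s u v → p-face u v ≡ true
        p-face-complete side₁ = refl
        p-face-complete side₂ = refl
        p-face-complete side₃ = refl

        p-face-sound : ∀ u v → p-face u v ≡ true → OnTriangle q p s u v
        p-face-sound q p _ = side₁
        p-face-sound p s _ = side₂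
        p-face-sound s q _ = side₃

        r-face-complete : ∀ {u v} → OnTriangle q s r u v → r-face u v ≡ true
        r-face-complete side₁ = refl
        r-face-complete side₂ = refl
        r-face-complete side₃ = refl

        r-face-sound : ∀ u v → r-face u v ≡ true → OnTriangle q s r u v
        r-face-sound q s _ = side₁
        r-face-sound s r _ = side₂
        r-face-sound r q _ = side₃

        on-p-face : ∀ {w x} → G w x → γ w x ≡ γ q p → OnTriangle q p s w x
        on-p-face = face-colour G-sym rot euler-G c (ρpq , ρsp , ρqs) qp ps sq
                      p-face p-face-complete p-face-sound

        on-r-face : ∀ {w x} → G w x → γ w x ≡ γ q s → OnTriangle q s r w x
        on-r-face = face-colour G-sym rot euler-G c (ρsq , ρrs , ρqr) qs sr rq
                      r-face r-face-complete r-face-sound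

        meet-H : ∀ {u v w x y} → H u v → G (emb w) x → G (emb w) y →
                 m (γ (emb w) x) ≡ γᴴ u v → m (γ (emb w) y) ≡ γᴴ v u → w ≡ u ⊎ w ≡ v
        meet-H {w = w} uv wx wy e₁ e₂ = faces-meet rᴴ uv (shrink-adj w wx) (shrink-adj w wy)
          (trans (γ-shrink w wx) e₁) (trans (γ-shrink w wy) e₂)

        -- All faces at q contain p and r.
        at-p : ∀ {x} → G q x → ∃ λ y → H p y × γᴴ p y ≡ m (γ q x)
        at-p qp = s , ps , cong m (sym (next qp ρpq))
        at-p qr = r , pr , cong m (next pq ρqp)
        at-p qs = s , ps , trans (cong m (sym (trans (next sq ρqs) (next qp ρpq)))) (sym m-glues)

        at-r : ∀ {x} → G q x → ∃ λ y → H r y × γᴴ r y ≡ m (γ q x)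
        at-r qp = p , rp , trans m-rp (cong m (next sq ρqs))
        at-r qr = _ , shrink-adj r (proj₁ (rot r) rq) , trans (γ-shrink r (proj₁ (rot r) rq)) (cong m (sym (invariant c qr)))
        at-r qs = p , rp , cong m (next rq ρqr)

        Meet : PathG X → PathG X → Set
        Meet u v = ∀ {w x y} → G w x → G w y → γ w x ≡ γ u v → γ w y ≡ γ v u → w ≡ u ⊎ w ≡ v

        flip-meet : ∀ {u v} → Meet u v → Meet v u
        flip-meet meet wx wy e₁ e₂ = Sum.swap (meet wy wx e₂ e₁)

        meet-qp : Meet q p
        meet-qp wx wy e₁ e₂ with on-p-face wx e₁
        ... | side₁ = inj₁ refl
        ... | side₂ = inj₂ refl
        -- Here `w` is `s`, which in `H` would lie on both faces along `r p`.
        ... | side₃ with meet-H {w = s} rp wx wy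
                           (trans (cong m (trans e₁ (sym (next sq ρqs)))) (sym m-rp)) (cong m e₂)
        ...   | inj₁ ()
        ...   | inj₂ ()

        meet-qr : Meet q r
        meet-qr wx wy e₁ e₂ with on-r-face wy (trans e₂ (next rq ρqr))
        ... | side₁ = inj₁ refl
        ... | side₃ = inj₂ refl
        ... | side₂ with meet-H {w = s} pr wx wy
                           (cong m (trans e₁ (sym (next pq ρqp)))) (cong m e₂)
        ...   | inj₁ ()
        ...   | inj₂ ()

        meet-qs : Meet q s
        meet-qs wx wy e₁ e₂ with on-r-face wx e₁ | on-p-face wy (trans e₂ (next sq ρqs))
        ... | side₁ | _     = inj₁ refl
        ... | side₂ | _     = inj₂ refl
        ... | side₃ | ()

        meet-old : ∀ u v → G (emb u) (emb v) → Meet (emb u) (emb v)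
        meet-old u v uv {w} {x} {y} wx wy e₁ e₂ = by-view (view w) wx wy e₁ e₂
          where
          uvᴴ : H u v
          uvᴴ = descend u v uv
          colour-uv : m (γ (emb u) (emb v)) ≡ γᴴ u v
          colour-uv = cong (m ∘ γ (emb u)) (sym (lift-old u v uv))
          colour-vu : m (γ (emb v) (emb u)) ≡ γᴴ v u
          colour-vu = cong (m ∘ γ (emb v)) (sym (lift-old v u (G-sym uv)))
          not-pr : ∀ {u v} → G (emb u) (emb v) → ¬ ((p ≡ u ⊎ p ≡ v) × (r ≡ u ⊎ r ≡ v))
          not-pr () (inj₁ refl , inj₂ refl)
          not-pr () (inj₂ refl , inj₁ refl)
          by-view : ∀ {w x y} → w ≡ q ⊎ (∃ λ t → w ≡ emb t) → G w x → G w y →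
                    γ w x ≡ γ (emb u) (emb v) → γ w y ≡ γ (emb v) (emb u) → w ≡ emb u ⊎ w ≡ emb v
          by-view (inj₂ (t , refl)) wx wy e₁ e₂ =
            Sum.map (cong emb) (cong emb) (meet-H uvᴴ wx wy (trans (cong m e₁) colour-uv) (trans (cong m e₂) colour-vu))
          -- If `q` were on both faces along `u v`, then so would be `p` and `r`; thus `u` and `v`
          -- would be `p` and `r`, which are not adjacent in `G`.
          by-view (inj₁ refl) wx wy e₁ e₂ with at-p wx | at-p wy | at-r wx | at-r wy
          ... | _ , a , ea | _ , b , eb | _ , c , ec | _ , d , ed = ⊥-elim (not-pr uv
            ( faces-meet rᴴ uvᴴ a b (trans ea (trans (cong m e₁) colour-uv)) (trans eb (trans (cong m e₂) colour-vu))
            , faces-meet rᴴ uvᴴ c d (trans ec (trans (cong m e₁) colour-uv)) (trans ed (trans (cong m e₂) colour-vu))))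

        meets : ∀ {u v} → G u v → Meet u v
        meets qp = meet-qp
        meets pq = flip-meet meet-qp
        meets qr = meet-qr
        meets rq = flip-meet meet-qr
        meets qs = meet-qs
        meets sq = flip-meet meet-qs
        meets ps = meet-old p s ps
        meets sp = meet-old s p sp
        meets rs = meet-old r s rs
        meets sr = meet-old s r sr
        meets po = meet-old p (old p°) po
        meets op = meet-old (old p°) p op
        meets ro = meet-old r (old r°) ro
        meets or = meet-old (old r°) r or
        meets (so e) = meet-old s (old _) (so e)
        meets (os e) = meet-old (old _) s (os e)
        meets (oo e) = meet-old (old _) (old _) (oo e)

        rigid-G : Rigid G ρ c
        rigid-G = record { triangles = triangle ; faces-meet = λ uv → meets uv }

    module Extend {ρ : PathH X → PathH X → PathH X} (rot : Rotation H ρ) {k : ℕ} (c : Colouring H ρ k)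
                  (ρpr : ρ p r ≡ s) (ρsp : ρ s p ≡ r) (ρrs : ρ r s ≡ p) where

      γ : PathH X → PathH X → Fin k
      γ = colour c

      -- The vertex `q` is put on the edge `p r` and inserted between `p` and `r` at `s`, that is,
      -- inside the face through `r p`, `p s` and `s r`.
      ρᴳ : PathG X → PathG X → PathG X
      ρᴳ q p       = r
      ρᴳ q r       = s
      ρᴳ q _       = p
      ρᴳ s p       = q
      ρᴳ s q       = r
      ρᴳ s v       = emb (ρ s (drop s v))
      ρᴳ p v       = lift p (ρ p (drop p v))
      ρᴳ r v       = lift r (ρ r (drop r v))
      ρᴳ (old u) v = lift (old u) (ρ (old u) (drop (old u) v))

      -- The triangle p r s is split by the new edge q s; its part containing p gets a new colour.
      γᴳ : PathG X → PathG X → Fin (suc k)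
      γᴳ q r       = suc (γ p r)
      γᴳ q s       = suc (γ r p)
      γᴳ q _       = zero
      γᴳ s q       = zero
      γᴳ s v       = suc (γ s (drop s v))
      γᴳ p s       = zero
      γᴳ p v       = suc (γ p (drop p v))
      γᴳ r v       = suc (γ r (drop r v))
      γᴳ (old u) v = suc (γ (old u) (drop (old u) v))

      γ-lift : ∀ {u v} → H u v → (u ≡ p → v ≢ s) → γᴳ (emb u) (lift u v) ≡ suc (γ u v)
      γ-lift ps ne = contradiction refl (ne refl)
      γ-lift rp _ = refl
      γ-lift pr _ = refl
      γ-lift sp _ = refl
      γ-lift rs _ = refl
      γ-lift sr _ = refl
      γ-lift po _ = refl
      γ-lift op _ = refl
      γ-lift ro _ = refl
      γ-lift or _ = refl
      γ-lift (so _) _ = refl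
      γ-lift (os _) _ = refl
      γ-lift (oo _) _ = refl

      other : ∀ u → u ≢ s → ∀ v → ρᴳ (emb u) v ≡ lift u (ρ u (drop u v))
      other p _ _ = refl
      other r _ _ = refl
      other (old _) _ _ = refl
      other s ne _ = contradiction refl ne

      rotation-other : ∀ u → u ≢ s → RotationAt (G (emb u)) (ρᴳ (emb u))
      rotation-other u u≢s = closed , reach
        where
        dart′ : ∀ {v} → G (emb u) v → ∃ λ w → H u w × v ≡ lift u w
        dart′ e with dart u e
        ... | kept f = _ , f , refl
        ... | s→q    = contradiction refl u≢s
        image : ∀ {w} → H u w → ρᴳ (emb u) (lift u w) ≡ lift u (ρ u w)
        image f = trans (other u u≢s _) (cong (lift u ∘ ρ u) (drop-lift f))
        closed : ∀ {v} → G (emb u) v → G (emb u) (ρᴳ (emb u) v)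
        closed e with dart′ e
        ... | w , f , refl = subst (G (emb u)) (sym (image f)) (lift-adj (proj₁ (rot u) f))
        reach : ∀ {v w} → G (emb u) v → G (emb u) w → Star (λ x y → ρᴳ (emb u) x ≡ y) v w
        reach e e′ with dart′ e | dart′ e′
        ... | _ , f , refl | _ , f′ , refl =
          star-map {N = H u} (lift u) (proj₁ (rot u)) (λ f → image f ◅ ε) f (proj₂ (rot u) f f′)

      rotation-s : RotationAt (G s) (ρᴳ s)
      rotation-s = closed , reach
        where
        closed : ∀ {v} → G s v → G s (ρᴳ s v)
        closed sp     = sq
        closed sq     = sr
        closed sr     = lift-adj (proj₁ (rot s) sr)
        closed (so e) = lift-adj (proj₁ (rot s) (so e))
        step : ∀ {v} → H s v → Star (λ x y → ρᴳ s x ≡ y) (emb v) (emb (ρ s v))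
        step sp     = refl ◅ cong emb (sym ρsp) ◅ ε
        step sr     = refl ◅ ε
        step (so _) = refl ◅ ε
        old-reach : ∀ {v w} → H s v → H s w → Star (λ x y → ρᴳ s x ≡ y) (emb v) (emb w)
        old-reach f f′ = star-map {N = H s} emb (proj₁ (rot s)) step f (proj₂ (rot s) f f′)
        enter : ∀ {v} → G s v → ∃ λ w → H s w × Star (λ x y → ρᴳ s x ≡ y) v (emb w)
        enter sp     = p , sp , ε
        enter sq     = r , sr , refl ◅ ε
        enter sr     = r , sr , ε
        enter (so e) = _ , so e , ε
        leave : ∀ {v} → G s v → ∃ λ w → H s w × Star (λ x y → ρᴳ s x ≡ y) (emb w) v
        leave sp     = p , sp , ε
        leave sq     = p , sp , refl ◅ ε
        leave sr     = r , sr , ε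
        leave (so e) = _ , so e , ε
        reach : ∀ {v w} → G s v → G s w → Star (λ x y → ρᴳ s x ≡ y) v w
        reach e e′ with enter e | leave e′
        ... | _ , f , a | _ , f′ , b = a ◅◅ old-reach f f′ ◅◅ b

      rotation : Rotation G ρᴳ
      rotation p       = rotation-other p (λ ())
      rotation q       = cycle₃-rotation (refl , refl , refl) qp qr qs q-nbrs
      rotation r       = rotation-other r (λ ())
      rotation s       = rotation-s
      rotation (old u) = rotation-other (old u) (λ ())

      next : ∀ v {u} → H v u → (v ≡ p → u ≢ r) → suc (γ u v) ≡ γᴳ (emb v) (lift v (ρ v u))
      next v {u} vu ne = trans (cong suc (invariant c (H-sym vu))) (sym (γ-lift (proj₁ (rot v) vu) ne′))
        where
        ne′ : v ≡ p → ρ v u ≢ s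
        -- Only the recoloured dart `p s` has to be avoided, and on its face it is preceded by the
        -- dart from `r`.
        ne′ refl e = ne refl (rotation-injective (rot p) vu pr (trans e (sym ρpr)))

      inv : ∀ {u v} → G u v → γᴳ u v ≡ γᴳ v (ρᴳ v u)
      inv pq     = refl
      inv qp     = cong (γᴳ p ∘ lift p) (sym ρpr)
      inv qr     = next r rp (λ ())
      inv rq     = refl
      inv qs     = cong suc (trans (invariant c rp) (trans (cong (γ p) ρpr) (trans (invariant c ps) (cong (γ s) ρsp))))
      inv sq     = refl
      inv ps     = refl
      inv sp     = next p ps (λ _ ())
      inv rs     = next s sr (λ ())
      inv sr     = next r rs (λ ())
      inv po     = next (old _) op (λ ())
      inv op     = next p po (λ _ ())
      inv ro     = next (old _) or (λ ())
      inv or     = next r ro (λ ())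
      inv (so e) = next (old _) (os e) (λ ())
      inv (os e) = next s (so e) (λ ())
      inv (oo e) = next (old _) (oo (R-sym e)) (λ ())

      hit : ∀ {u v} → H u v → ∃₂ λ x y → G x y × γᴳ x y ≡ suc (γ u v)
      hit pr     = p , q , pq , refl
      -- The dart `p s` has received the new colour; its old one survives on `s r`, in the other
      -- part of the split face.
      hit ps     = s , r , sr , cong suc (sym (trans (invariant c ps) (cong (γ s) ρsp)))
      hit rp = _ , _ , lift-adj rp , refl
      hit sp = _ , _ , lift-adj sp , refl
      hit rs = _ , _ , lift-adj rs , refl
      hit sr = _ , _ , lift-adj sr , refl
      hit po = _ , _ , lift-adj po , refl
      hit op = _ , _ , lift-adj op , refl
      hit ro = _ , _ , lift-adj ro , refl
      hit or = _ , _ , lift-adj or , refl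
      hit (so e) = _ , _ , lift-adj (so e) , refl
      hit (os e) = _ , _ , lift-adj (os e) , refl
      hit (oo e) = _ , _ , lift-adj (oo e) , refl

      surj : ∀ t → ∃₂ λ x y → G x y × γᴳ x y ≡ t
      surj zero    = q , p , qp , refl
      surj (suc t) with surjective c t
      ... | u , v , e , refl = hit e

      colouring : Colouring G ρᴳ (suc k)
      colouring = record { colour = γᴳ ; invariant = inv ; surjective = surj }

    -- The new darts are the three leaving `q`, and `s` to `q`. The other two entering `q` stand for
    -- the two darts of `p r`.
    path-darts : ∀ {m} → Enumeration (Darts H) m → Enumeration (Darts G) (4 + m)
    path-darts e = reindex f g f-Q gf g-P fg (sum-enumeration (fin-enumeration 4) e)
      where
      f : Fin 4 ⊎ PathH X × PathH X → PathG X × PathG X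
      f (inj₁ zero)                   = q , p
      f (inj₁ (suc zero))             = q , r
      f (inj₁ (suc (suc zero)))       = q , s
      f (inj₁ (suc (suc (suc zero)))) = s , q
      f (inj₂ (u , v))                = emb u , lift u v
      g : PathG X × PathG X → Fin 4 ⊎ PathH X × PathH X
      g (q , r)     = inj₁ (suc zero)
      g (q , s)     = inj₁ (suc (suc zero))
      g (q , _)     = inj₁ zero
      g (s , q)     = inj₁ (suc (suc (suc zero)))
      g (s , v)     = inj₂ (s , drop s v)
      g (p , v)     = inj₂ (p , drop p v)
      g (r , v)     = inj₂ (r , drop r v)
      g (old u , v) = inj₂ (old u , drop (old u) v)
      f-Q : ∀ x → [ (λ _ → ⊤) , Darts H ]′ x → Darts G (f x)
      f-Q (inj₁ zero) _                   = qp
      f-Q (inj₁ (suc zero)) _             = qr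
      f-Q (inj₁ (suc (suc zero))) _       = qs
      f-Q (inj₁ (suc (suc (suc zero)))) _ = sq
      f-Q (inj₂ (u , v)) e                = lift-adj e
      gf-dart : ∀ {u v} → H u v → g (emb u , lift u v) ≡ inj₂ (u , v)
      gf-dart pr = refl
      gf-dart rp = refl
      gf-dart ps = refl
      gf-dart sp = refl
      gf-dart rs = refl
      gf-dart sr = refl
      gf-dart po = refl
      gf-dart op = refl
      gf-dart ro = refl
      gf-dart or = refl
      gf-dart (so _) = refl
      gf-dart (os _) = refl
      gf-dart (oo _) = refl
      gf : ∀ x → [ (λ _ → ⊤) , Darts H ]′ x → g (f x) ≡ x
      gf (inj₁ zero) _                   = refl
      gf (inj₁ (suc zero)) _             = refl
      gf (inj₁ (suc (suc zero))) _       = refl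
      gf (inj₁ (suc (suc (suc zero)))) _ = refl
      gf (inj₂ (u , v)) e                = gf-dart e
      back : ∀ {u v} → G u v → [ (λ _ → ⊤) , Darts H ]′ (g (u , v)) × f (g (u , v)) ≡ (u , v)
      back pq = pr , refl
      back qp = tt , refl
      back qr = tt , refl
      back rq = rp , refl
      back qs = tt , refl
      back sq = tt , refl
      back ps = ps , refl
      back sp = sp , refl
      back rs = rs , refl
      back sr = sr , refl
      back po = po , refl
      back op = op , refl
      back ro = ro , refl
      back or = or , refl
      back (so e) = (so e) , refl
      back (os e) = (os e) , refl
      back (oo e) = (oo e) , refl
      g-P : ∀ y → Darts G y → [ (λ _ → ⊤) , Darts H ]′ (g y)
      g-P _ e = proj₁ (back e)
      fg : ∀ y → Darts G y → f (g y) ≡ y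
      fg _ e = proj₂ (back e)

  -- The symmetry exchanging `p` and `r`, and the induction step for D3b.

  swapᴳ : {X : Set} → PathG X → PathG X
  swapᴳ p = r
  swapᴳ r = p
  swapᴳ v = v

  swapᴴ : {X : Set} → PathH X → PathH X
  swapᴴ p = r
  swapᴴ r = p
  swapᴴ v = v

  swapᴳ-involutive : {X : Set} (u : PathG X) → swapᴳ (swapᴳ u) ≡ u
  swapᴳ-involutive p       = refl
  swapᴳ-involutive q       = refl
  swapᴳ-involutive r       = refl
  swapᴳ-involutive s       = refl
  swapᴳ-involutive (old _) = refl

  swapᴴ-involutive : {X : Set} (u : PathH X) → swapᴴ (swapᴴ u) ≡ u
  swapᴴ-involutive p       = refl
  swapᴴ-involutive r       = refl
  swapᴴ-involutive s       = refl
  swapᴴ-involutive (old _) = refl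

  swapped : Frame → Frame
  swapped P = record { X = X ; R = R ; S = S ; p° = r° ; r° = p° ; R-sym = R-sym }
    where open Frame P

  swap-G : ∀ P → Path.G P ≃ Path.G (swapped P)
  swap-G P = record
    { to = swapᴳ ; from = swapᴳ ; to-adj = to-adj ; from-adj = from-adj
    ; from-to = λ {u} {v} _ → swapᴳ-involutive u , swapᴳ-involutive v
    ; to-from = λ {u} {v} _ → swapᴳ-involutive u , swapᴳ-involutive v }
    where
    to-adj : ∀ {u v} → Path.G P u v → Path.G (swapped P) (swapᴳ u) (swapᴳ v)
    to-adj Path.pq = Path.rq
    to-adj Path.qp = Path.qr
    to-adj Path.qr = Path.qp
    to-adj Path.rq = Path.pq
    to-adj Path.qs = Path.qs
    to-adj Path.sq = Path.sq
    to-adj Path.ps = Path.rs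
    to-adj Path.sp = Path.sr
    to-adj Path.rs = Path.ps
    to-adj Path.sr = Path.sp
    to-adj Path.po = Path.ro
    to-adj Path.op = Path.or
    to-adj Path.ro = Path.po
    to-adj Path.or = Path.op
    to-adj (Path.so e) = Path.so e
    to-adj (Path.os e) = Path.os e
    to-adj (Path.oo e) = Path.oo e
    from-adj : ∀ {u v} → Path.G (swapped P) u v → Path.G P (swapᴳ u) (swapᴳ v)
    from-adj Path.pq = Path.rq
    from-adj Path.qp = Path.qr
    from-adj Path.qr = Path.qp
    from-adj Path.rq = Path.pq
    from-adj Path.qs = Path.qs
    from-adj Path.sq = Path.sq
    from-adj Path.ps = Path.rs
    from-adj Path.sp = Path.sr
    from-adj Path.rs = Path.ps
    from-adj Path.sr = Path.sp
    from-adj Path.po = Path.ro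
    from-adj Path.op = Path.or
    from-adj Path.ro = Path.po
    from-adj Path.or = Path.op
    from-adj (Path.so e) = Path.so e
    from-adj (Path.os e) = Path.os e
    from-adj (Path.oo e) = Path.oo e

  swap-H : ∀ P → Path.H P ≃ Path.H (swapped P)
  swap-H P = record
    { to = swapᴴ ; from = swapᴴ ; to-adj = to-adj ; from-adj = from-adj
    ; from-to = λ {u} {v} _ → swapᴴ-involutive u , swapᴴ-involutive v
    ; to-from = λ {u} {v} _ → swapᴴ-involutive u , swapᴴ-involutive v }
    where
    to-adj : ∀ {u v} → Path.H P u v → Path.H (swapped P) (swapᴴ u) (swapᴴ v)
    to-adj Path.pr = Path.rp
    to-adj Path.rp = Path.pr
    to-adj Path.ps = Path.rs
    to-adj Path.sp = Path.sr
    to-adj Path.rs = Path.ps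
    to-adj Path.sr = Path.sp
    to-adj Path.po = Path.ro
    to-adj Path.op = Path.or
    to-adj Path.ro = Path.po
    to-adj Path.or = Path.op
    to-adj (Path.so e) = Path.so e
    to-adj (Path.os e) = Path.os e
    to-adj (Path.oo e) = Path.oo e
    from-adj : ∀ {u v} → Path.H (swapped P) u v → Path.H P (swapᴴ u) (swapᴴ v)
    from-adj Path.pr = Path.rp
    from-adj Path.rp = Path.pr
    from-adj Path.ps = Path.rs
    from-adj Path.sp = Path.sr
    from-adj Path.rs = Path.ps
    from-adj Path.sr = Path.sp
    from-adj Path.po = Path.ro
    from-adj Path.op = Path.or
    from-adj Path.ro = Path.po
    from-adj Path.or = Path.op
    from-adj (Path.so e) = Path.so e
    from-adj (Path.os e) = Path.os e
    from-adj (Path.oo e) = Path.oo e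

  module PathStep (P : Frame) {K : ℕ} (w : Whitney (Path.H P) K) where

    G : PathG (Frame.X P) → PathG (Frame.X P) → Set
    G = Path.G P

    G-sym : ∀ {u v} → G u v → G v u
    G-sym = Path.G-sym P

    w′ : Whitney (Path.H (swapped P)) K
    w′ = ≃-whitney (Path.H-sym P) (swap-H P) w

    module I = Pull (≃-sym (swap-G P))
    module J = Pull (swap-G P)
    module Iᴴ = Pull (≃-sym (swap-H P))

    orientation : ∀ {ρ} → Rotation G ρ → Cycle₃ (ρ q) p r s ⊎ Cycle₃ (ρ q) p s r
    orientation rot = rotation₃ (rot q) Path.qp Path.qr Path.qs (λ ()) (λ ()) (λ ()) (Path.q-nbrs P)

    -- Exchanging the names `p` and `r` reverses the cyclic order at `q`, so the rotation itself
    -- need not be reversed.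
    reflected : ∀ {ρ} → Cycle₃ (ρ q) p s r → Cycle₃ (I.pull ρ q) p r s
    reflected (qps , qsr , qrp) = cong swapᴳ qrp , cong swapᴳ qps , cong swapᴳ qsr

    euler-G : ∀ {ρ k} → Rotation G ρ → Colouring G ρ k → k ≤ suc K
    euler-G {ρ} rot c with orientation rot
    ... | inj₁ (e₁ , e₂ , e₃) = proj₁ (Path.Restrict.Colours.bound P rot c e₁ e₂ e₃ w)
    ... | inj₂ e with reflected {ρ} e
    ...   | e₁ , e₂ , e₃ = proj₁ (Path.Restrict.Colours.bound (swapped P) (I.pull-rotation rot)
                             (I.pull-colouring G-sym rot c) e₁ e₂ e₃ w′)

    rigid-G : ∀ {ρ} → Rotation G ρ → (c : Colouring G ρ (suc K)) → Rigid G ρ c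
    rigid-G {ρ} rot c with orientation rot
    ... | inj₁ (e₁ , e₂ , e₃) = Path.Restrict.Rigidity.rigid-G P rot w c (euler-G rot) e₁ e₂ e₃
    ... | inj₂ e with reflected {ρ} e
    ...   | e₁ , e₂ , e₃ = I.push-rigid G-sym rot c
              (Path.Restrict.Rigidity.rigid-G (swapped P) rot′ w′ (I.pull-colouring G-sym rot c)
                (λ c → proj₁ (Path.Restrict.Colours.bound (swapped P) rot′ c e₁ e₂ e₃ w′)) e₁ e₂ e₃)
      where
      rot′ : Rotation (Path.G (swapped P)) (I.pull ρ)
      rot′ = I.pull-rotation rot

    embedding-G : ∃ λ ρ → Rotation G ρ × Colouring G ρ (suc K)
    embedding-G with embedding w
    -- Rigidity of `H` supplies the face `p r s` in which `q s` is drawn. If it lies on the side of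
    -- the dart `p r`, the roles of `p` and `r` are exchanged.
    ... | ρ , rot , c with triangles (rigid w rot c) Path.pr Path.rs Path.ps
    ...   | inj₂ (ρsp , ρrs , ρpr) =
      _ , Path.Extend.rotation P rot c ρpr ρsp ρrs , Path.Extend.colouring P rot c ρpr ρsp ρrs
    ...   | inj₁ (ρrp , ρsr , ρps) =
      _ , J.pull-rotation E.rotation , J.pull-colouring (Path.G-sym (swapped P)) E.rotation E.colouring
      where
      module E = Path.Extend (swapped P) {Iᴴ.pull ρ} (Iᴴ.pull-rotation rot)
                   (Iᴴ.pull-colouring (Path.H-sym P) rot c) (cong swapᴴ ρrp) (cong swapᴴ ρsr) (cong swapᴴ ρps)

  path-step : ∀ P {K} → Whitney (Path.H P) K → Whitney (Path.G P) (suc K)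
  path-step P w = record { embedding = embedding-G ; euler = euler-G ; rigid = rigid-G }
    where open PathStep P w

-- Undoing D3a.

module TriangleReduction where

  -- (D3a) on labelled vertices: X supplies the vertices other than p, q, r, among them the outside
  -- neighbours a, b, c of p, q, r in this order; the triangle is contracted to o.
  data TriG (X : Set) : Set where
    p q r : TriG X
    old   : X → TriG X

  data TriH (X : Set) : Set where
    o   : TriH X
    old : X → TriH X

  old-injective : {X : Set} {u v : X} → _≡_ {A = TriH X} (old u) (old v) → u ≡ v
  old-injective refl = refl

  π : {X : Set} → TriG X → TriH X
  π (old v) = old v
  π _       = o

  π-old : {X : Set} (w : TriG X) {u : X} → π w ≡ old u → w ≡ old u
  π-old (old _) refl = refl

  record Frame : Set₁ where
    field
      X        : Set
      _≟_      : DecidableEquality X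
      R        : X → X → Set
      a b c    : X
      a≢b      : a ≢ b
      b≢c      : b ≢ c
      a≢c      : a ≢ c
      R-sym    : ∀ {u v} → R u v → R v u
      R-irrefl : ∀ {u} → ¬ R u u

  module Tri (P : Frame) where
    open Frame P

    data G : TriG X → TriG X → Set where
      pq : G p q
      qp : G q p
      qr : G q r
      rq : G r q
      rp : G r p
      pr : G p r
      pa : G p (old a)
      ap : G (old a) p
      qb : G q (old b)
      bq : G (old b) q
      rc : G r (old c)
      cr : G (old c) r
      oo : ∀ {u v} → R u v → G (old u) (old v)

    data H : TriH X → TriH X → Set where
      oa : H o (old a)
      ao : H (old a) o
      ob : H o (old b)
      bo : H (old b) o
      oc : H o (old c)
      co : H (old c) o
      oo : ∀ {u v} → R u v → H (old u) (old v)

    G-sym : ∀ {u v} → G u v → G v u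
    G-sym pq = qp
    G-sym qp = pq
    G-sym qr = rq
    G-sym rq = qr
    G-sym rp = pr
    G-sym pr = rp
    G-sym pa = ap
    G-sym ap = pa
    G-sym qb = bq
    G-sym bq = qb
    G-sym rc = cr
    G-sym cr = rc
    G-sym (oo e) = oo (R-sym e)

    H-sym : ∀ {u v} → H u v → H v u
    H-sym oa = ao
    H-sym ao = oa
    H-sym ob = bo
    H-sym bo = ob
    H-sym oc = co
    H-sym co = oc
    H-sym (oo e) = oo (R-sym e)

    p-nbrs : ∀ {v} → G p v → v ≡ r ⊎ v ≡ q ⊎ v ≡ old a
    p-nbrs pr = inj₁ refl
    p-nbrs pq = inj₂ (inj₁ refl)
    p-nbrs pa = inj₂ (inj₂ refl)

    q-nbrs : ∀ {v} → G q v → v ≡ p ⊎ v ≡ r ⊎ v ≡ old b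
    q-nbrs qp = inj₁ refl
    q-nbrs qr = inj₂ (inj₁ refl)
    q-nbrs qb = inj₂ (inj₂ refl)

    r-nbrs : ∀ {v} → G r v → v ≡ q ⊎ v ≡ p ⊎ v ≡ old c
    r-nbrs rq = inj₁ refl
    r-nbrs rp = inj₂ (inj₁ refl)
    r-nbrs rc = inj₂ (inj₂ refl)

    o-nbrs : ∀ {v} → H o v → v ≡ old a ⊎ v ≡ old c ⊎ v ≡ old b
    o-nbrs oa = inj₁ refl
    o-nbrs oc = inj₂ (inj₁ refl)
    o-nbrs ob = inj₂ (inj₂ refl)

    -- The corner of the triangle at which an outside neighbour is attached; p is junk for the
    -- vertices other than a, b, c.
    attach : X → TriG X
    attach v with v ≟ b | v ≟ c
    ... | yes _ | _     = q
    ... | no _  | yes _ = r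
    ... | no _  | no _  = p

    attach-a : attach a ≡ p
    attach-a with a ≟ b | a ≟ c
    ... | yes e | _     = contradiction e a≢b
    ... | no _  | yes e = contradiction e a≢c
    ... | no _  | no _  = refl

    attach-b : attach b ≡ q
    attach-b with b ≟ b | b ≟ c
    ... | yes _ | _ = refl
    ... | no ne | _ = contradiction refl ne

    attach-c : attach c ≡ r
    attach-c with c ≟ b | c ≟ c
    ... | yes e | _     = contradiction (sym e) b≢c
    ... | no _  | yes _ = refl
    ... | no _  | no ne = contradiction refl ne

    π-attach : ∀ v → π (attach v) ≡ o
    π-attach v with v ≟ b | v ≟ c
    ... | yes _ | _     = refl
    ... | no _  | yes _ = refl
    ... | no _  | no _  = refl

    -- The dart (u , v) of H is the dart (lift v u , lift u v) of G.
    lift : TriH X → TriH X → TriG X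
    lift (old u) o = attach u
    lift o       o = p
    lift _ (old v) = old v

    lift-old : ∀ u v → lift u (old v) ≡ old v
    lift-old o       v = refl
    lift-old (old u) v = refl

    lift-adj : ∀ {u v} → H u v → G (lift v u) (lift u v)
    lift-adj oa rewrite attach-a = pa
    lift-adj ao rewrite attach-a = ap
    lift-adj ob rewrite attach-b = qb
    lift-adj bo rewrite attach-b = bq
    lift-adj oc rewrite attach-c = rc
    lift-adj co rewrite attach-c = cr
    lift-adj (oo e) = oo e

    π-lift : ∀ {u v} → H u v → π (lift u v) ≡ v
    π-lift oa = refl
    π-lift ao = π-attach a
    π-lift ob = refl
    π-lift bo = π-attach b
    π-lift oc = refl
    π-lift co = π-attach c
    π-lift (oo e) = refl

    π-adj : ∀ {u w} → G (old u) w → H (old u) (π w)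
    π-adj ap = ao
    π-adj bq = bo
    π-adj cr = co
    π-adj (oo e) = oo e

    lift-π : ∀ {u w} → G (old u) w → lift (old u) (π w) ≡ w
    lift-π ap = attach-a
    lift-π bq = attach-b
    lift-π cr = attach-c
    lift-π (oo e) = refl

    module Restrict {ρ : TriG X → TriG X → TriG X} (rot : Rotation G ρ) (ν : X → X) where

      -- The order `ν` of the outside neighbours around `o` is left as a parameter, because it
      -- depends on how the three corners are turned.
      ρᴴ : TriH X → TriH X → TriH X
      ρᴴ o       (old v) = old (ν v)
      ρᴴ o       o       = o
      ρᴴ (old u) v       = π (ρ (old u) (lift (old u) v))

      lift-adj-old : ∀ {u v} → H (old u) v → G (old u) (lift (old u) v)
      lift-adj-old {u} {v} e = subst (λ x → G x (lift (old u) v)) (lift-old v u) (lift-adj e)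

      rotation-old : ∀ u → RotationAt (H (old u)) (ρᴴ (old u))
      rotation-old u = (λ e → π-adj (proj₁ (rot (old u)) (lift-adj-old e))) , reach
        where
        reach : ∀ {v w} → H (old u) v → H (old u) w → Star (λ x y → ρᴴ (old u) x ≡ y) v w
        reach e f = subst₂ (Star _) (π-lift e) (π-lift f)
          (star-map {N = G (old u)} π (proj₁ (rot (old u)))
            (λ g → cong (π ∘ ρ (old u)) (lift-π g) ◅ ε)
            (lift-adj-old e) (proj₂ (rot (old u)) (lift-adj-old e) (lift-adj-old f)))

      rotation : RotationAt (H o) (ρᴴ o) → Rotation H ρᴴ
      rotation at-o o       = at-o
      rotation at-o (old u) = rotation-old u

      -- The contraction leaves a loop at o, with the darts p → q and q → p of G on its two sides;
      -- deleting it merges their colours.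
      module Merge {k k′ : ℕ} (col : Colouring G ρ k) (m : Fin k → Fin k′)
                   (m-surj : ∀ t → ∃ λ y → m y ≡ t) where

        γ : TriG X → TriG X → Fin k
        γ = colour col

        γᴴ : TriH X → TriH X → Fin k′
        γᴴ u v = m (γ (lift v u) (lift u v))

        γ-oa : γᴴ o (old a) ≡ m (γ p (old a))
        γ-oa = cong (λ x → m (γ x (old a))) attach-a
        γ-ob : γᴴ o (old b) ≡ m (γ q (old b))
        γ-ob = cong (λ x → m (γ x (old b))) attach-b
        γ-oc : γᴴ o (old c) ≡ m (γ r (old c))
        γ-oc = cong (λ x → m (γ x (old c))) attach-c

        γ-ao : γᴴ (old a) o ≡ m (γ (old a) p)
        γ-ao = cong (λ x → m (γ (old a) x)) attach-a
        γ-bo : γᴴ (old b) o ≡ m (γ (old b) q)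
        γ-bo = cong (λ x → m (γ (old b) x)) attach-b
        γ-co : γᴴ (old c) o ≡ m (γ (old c) r)
        γ-co = cong (λ x → m (γ (old c) x)) attach-c

        γ-π : ∀ {u w} → G (old u) w → γᴴ (old u) (π w) ≡ m (γ (old u) w)
        γ-π {u} {w} e = cong₂ (λ x y → m (γ x y)) (lift-old (π w) u) (lift-π e)

        inv-old : ∀ {u v} → H u (old v) → γᴴ u (old v) ≡ γᴴ (old v) (ρᴴ (old v) u)
        inv-old {u} {v} e = begin
          m (γ (lift (old v) u) (lift u (old v)))       ≡⟨ cong (m ∘ γ (lift (old v) u)) (lift-old u v) ⟩
          m (γ (lift (old v) u) (old v))                ≡⟨ cong m (invariant col (G-sym vu)) ⟩
          m (γ (old v) (ρ (old v) (lift (old v) u)))    ≡⟨ sym (γ-π (proj₁ (rot (old v)) vu)) ⟩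
          γᴴ (old v) (ρᴴ (old v) u)                     ∎
          where
          open ≡-Reasoning
          vu : G (old v) (lift (old v) u)
          vu = lift-adj-old (H-sym e)

        -- The part that depends on the orientation of the corners: faces passing through `o`
        -- continue correctly, and no colour is lost with the six darts inside the triangle.
        module Close (turn-a : m (γ (old a) p) ≡ γᴴ o (old (ν a)))
                     (turn-b : m (γ (old b) q) ≡ γᴴ o (old (ν b)))
                     (turn-c : m (γ (old c) r) ≡ γᴴ o (old (ν c)))
                     (inner : ∀ {u v} → G u v → π u ≡ o → π v ≡ o →
                              ∃ λ w → H o w × γᴴ o w ≡ m (γ u v)) where

          inv : ∀ {u v} → H u v → γᴴ u v ≡ γᴴ v (ρᴴ v u)
          inv oa     = inv-old oa
          inv ob     = inv-old ob
          inv oc     = inv-old oc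
          inv (oo e) = inv-old (oo e)
          inv ao     = trans γ-ao turn-a
          inv bo     = trans γ-bo turn-b
          inv co     = trans γ-co turn-c

          descend : ∀ {u v} → G u v → ∃ λ w → H (π u) w × γᴴ (π u) w ≡ m (γ u v)
          descend pq = inner pq refl refl
          descend qp = inner qp refl refl
          descend qr = inner qr refl refl
          descend rq = inner rq refl refl
          descend rp = inner rp refl refl
          descend pr = inner pr refl refl
          descend pa = old a , oa , γ-oa
          descend qb = old b , ob , γ-ob
          descend rc = old c , oc , γ-oc
          descend ap = o , ao , γ-ao
          descend bq = o , bo , γ-bo
          descend cr = o , co , γ-co
          descend (oo e) = _ , oo e , refl

          surj : ∀ t → ∃₂ λ x y → H x y × γᴴ x y ≡ t
          surj t with m-surj t
          ... | t′ , refl with surjective col t′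
          ...   | u , v , e , refl = π u , descend e

          colouring : Colouring H ρᴴ k′
          colouring = record { colour = γᴴ ; invariant = inv ; surjective = surj }

    -- p, q and r are turned the same way: the triangle is a face.
    module Positive {ρ : TriG X → TriG X → TriG X} (rot : Rotation G ρ)
                    (at-p : Cycle₃ (ρ p) r q (old a)) (at-q : Cycle₃ (ρ q) p r (old b))
                    (at-r : Cycle₃ (ρ r) q p (old c)) where

      -- Contracting `q r` and `r p` leaves at `o` the cyclic order `b`, loop, loop, `a`, `c`; the
      -- two ends of the loop are adjacent and enclose the former triangle. Dropping them gives `ν`.
      ν : X → X
      ν v with attach v
      ... | q = a
      ... | r = b
      ... | _ = c

      ν-a : ν a ≡ c
      ν-a rewrite attach-a = refl
      ν-b : ν b ≡ a
      ν-b rewrite attach-b = refl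
      ν-c : ν c ≡ b
      ν-c rewrite attach-c = refl

      open Restrict rot ν

      rotᴴ : Rotation H ρᴴ
      rotᴴ = rotation (cycle₃-rotation (cong old ν-a , cong old ν-c , cong old ν-b) oa oc ob o-nbrs)

      module Colours {k : ℕ} (col : Colouring G ρ k) where
        γ : TriG X → TriG X → Fin k
        γ = colour col

        next : ∀ {u v w} → G u v → ρ v u ≡ w → γ u v ≡ γ v w
        next e refl = invariant col e

        γqp : γ q p ≡ γ p (old a)
        γqp = next qp (proj₁ (proj₂ at-p))
        γrq : γ r q ≡ γ q (old b)
        γrq = next rq (proj₁ (proj₂ at-q))
        γpr : γ p r ≡ γ r (old c)
        γpr = next pr (proj₁ (proj₂ at-r))
        γap : γ (old a) p ≡ γ r (old c)
        γap = trans (next ap (proj₂ (proj₂ at-p))) γpr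
        γbq : γ (old b) q ≡ γ p (old a)
        γbq = trans (next bq (proj₂ (proj₂ at-q))) γqp
        γcr : γ (old c) r ≡ γ q (old b)
        γcr = trans (next cr (proj₂ (proj₂ at-r))) γrq
        γqr : γ q r ≡ γ p q
        γqr = sym (next pq (proj₁ at-q))
        γrp : γ r p ≡ γ p q
        γrp = next rp (proj₁ at-p)

        module Glue {k′ : ℕ} (m : Fin k → Fin k′) (m-glues : m (γ p q) ≡ m (γ q p))
                    (m-surj : ∀ t → ∃ λ y → m y ≡ t) where
          open Merge col m m-surj hiding (γ) public

          inner : ∀ {u v} → G u v → π u ≡ o → π v ≡ o → ∃ λ w → H o w × γᴴ o w ≡ m (γ u v)
          -- Gluing gives the inside of the triangle the colour of `q p`, whose face continues along
          -- `p a`.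
          inner pq _ _ = old a , oa , trans γ-oa (sym (trans m-glues (cong m γqp)))
          inner qr _ _ = old a , oa , trans γ-oa (sym (trans (cong m γqr) (trans m-glues (cong m γqp))))
          inner rp _ _ = old a , oa , trans γ-oa (sym (trans (cong m γrp) (trans m-glues (cong m γqp))))
          inner qp _ _ = old a , oa , trans γ-oa (cong m (sym γqp))
          inner rq _ _ = old b , ob , trans γ-ob (cong m (sym γrq))
          inner pr _ _ = old c , oc , trans γ-oc (cong m (sym γpr))

          open Close (trans (cong m γap) (trans (sym γ-oc) (cong (γᴴ o ∘ old) (sym ν-a))))
                     (trans (cong m γbq) (trans (sym γ-oa) (cong (γᴴ o ∘ old) (sym ν-b))))
                     (trans (cong m γcr) (trans (sym γ-ob) (cong (γᴴ o ∘ old) (sym ν-c))))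
                     inner public

        bound : ∀ {K} → Whitney H K → k ≤ suc K × (k ≡ suc K → γ p q ≢ γ q p)
        bound w = merge-bound λ m glues surj → euler w rotᴴ (Glue.colouring m glues surj)

      module Rigidity {K : ℕ} (w : Whitney H K) (col : Colouring G ρ (suc K))
                      (euler-G : ∀ {k} → Colouring G ρ k → k ≤ suc K) where
        open Colours col

        glued : Σ (Fin (suc K) → Fin K) λ m → m (γ p q) ≡ m (γ q p) × (∀ t → ∃ λ y → m y ≡ t)
        glued with glue (γ p q) (γ q p) (proj₂ (bound w) refl)
        ... | _ , refl , m = m

        m : Fin (suc K) → Fin K
        m = proj₁ glued

        open Glue m (proj₁ (proj₂ glued)) (proj₂ (proj₂ glued))

        rᴴ : Rigid H ρᴴ colouring
        rᴴ = rigid w rotᴴ colouring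

        pqr-face : Face ρ p q r
        pqr-face = proj₁ at-q , proj₁ at-r , proj₁ at-p

        inner-triangle : ∀ {x y z} → π x ≡ o → π y ≡ o → π z ≡ o →
                         G x y → G y z → G x z → Facial ρ x y z
        inner-triangle _ _ _ pq qr pr = inj₁ pqr-face
        inner-triangle _ _ _ qr rp qp = facial-rotate ρ {p} {q} {r} (inj₁ pqr-face)
        inner-triangle _ _ _ rp pq rq = facial-rotate ρ {q} {r} {p} (facial-rotate ρ {p} {q} {r} (inj₁ pqr-face))
        inner-triangle _ _ _ pr rq pq = inj₂ pqr-face
        inner-triangle _ _ _ rq qp rp = facial-rotate ρ {p} {r} {q} (inj₂ pqr-face)
        inner-triangle _ _ _ qp pr qr = facial-rotate ρ {r} {q} {p} (facial-rotate ρ {p} {r} {q} (inj₂ pqr-face))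

        attached : ∀ {u x} → π x ≡ o → G (old u) x → x ≡ attach u
        attached _ ap = sym attach-a
        attached _ bq = sym attach-b
        attached _ cr = sym attach-c

        no-fan : ∀ {u x y} → π x ≡ o → π y ≡ o → G (old u) x → G (old u) y → ¬ G x y
        no-fan ox oy ux uy xy with trans (attached ox ux) (sym (attached oy uy))
        no-fan {x = p} _ _ _ _ () | refl
        no-fan {x = q} _ _ _ _ () | refl
        no-fan {x = r} _ _ _ _ () | refl
        no-fan {x = old _} () _ _ _ _ | refl

        anchor : TriG X → X
        anchor p = a
        anchor q = b
        anchor _ = c

        anchored : ∀ {u x} → π x ≡ o → G x (old u) → u ≡ anchor x
        anchored _ pa = refl
        anchored _ qb = refl
        anchored _ rc = refl

        R-of : ∀ {u v} → G (old u) (old v) → R u v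
        R-of (oo e) = e

        no-outer-edge : ∀ {u v x} → π x ≡ o → G x (old u) → G x (old v) → ¬ G (old u) (old v)
        no-outer-edge ox xu xv (oo e) with trans (anchored ox xu) (sym (anchored ox xv))
        ... | refl = R-irrefl e

        ascend-face : ∀ {u v t} → Face ρᴴ (old u) (old v) (old t) → Face ρ (old u) (old v) (old t)
        ascend-face (e₁ , e₂ , e₃) = π-old _ e₁ , π-old _ e₂ , π-old _ e₃

        view : (v : TriG X) → π v ≡ o ⊎ ∃ λ u → v ≡ old u
        view p       = inj₁ refl
        view q       = inj₁ refl
        view r       = inj₁ refl
        view (old u) = inj₂ (u , refl)

        -- An outside vertex sees at most one corner, and a corner has one outside neighbour. So
        -- every triangle other than `p q r` avoids all three corners and is already a triangle of
        -- `H`.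
        triangle : ∀ {x y z} → G x y → G y z → G x z → Facial ρ x y z
        triangle {x} {y} {z} xy yz xz with view x | view y | view z
        ... | inj₁ ox | inj₁ oy | inj₁ oz = inner-triangle ox oy oz xy yz xz
        ... | inj₁ ox | inj₁ oy | inj₂ (_ , refl) = contradiction xy (no-fan ox oy (G-sym xz) (G-sym yz))
        ... | inj₁ ox | inj₂ (_ , refl) | inj₁ oz = contradiction xz (no-fan ox oz (G-sym xy) yz)
        ... | inj₂ (_ , refl) | inj₁ oy | inj₁ oz = contradiction yz (no-fan oy oz xy xz)
        ... | inj₁ ox | inj₂ (_ , refl) | inj₂ (_ , refl) = contradiction yz (no-outer-edge ox xy xz)
        ... | inj₂ (_ , refl) | inj₁ oy | inj₂ (_ , refl) = contradiction xz (no-outer-edge oy (G-sym xy) yz)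
        ... | inj₂ (_ , refl) | inj₂ (_ , refl) | inj₁ oz = contradiction xy (no-outer-edge oz (G-sym xz) (G-sym yz))
        ... | inj₂ (u , refl) | inj₂ (v , refl) | inj₂ (t , refl)
          with triangles rᴴ {old u} {old v} {old t} (oo (R-of xy)) (oo (R-of yz)) (oo (R-of xz))
        ...   | inj₁ f = inj₁ (ascend-face f)
        ...   | inj₂ f = inj₂ (ascend-face f)

        on-face : TriG X → TriG X → Bool
        on-face p q = true
        on-face q r = true
        on-face r p = true
        on-face _ _ = false

        on-face-complete : ∀ {u v} → OnTriangle p q r u v → on-face u v ≡ true
        on-face-complete side₁ = refl
        on-face-complete side₂ = refl
        on-face-complete side₃ = refl

        on-face-sound : ∀ u v → on-face u v ≡ true → OnTriangle p q r u v
        on-face-sound p q _ = side₁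
        on-face-sound q r _ = side₂
        on-face-sound r p _ = side₃

        face-only : ∀ {u v} → G u v → γ u v ≡ γ p q → OnTriangle p q r u v
        face-only = face-colour G-sym rot euler-G col pqr-face pq qr rp
                      on-face on-face-complete on-face-sound

        a≉pq : γ p (old a) ≢ γ p q
        a≉pq e with face-only pa e
        ... | ()
        b≉pq : γ q (old b) ≢ γ p q
        b≉pq e with face-only qb e
        ... | ()
        c≉pq : γ r (old c) ≢ γ p q
        c≉pq e with face-only rc e
        ... | ()

        -- The outer edge at `p` has the faces of `r c` and of `p a` on its sides. Equal colours
        -- would remain equal after gluing and contradict `two-sided` in `H`. The next two are the
        -- same at `q` and `r`.
        c≉a : γ r (old c) ≢ γ p (old a)
        c≉a e = two-sided H-sym rotᴴ colouring rᴴ ao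
          (λ e → a≢c (old-injective (trans (sym e) (cong old ν-a)))) (λ ())
          (trans γ-ao (trans (cong m (trans γap e)) (sym γ-oa)))
        a≉b : γ p (old a) ≢ γ q (old b)
        a≉b e = two-sided H-sym rotᴴ colouring rᴴ bo
          (λ e → a≢b (old-injective (trans (sym (cong old ν-b)) e))) (λ ())
          (trans γ-bo (trans (cong m (trans γbq e)) (sym γ-ob)))
        b≉c : γ q (old b) ≢ γ r (old c)
        b≉c e = two-sided H-sym rotᴴ colouring rᴴ co
          (λ e → b≢c (old-injective (trans (sym (cong old ν-c)) e))) (λ ())
          (trans γ-co (trans (cong m (trans γcr e)) (sym γ-oc)))

        -- The colour of `q b` is that of the face outside the side `q r`. The darts leaving `p`
        -- show only the inner colour and the two other outer ones.
        p-avoids : ∀ {x} → G p x → γ p x ≢ γ q (old b)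
        p-avoids pq e = b≉pq (sym e)
        p-avoids pr e = b≉c (sym (trans (sym γpr) e))
        p-avoids pa e = a≉b e

        q-avoids : ∀ {x} → G q x → γ q x ≢ γ r (old c)
        q-avoids qr e = c≉pq (trans (sym e) γqr)
        q-avoids qp e = c≉a (sym (trans (sym γqp) e))
        q-avoids qb e = b≉c e

        r-avoids : ∀ {x} → G r x → γ r x ≢ γ p (old a)
        r-avoids rp e = a≉pq (trans (sym e) γrp)
        r-avoids rq e = a≉b (trans (sym e) γrq)
        r-avoids rc e = c≉a e

        Meet : TriG X → TriG X → Set
        Meet u v = ∀ {w x y} → G w x → G w y → γ w x ≡ γ u v → γ w y ≡ γ v u → w ≡ u ⊎ w ≡ v

        flip-meet : ∀ {u v} → Meet u v → Meet v u
        flip-meet meet wx wy e₁ e₂ = Sum.swap (meet wy wx e₂ e₁)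

        meet-H : ∀ {u v w x y} → H u v → G w x → G w y →
                 m (γ w x) ≡ γᴴ u v → m (γ w y) ≡ γᴴ v u → π w ≡ u ⊎ π w ≡ v
        meet-H uv wx wy e₁ e₂ = faces-meet rᴴ uv (proj₁ (proj₂ (descend wx))) (proj₁ (proj₂ (descend wy)))
          (trans (proj₂ (proj₂ (descend wx))) e₁) (trans (proj₂ (proj₂ (descend wy))) e₂)

        outside : ∀ {t v} {u : TriG X} → π (old t) ≡ o ⊎ π (old t) ≡ old v → old t ≡ u ⊎ _≡_ {A = TriG X} (old t) (old v)
        outside (inj₂ refl) = inj₂ refl

        meet-pa : Meet p (old a)
        meet-pa {p} _ _ _ _ = inj₁ refl
        meet-pa {q} _ wy _ e₂ = contradiction (trans e₂ γap) (q-avoids wy)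
        meet-pa {r} wx _ e₁ _ = contradiction e₁ (r-avoids wx)
        meet-pa {old t} wx wy e₁ e₂ =
          outside (meet-H oa wx wy (trans (cong m e₁) (sym γ-oa)) (trans (cong m e₂) (sym γ-ao)))

        meet-qb : Meet q (old b)
        meet-qb {q} _ _ _ _ = inj₁ refl
        meet-qb {r} _ wy _ e₂ = contradiction (trans e₂ γbq) (r-avoids wy)
        meet-qb {p} wx _ e₁ _ = contradiction e₁ (p-avoids wx)
        meet-qb {old t} wx wy e₁ e₂ =
          outside (meet-H ob wx wy (trans (cong m e₁) (sym γ-ob)) (trans (cong m e₂) (sym γ-bo)))

        meet-rc : Meet r (old c)
        meet-rc {r} _ _ _ _ = inj₁ refl
        meet-rc {p} _ wy _ e₂ = contradiction (trans e₂ γcr) (p-avoids wy)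
        meet-rc {q} wx _ e₁ _ = contradiction e₁ (q-avoids wx)
        meet-rc {old t} wx wy e₁ e₂ =
          outside (meet-H oc wx wy (trans (cong m e₁) (sym γ-oc)) (trans (cong m e₂) (sym γ-co)))

        meet-pq : Meet p q
        meet-pq wx wy e₁ e₂ with face-only wx e₁
        ... | side₁ = inj₁ refl
        ... | side₂ = inj₂ refl
        ... | side₃ = contradiction (trans e₂ γqp) (r-avoids wy)

        meet-qr : Meet q r
        meet-qr wx wy e₁ e₂ with face-only wx (trans e₁ γqr)
        ... | side₁ = contradiction (trans e₂ γrq) (p-avoids wy)
        ... | side₂ = inj₁ refl
        ... | side₃ = inj₂ refl

        meet-rp : Meet r p
        meet-rp wx wy e₁ e₂ with face-only wx (trans e₁ γrp)
        ... | side₁ = inj₂ refl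
        ... | side₂ = contradiction (trans e₂ γpr) (q-avoids wy)
        ... | side₃ = inj₁ refl

        meets : ∀ {u v} → G u v → Meet u v
        meets pq = meet-pq
        meets qp = flip-meet meet-pq
        meets qr = meet-qr
        meets rq = flip-meet meet-qr
        meets rp = meet-rp
        meets pr = flip-meet meet-rp
        meets pa = meet-pa
        meets ap = flip-meet meet-pa
        meets qb = meet-qb
        meets bq = flip-meet meet-qb
        meets rc = meet-rc
        meets cr = flip-meet meet-rc
        meets (oo uv) {w} wx wy e₁ e₂ =
          Sum.map (π-old w) (π-old w) (meet-H (oo uv) wx wy (cong m e₁) (cong m e₂))

        rigid-G : Rigid G ρ col
        rigid-G = record { triangles = triangle ; faces-meet = λ uv → meets uv }

    -- r is turned the other way: the loop left by the contraction would separate c from a and b.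
    module Mixed {ρ : TriG X → TriG X → TriG X} (rot : Rotation G ρ)
                 (at-p : Cycle₃ (ρ p) r q (old a)) (at-q : Cycle₃ (ρ q) p r (old b))
                 (at-r : Cycle₃ (ρ r) q (old c) p) where

      -- Contracting `q r` and `r p` now leaves the cyclic order `b`, loop, `c`, loop, `a` at `o`,
      -- and dropping the loop brings `c` back between `b` and `a`.
      ν : X → X
      ν v with attach v
      ... | q = c
      ... | r = a
      ... | _ = b

      ν-a : ν a ≡ b
      ν-a rewrite attach-a = refl
      ν-b : ν b ≡ c
      ν-b rewrite attach-b = refl
      ν-c : ν c ≡ a
      ν-c rewrite attach-c = refl

      open Restrict rot ν

      rotᴴ : Rotation H ρᴴ
      rotᴴ = rotation (cycle₃-rotation (cong old ν-a , cong old ν-b , cong old ν-c) oa ob oc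
               (λ e → Sum.map₂ Sum.swap (o-nbrs e)))

      module Colours {k : ℕ} (col : Colouring G ρ k) where
        γ : TriG X → TriG X → Fin k
        γ = colour col

        next : ∀ {u v w} → G u v → ρ v u ≡ w → γ u v ≡ γ v w
        next e refl = invariant col e

        γqp : γ q p ≡ γ p (old a)
        γqp = next qp (proj₁ (proj₂ at-p))
        γrq : γ r q ≡ γ q (old b)
        γrq = next rq (proj₁ (proj₂ at-q))
        γpr : γ p r ≡ γ q (old b)
        γpr = trans (next pr (proj₂ (proj₂ at-r))) γrq
        γap : γ (old a) p ≡ γ q (old b)
        γap = trans (next ap (proj₂ (proj₂ at-p))) γpr
        γbq : γ (old b) q ≡ γ p (old a)
        γbq = trans (next bq (proj₂ (proj₂ at-q))) γqp
        γqr : γ q r ≡ γ r (old c)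
        γqr = next qr (proj₁ at-r)
        γpq : γ p q ≡ γ r (old c)
        γpq = trans (next pq (proj₁ at-q)) γqr
        γrp : γ r p ≡ γ r (old c)
        γrp = trans (next rp (proj₁ at-p)) γpq
        -- The face runs `c r p q r c`, so it has the outer edge at `r` on both sides. This survives
        -- any gluing and is what refutes the case of equality.
        γcr : γ (old c) r ≡ γ r (old c)
        γcr = trans (next cr (proj₁ (proj₂ at-r))) γrp

        module Glue {k′ : ℕ} (m : Fin k → Fin k′) (m-glues : m (γ p q) ≡ m (γ q p))
                    (m-surj : ∀ t → ∃ λ y → m y ≡ t) where
          open Merge col m m-surj hiding (γ) public

          m-ca : m (γ r (old c)) ≡ m (γ p (old a))
          m-ca = trans (cong m (sym γpq)) (trans m-glues (cong m γqp))

          inner : ∀ {u v} → G u v → π u ≡ o → π v ≡ o → ∃ λ w → H o w × γᴴ o w ≡ m (γ u v)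
          inner pq _ _ = old c , oc , trans γ-oc (cong m (sym γpq))
          inner qr _ _ = old c , oc , trans γ-oc (cong m (sym γqr))
          inner rp _ _ = old c , oc , trans γ-oc (cong m (sym γrp))
          inner qp _ _ = old a , oa , trans γ-oa (cong m (sym γqp))
          inner rq _ _ = old b , ob , trans γ-ob (cong m (sym γrq))
          inner pr _ _ = old b , ob , trans γ-ob (cong m (sym γpr))

          open Close (trans (cong m γap) (trans (sym γ-ob) (cong (γᴴ o ∘ old) (sym ν-a))))
                     -- In `G` the face arriving from `b` goes on to `a`, but in `H` to `c`; the
                     -- loop lay between them, and the gluing identifies the two colours.
                     (trans (cong m γbq) (trans (sym m-ca) (trans (sym γ-oc) (cong (γᴴ o ∘ old) (sym ν-b)))))
                     (trans (cong m γcr) (trans m-ca (trans (sym γ-oa) (cong (γᴴ o ∘ old) (sym ν-c)))))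
                     inner public

        bound : ∀ {K} → Whitney H K → k ≤ suc K × (k ≡ suc K → γ p q ≢ γ q p)
        bound w = merge-bound λ m glues surj → euler w rotᴴ (Glue.colouring m glues surj)

      impossible : ∀ {K} → Whitney H K → ¬ Colouring G ρ (suc K)
      impossible {K} w col with glue (γ p q) (γ q p) (proj₂ (bound w) refl)
        where open Colours col
      ... | _ , refl , m , glues , surj =
        two-sided H-sym rotᴴ colouring (rigid w rotᴴ colouring) co (λ e → a≢c (old-injective (trans (sym (cong old ν-c)) e))) (λ ())
          (trans γ-co (trans (cong m γcr) (sym γ-oc)))
        where
        open Colours col
        open Glue m glues surj
    module Extend {ρ : TriH X → TriH X → TriH X} (rot : Rotation H ρ) {k : ℕ} (col : Colouring H ρ k)
                  (at-o : Cycle₃ (ρ o) (old a) (old c) (old b)) where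

      γ : TriH X → TriH X → Fin k
      γ = colour col

      ρᴳ : TriG X → TriG X → TriG X
      ρᴳ p q       = old a
      ρᴳ p r       = q
      ρᴳ p _       = r
      ρᴳ q p       = r
      ρᴳ q r       = old b
      ρᴳ q _       = p
      ρᴳ r p       = old c
      ρᴳ r q       = p
      ρᴳ r _       = q
      ρᴳ (old u) v = lift (old u) (ρ (old u) (π v))

      -- Zero is the new face `p q r`. A side traversed the other way takes the colour of the outer
      -- edge that follows it on its face.
      γᴳ : TriG X → TriG X → Fin (suc k)
      γᴳ p q       = zero
      γᴳ q r       = zero
      γᴳ r p       = zero
      γᴳ p r       = suc (γ o (old c))
      γᴳ p _       = suc (γ o (old a))
      γᴳ q p       = suc (γ o (old a))
      γᴳ q _       = suc (γ o (old b))
      γᴳ r q       = suc (γ o (old b))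
      γᴳ r _       = suc (γ o (old c))
      γᴳ (old u) v = suc (γ (old u) (π v))

      lift-adj-old : ∀ {u v} → H (old u) v → G (old u) (lift (old u) v)
      lift-adj-old {u} {v} e = subst (λ x → G x (lift (old u) v)) (lift-old v u) (lift-adj e)

      rotation-old : ∀ u → RotationAt (G (old u)) (ρᴳ (old u))
      rotation-old u = (λ e → lift-adj-old (proj₁ (rot (old u)) (π-adj e))) , reach
        where
        reach : ∀ {v w} → G (old u) v → G (old u) w → Star (λ x y → ρᴳ (old u) x ≡ y) v w
        reach e f = subst₂ (Star _) (lift-π e) (lift-π f)
          (star-map {N = H (old u)} (lift (old u)) (proj₁ (rot (old u)))
            (λ g → cong (lift (old u) ∘ ρ (old u)) (π-lift g) ◅ ε)
            (π-adj e) (proj₂ (rot (old u)) (π-adj e) (π-adj f)))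

      rotᴳ : Rotation G ρᴳ
      rotᴳ p       = cycle₃-rotation (refl , refl , refl) pr pq pa p-nbrs
      rotᴳ q       = cycle₃-rotation (refl , refl , refl) qp qr qb q-nbrs
      rotᴳ r       = cycle₃-rotation (refl , refl , refl) rq rp rc r-nbrs
      rotᴳ (old u) = rotation-old u

      leave : ∀ {u v} → H u (old v) → suc (γ u (old v)) ≡ γᴳ (old v) (lift (old v) (ρ (old v) u))
      leave {u} {v} e = cong suc (trans (invariant col e)
        (cong (γ (old v)) (sym (π-lift (proj₁ (rot (old v)) (H-sym e))))))

      enter : ∀ {u v} → H (old u) o → ρ o (old u) ≡ v → γ (old u) o ≡ γ o v
      enter e refl = invariant col e

      inv : ∀ {u v} → G u v → γᴳ u v ≡ γᴳ v (ρᴳ v u)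
      inv pq     = refl
      inv qr     = refl
      inv rp     = refl
      inv qp     = refl
      inv rq     = refl
      inv pr     = refl
      inv pa     = leave oa
      inv qb     = leave ob
      inv rc     = leave oc
      inv ap     = cong suc (enter ao (proj₁ at-o))
      inv bq     = cong suc (enter bo (proj₂ (proj₂ at-o)))
      inv cr     = cong suc (enter co (proj₁ (proj₂ at-o)))
      inv (oo e) = leave (oo e)

      hit : ∀ {u v} → H u v → ∃₂ λ x y → G x y × γᴳ x y ≡ suc (γ u v)
      hit oa = p , old a , pa , refl
      hit ob = q , old b , qb , refl
      hit oc = r , old c , rc , refl
      hit ao = old a , p , ap , refl
      hit bo = old b , q , bq , refl
      hit co = old c , r , cr , refl
      hit (oo e) = _ , _ , oo e , refl

      surj : ∀ t → ∃₂ λ x y → G x y × γᴳ x y ≡ t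
      surj zero    = p , q , pq , refl
      surj (suc t) with surjective col t
      ... | u , v , e , refl = hit e

      colouring : Colouring G ρᴳ (suc k)
      colouring = record { colour = γᴳ ; invariant = inv ; surjective = surj }

    triangle-darts : ∀ {m} → Enumeration (Darts H) m → Enumeration (Darts G) (6 + m)
    triangle-darts e =
      reindex f g f-Q gf g-P fg (sum-enumeration (fin-enumeration 6) e)
      where
      new : Fin 6 → TriG X × TriG X
      new zero                               = p , q
      new (suc zero)                         = q , p
      new (suc (suc zero))                   = q , r
      new (suc (suc (suc zero)))             = r , q
      new (suc (suc (suc (suc zero))))       = r , p
      new (suc (suc (suc (suc (suc zero))))) = p , r
      f : Fin 6 ⊎ TriH X × TriH X → TriG X × TriG X
      f (inj₁ i)       = new i
      f (inj₂ (u , v)) = lift v u , lift u v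
      g : TriG X × TriG X → Fin 6 ⊎ TriH X × TriH X
      g (p , q) = inj₁ zero
      g (q , p) = inj₁ (suc zero)
      g (q , r) = inj₁ (suc (suc zero))
      g (r , q) = inj₁ (suc (suc (suc zero)))
      g (r , p) = inj₁ (suc (suc (suc (suc zero))))
      g (p , r) = inj₁ (suc (suc (suc (suc (suc zero)))))
      g (u , v) = inj₂ (π u , π v)
      new-adj : ∀ i → Darts G (new i)
      new-adj zero                               = pq
      new-adj (suc zero)                         = qp
      new-adj (suc (suc zero))                   = qr
      new-adj (suc (suc (suc zero)))             = rq
      new-adj (suc (suc (suc (suc zero))))       = rp
      new-adj (suc (suc (suc (suc (suc zero))))) = pr
      f-Q : ∀ x → [ (λ _ → ⊤) , Darts H ]′ x → Darts G (f x)
      f-Q (inj₁ i) _       = new-adj i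
      f-Q (inj₂ (u , v)) e = lift-adj e
      gf-new : ∀ i → g (new i) ≡ inj₁ i
      gf-new zero                               = refl
      gf-new (suc zero)                         = refl
      gf-new (suc (suc zero))                   = refl
      gf-new (suc (suc (suc zero)))             = refl
      gf-new (suc (suc (suc (suc zero))))       = refl
      gf-new (suc (suc (suc (suc (suc zero))))) = refl
      gf-dart : ∀ {u v} → H u v → g (lift v u , lift u v) ≡ inj₂ (u , v)
      gf-dart oa rewrite attach-a = refl
      gf-dart ob rewrite attach-b = refl
      gf-dart oc rewrite attach-c = refl
      gf-dart ao rewrite attach-a = refl
      gf-dart bo rewrite attach-b = refl
      gf-dart co rewrite attach-c = refl
      gf-dart (oo _) = refl
      gf : ∀ x → [ (λ _ → ⊤) , Darts H ]′ x → g (f x) ≡ x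
      gf (inj₁ i) _       = gf-new i
      gf (inj₂ (u , v)) e = gf-dart e
      back : ∀ {u v} → G u v → [ (λ _ → ⊤) , Darts H ]′ (g (u , v)) × f (g (u , v)) ≡ (u , v)
      back pq = tt , refl
      back qp = tt , refl
      back qr = tt , refl
      back rq = tt , refl
      back rp = tt , refl
      back pr = tt , refl
      back pa = oa , cong (_, old a) attach-a
      back qb = ob , cong (_, old b) attach-b
      back rc = oc , cong (_, old c) attach-c
      back ap = ao , cong (old a ,_) attach-a
      back bq = bo , cong (old b ,_) attach-b
      back cr = co , cong (old c ,_) attach-c
      back (oo e) = oo e , refl
      g-P : ∀ y → Darts G y → [ (λ _ → ⊤) , Darts H ]′ (g y)
      g-P _ e = proj₁ (back e)
      fg : ∀ y → Darts G y → f (g y) ≡ y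
      fg _ e = proj₂ (back e)

  -- Symmetries of the triangle, and the induction step for D3a.

  turn turn⁻¹ exchange : {X : Set} → TriG X → TriG X
  turn p       = r
  turn q       = p
  turn r       = q
  turn (old v) = old v
  turn⁻¹ p       = q
  turn⁻¹ q       = r
  turn⁻¹ r       = p
  turn⁻¹ (old v) = old v
  exchange p = q
  exchange q = p
  exchange v = v

  turn-turn⁻¹ : {X : Set} (v : TriG X) → turn (turn⁻¹ v) ≡ v
  turn-turn⁻¹ p       = refl
  turn-turn⁻¹ q       = refl
  turn-turn⁻¹ r       = refl
  turn-turn⁻¹ (old _) = refl

  turn⁻¹-turn : {X : Set} (v : TriG X) → turn⁻¹ (turn v) ≡ v
  turn⁻¹-turn p       = refl
  turn⁻¹-turn q       = refl
  turn⁻¹-turn r       = refl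
  turn⁻¹-turn (old _) = refl

  exchange-involutive : {X : Set} (v : TriG X) → exchange (exchange v) ≡ v
  exchange-involutive p       = refl
  exchange-involutive q       = refl
  exchange-involutive r       = refl
  exchange-involutive (old _) = refl

  turned exchanged : Frame → Frame
  turned P = record
    { X = X ; _≟_ = _≟_ ; R = R ; a = b ; b = c ; c = a ; a≢b = b≢c ; b≢c = a≢c ∘ sym ; a≢c = a≢b ∘ sym
    ; R-sym = R-sym ; R-irrefl = R-irrefl }
    where open Frame P
  exchanged P = record
    { X = X ; _≟_ = _≟_ ; R = R ; a = b ; b = a ; c = c ; a≢b = a≢b ∘ sym ; b≢c = a≢c ; a≢c = b≢c
    ; R-sym = R-sym ; R-irrefl = R-irrefl }
    where open Frame P

  turn-G : ∀ P → Tri.G P ≃ Tri.G (turned P)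
  turn-G P = record
    { to = turn ; from = turn⁻¹ ; to-adj = to-adj ; from-adj = from-adj
    ; from-to = λ {u} {v} _ → turn⁻¹-turn u , turn⁻¹-turn v
    ; to-from = λ {u} {v} _ → turn-turn⁻¹ u , turn-turn⁻¹ v }
    where
    to-adj : ∀ {u v} → Tri.G P u v → Tri.G (turned P) (turn u) (turn v)
    to-adj Tri.pq = Tri.rp
    to-adj Tri.qp = Tri.pr
    to-adj Tri.qr = Tri.pq
    to-adj Tri.rq = Tri.qp
    to-adj Tri.rp = Tri.qr
    to-adj Tri.pr = Tri.rq
    to-adj Tri.pa = Tri.rc
    to-adj Tri.ap = Tri.cr
    to-adj Tri.qb = Tri.pa
    to-adj Tri.bq = Tri.ap
    to-adj Tri.rc = Tri.qb
    to-adj Tri.cr = Tri.bq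
    to-adj (Tri.oo e) = Tri.oo e
    from-adj : ∀ {u v} → Tri.G (turned P) u v → Tri.G P (turn⁻¹ u) (turn⁻¹ v)
    from-adj Tri.pq = Tri.qr
    from-adj Tri.qp = Tri.rq
    from-adj Tri.qr = Tri.rp
    from-adj Tri.rq = Tri.pr
    from-adj Tri.rp = Tri.pq
    from-adj Tri.pr = Tri.qp
    from-adj Tri.pa = Tri.qb
    from-adj Tri.ap = Tri.bq
    from-adj Tri.qb = Tri.rc
    from-adj Tri.bq = Tri.cr
    from-adj Tri.rc = Tri.pa
    from-adj Tri.cr = Tri.ap
    from-adj (Tri.oo e) = Tri.oo e

  turn-H : ∀ P → Tri.H P ≃ Tri.H (turned P)
  turn-H P = record
    { to = λ v → v ; from = λ v → v ; to-adj = to-adj ; from-adj = from-adj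
    ; from-to = λ _ → refl , refl ; to-from = λ _ → refl , refl }
    where
    to-adj : ∀ {u v} → Tri.H P u v → Tri.H (turned P) u v
    to-adj Tri.oa = Tri.oc
    to-adj Tri.ao = Tri.co
    to-adj Tri.ob = Tri.oa
    to-adj Tri.bo = Tri.ao
    to-adj Tri.oc = Tri.ob
    to-adj Tri.co = Tri.bo
    to-adj (Tri.oo e) = Tri.oo e
    from-adj : ∀ {u v} → Tri.H (turned P) u v → Tri.H P u v
    from-adj Tri.oa = Tri.ob
    from-adj Tri.ao = Tri.bo
    from-adj Tri.ob = Tri.oc
    from-adj Tri.bo = Tri.co
    from-adj Tri.oc = Tri.oa
    from-adj Tri.co = Tri.ao
    from-adj (Tri.oo e) = Tri.oo e

  exchange-G : ∀ P → Tri.G P ≃ Tri.G (exchanged P)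
  exchange-G P = record
    { to = exchange ; from = exchange ; to-adj = to-adj ; from-adj = from-adj
    ; from-to = λ {u} {v} _ → exchange-involutive u , exchange-involutive v
    ; to-from = λ {u} {v} _ → exchange-involutive u , exchange-involutive v }
    where
    to-adj : ∀ {u v} → Tri.G P u v → Tri.G (exchanged P) (exchange u) (exchange v)
    to-adj Tri.pq = Tri.qp
    to-adj Tri.qp = Tri.pq
    to-adj Tri.qr = Tri.pr
    to-adj Tri.rq = Tri.rp
    to-adj Tri.rp = Tri.rq
    to-adj Tri.pr = Tri.qr
    to-adj Tri.pa = Tri.qb
    to-adj Tri.ap = Tri.bq
    to-adj Tri.qb = Tri.pa
    to-adj Tri.bq = Tri.ap
    to-adj Tri.rc = Tri.rc
    to-adj Tri.cr = Tri.cr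
    to-adj (Tri.oo e) = Tri.oo e
    from-adj : ∀ {u v} → Tri.G (exchanged P) u v → Tri.G P (exchange u) (exchange v)
    from-adj Tri.pq = Tri.qp
    from-adj Tri.qp = Tri.pq
    from-adj Tri.qr = Tri.pr
    from-adj Tri.rq = Tri.rp
    from-adj Tri.rp = Tri.rq
    from-adj Tri.pr = Tri.qr
    from-adj Tri.pa = Tri.qb
    from-adj Tri.ap = Tri.bq
    from-adj Tri.qb = Tri.pa
    from-adj Tri.bq = Tri.ap
    from-adj Tri.rc = Tri.rc
    from-adj Tri.cr = Tri.cr
    from-adj (Tri.oo e) = Tri.oo e

  exchange-H : ∀ P → Tri.H P ≃ Tri.H (exchanged P)
  exchange-H P = record
    { to = λ v → v ; from = λ v → v ; to-adj = to-adj ; from-adj = from-adj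
    ; from-to = λ _ → refl , refl ; to-from = λ _ → refl , refl }
    where
    to-adj : ∀ {u v} → Tri.H P u v → Tri.H (exchanged P) u v
    to-adj Tri.oa = Tri.ob
    to-adj Tri.ao = Tri.bo
    to-adj Tri.ob = Tri.oa
    to-adj Tri.bo = Tri.ao
    to-adj Tri.oc = Tri.oc
    to-adj Tri.co = Tri.co
    to-adj (Tri.oo e) = Tri.oo e
    from-adj : ∀ {u v} → Tri.H (exchanged P) u v → Tri.H P u v
    from-adj Tri.oa = Tri.ob
    from-adj Tri.ao = Tri.bo
    from-adj Tri.ob = Tri.oa
    from-adj Tri.bo = Tri.ao
    from-adj Tri.oc = Tri.oc
    from-adj Tri.co = Tri.co
    from-adj (Tri.oo e) = Tri.oo e

  -- The last two fields of `Whitney` for one fixed rotation, since the relabelling to apply depends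
  -- on how `ρ` turns at the corners.
  Outcome : {V : Set} (A : V → V → Set) (K : ℕ) (ρ : V → V → V) → Set
  Outcome A K ρ = (∀ {k} → Colouring A ρ k → k ≤ K) × (∀ (c : Colouring A ρ K) → Rigid A ρ c)

  transfer : {V W : Set} {A : V → V → Set} {B : W → W → Set} {K : ℕ} (i : A ≃ B) {ρ : V → V → V} →
             (∀ {u v} → A u v → A v u) → Rotation A ρ →
             Outcome B K (Pull.pull (≃-sym i) ρ) → Outcome A K ρ
  transfer i symA rot (bound , rig) =
    (λ c → bound (P.pull-colouring symA rot c)) , (λ c → P.push-rigid symA rot c (rig (P.pull-colouring symA rot c)))
    where module P = Pull (≃-sym i)

  conjugate : ∀ {X} (f g : TriG X → TriG X) {x y z} → Cycle₃ f x y z →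
              (∀ v → g (turn v) ≡ turn (f v)) → Cycle₃ g (turn x) (turn y) (turn z)
  conjugate f g (e₁ , e₂ , e₃) h =
    trans (h _) (cong turn e₁) , trans (h _) (cong turn e₂) , trans (h _) (cong turn e₃)

  module _ (P : Frame) where
    open Frame P

    p-orientation : ∀ {ρ} → Rotation (Tri.G P) ρ → Cycle₃ (ρ p) r q (old a) ⊎ Cycle₃ (ρ p) r (old a) q
    p-orientation rot = rotation₃ (rot p) Tri.pr Tri.pq Tri.pa (λ ()) (λ ()) (λ ()) (Tri.p-nbrs P)

    q-orientation : ∀ {ρ} → Rotation (Tri.G P) ρ → Cycle₃ (ρ q) p r (old b) ⊎ Cycle₃ (ρ q) p (old b) r
    q-orientation rot = rotation₃ (rot q) Tri.qp Tri.qr Tri.qb (λ ()) (λ ()) (λ ()) (Tri.q-nbrs P)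

    r-orientation : ∀ {ρ} → Rotation (Tri.G P) ρ → Cycle₃ (ρ r) q p (old c) ⊎ Cycle₃ (ρ r) q (old c) p
    r-orientation rot = rotation₃ (rot r) Tri.rq Tri.rp Tri.rc (λ ()) (λ ()) (λ ()) (Tri.r-nbrs P)

    turn-outcome : ∀ {K} {ρ} → Rotation (Tri.G P) ρ → Whitney (Tri.H P) K →
      (Whitney (Tri.H (turned P)) K → Rotation (Tri.G (turned P)) (Pull.pull (≃-sym (turn-G P)) ρ) →
        Outcome (Tri.G (turned P)) (suc K) (Pull.pull (≃-sym (turn-G P)) ρ)) →
      Outcome (Tri.G P) (suc K) ρ
    turn-outcome rot w f = transfer (turn-G P) (Tri.G-sym P) rot
      (f (≃-whitney (Tri.H-sym P) (turn-H P) w) (Pull.pull-rotation (≃-sym (turn-G P)) rot))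

  -- Of the three corners of the triangle two consecutive ones are turned the same way; up to a
  -- relabelling these are p and q, turned positively.
  module _ (P : Frame) {K : ℕ} (w : Whitney (Tri.H P) K) where
    open Frame P

    aligned : ∀ {ρ} → Rotation (Tri.G P) ρ → Cycle₃ (ρ p) r q (old a) → Cycle₃ (ρ q) p r (old b) →
              Outcome (Tri.G P) (suc K) ρ
    aligned {ρ} rot at-p at-q with r-orientation P rot
    ... | inj₁ at-r = bound , λ col → Tri.Positive.Rigidity.rigid-G P rot at-p at-q at-r w col bound
      where
      bound : ∀ {k} → Colouring (Tri.G P) ρ k → k ≤ suc K
      bound col = proj₁ (Tri.Positive.Colours.bound P rot at-p at-q at-r col w)
    ... | inj₂ at-r = (λ col → proj₁ (Tri.Mixed.Colours.bound P rot at-p at-q at-r col w))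
                    , λ col → contradiction col (Tri.Mixed.impossible P rot at-p at-q at-r w)

  module _ (P : Frame) {K : ℕ} (w : Whitney (Tri.H P) K) where
    open Frame P

    -- Exchanging `p` and `q` reverses both cyclic orders. This case and the next one are closed off
    -- over the frame, because later cases apply them to a relabelled frame.
    same-pq : ∀ {ρ} → Rotation (Tri.G P) ρ →
              Cycle₃ (ρ p) r q (old a) × Cycle₃ (ρ q) p r (old b) ⊎
              Cycle₃ (ρ p) r (old a) q × Cycle₃ (ρ q) p (old b) r → Outcome (Tri.G P) (suc K) ρ
    same-pq rot (inj₁ (at-p , at-q)) = aligned P w rot at-p at-q
    same-pq {ρ} rot (inj₂ ((ra , aq , qr) , (pb , br , rp))) =
      transfer (exchange-G P) (Tri.G-sym P) rot
        (aligned (exchanged P) (≃-whitney (Tri.H-sym P) (exchange-H P) w)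
          (Pull.pull-rotation (≃-sym (exchange-G P)) rot)
          (cong exchange rp , cong exchange pb , cong exchange br)
          (cong exchange qr , cong exchange ra , cong exchange aq))

  module _ (P : Frame) {K : ℕ} (w : Whitney (Tri.H P) K) where
    open Frame P

    same-qr : ∀ {ρ} → Rotation (Tri.G P) ρ →
              Cycle₃ (ρ q) p r (old b) × Cycle₃ (ρ r) q p (old c) ⊎
              Cycle₃ (ρ q) p (old b) r × Cycle₃ (ρ r) q (old c) p → Outcome (Tri.G P) (suc K) ρ
    same-qr {ρ} rot cycles =
      turn-outcome P rot w λ w′ rot′ → same-pq (turned P) w′ rot′ (Sum.map both both cycles)
      where
      ρ′ : TriG X → TriG X → TriG X
      ρ′ = Pull.pull (≃-sym (turn-G P)) ρ
      both : ∀ {x y z x′ y′ z′} → Cycle₃ (ρ q) x y z × Cycle₃ (ρ r) x′ y′ z′ →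
             Cycle₃ (ρ′ p) (turn x) (turn y) (turn z) × Cycle₃ (ρ′ q) (turn x′) (turn y′) (turn z′)
      both (e , e′) = conjugate (ρ q) (ρ′ p) e (λ v → cong (turn ∘ ρ q) (turn⁻¹-turn v))
                    , conjugate (ρ r) (ρ′ q) e′ (λ v → cong (turn ∘ ρ r) (turn⁻¹-turn v))

  module _ (P : Frame) {K : ℕ} (w : Whitney (Tri.H P) K) where
    open Frame P

    same-rp : ∀ {ρ} → Rotation (Tri.G P) ρ →
              Cycle₃ (ρ r) q p (old c) × Cycle₃ (ρ p) r q (old a) ⊎
              Cycle₃ (ρ r) q (old c) p × Cycle₃ (ρ p) r (old a) q → Outcome (Tri.G P) (suc K) ρ
    same-rp {ρ} rot cycles =
      turn-outcome P rot w λ w′ rot′ → same-qr (turned P) w′ rot′ (Sum.map both both cycles)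
      where
      ρ′ : TriG X → TriG X → TriG X
      ρ′ = Pull.pull (≃-sym (turn-G P)) ρ
      both : ∀ {x y z x′ y′ z′} → Cycle₃ (ρ r) x y z × Cycle₃ (ρ p) x′ y′ z′ →
             Cycle₃ (ρ′ q) (turn x) (turn y) (turn z) × Cycle₃ (ρ′ r) (turn x′) (turn y′) (turn z′)
      both (e , e′) = conjugate (ρ r) (ρ′ q) e (λ v → cong (turn ∘ ρ r) (turn⁻¹-turn v))
                    , conjugate (ρ p) (ρ′ r) e′ (λ v → cong (turn ∘ ρ p) (turn⁻¹-turn v))

    outcome : ∀ {ρ} → Rotation (Tri.G P) ρ → Outcome (Tri.G P) (suc K) ρ
    outcome rot with p-orientation P rot | q-orientation P rot | r-orientation P rot
    ... | inj₁ e | inj₁ f | _      = same-pq P w rot (inj₁ (e , f))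
    ... | inj₂ e | inj₂ f | _      = same-pq P w rot (inj₂ (e , f))
    ... | inj₁ e | inj₂ _ | inj₁ g = same-rp rot (inj₁ (g , e))
    ... | inj₂ e | inj₁ _ | inj₂ g = same-rp rot (inj₂ (g , e))
    ... | inj₁ _ | inj₂ f | inj₂ g = same-qr P w rot (inj₂ (f , g))
    ... | inj₂ _ | inj₁ f | inj₁ g = same-qr P w rot (inj₁ (f , g))

    -- Either cyclic order may occur at `o`; exchanging `a` and `b` turns one into the other, so
    -- `Extend` handles only one.
    embedding-G : ∃ λ ρ → Rotation (Tri.G P) ρ × Colouring (Tri.G P) ρ (suc K)
    embedding-G with embedding w
    ... | ρ , rot , col
      with rotation₃ (rot o) Tri.oa Tri.oc Tri.ob (a≢c ∘ old-injective) (b≢c ∘ sym ∘ old-injective) (a≢b ∘ old-injective) (Tri.o-nbrs P)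
    ...   | inj₁ e = _ , Tri.Extend.rotᴳ P rot col e , Tri.Extend.colouring P rot col e
    ...   | inj₂ (ab , bc , ca) = _ , Pull.pull-rotation (exchange-G P) E.rotᴳ
                                , Pull.pull-colouring (exchange-G P) (Tri.G-sym (exchanged P)) E.rotᴳ E.colouring
      where
      module E = Tri.Extend (exchanged P) (Pull.pull-rotation (≃-sym (exchange-H P)) rot)
                   (Pull.pull-colouring (≃-sym (exchange-H P)) (Tri.H-sym P) rot col) (bc , ca , ab)

  triangle-step : ∀ P {K} → Whitney (Tri.H P) K → Whitney (Tri.G P) (suc K)
  triangle-step P w = record
    { embedding = embedding-G P w
    ; euler     = λ rot → proj₁ (outcome P w rot)
    ; rigid     = λ rot → proj₂ (outcome P w rot) }

-- The base case: rotations of the complete graph on four vertices.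

A₄ : Fin 4 → Fin 4 → Set
A₄ = Adj K4

A₄-sym : ∀ {u v} → A₄ u v → A₄ v u
A₄-sym {u} {v} e = trans (k4sym v u) e

turned : Bool → Fin 3 → Fin 3
turned true  zero             = suc zero
turned true  (suc zero)       = suc (suc zero)
turned true  (suc (suc zero)) = zero
turned false zero             = suc (suc zero)
turned false (suc zero)       = zero
turned false (suc (suc zero)) = suc zero

-- `punchIn u` lists the three neighbours of `u` in increasing order, and `b` chooses the direction
-- in which they are turned. The value at `u` itself is junk.
row : Fin 4 → Bool → Fin 4 → Fin 4
row u b v with u Fin.≟ v
... | yes _ = v
... | no ne = punchIn u (turned b (punchOut ne))

nbr-adj : ∀ u i → A₄ u (punchIn u i)
nbr-adj u i = adjacent (Fin.punchInᵢ≢i u i ∘ sym)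
  where
  adjacent : ∀ {u v} → u ≢ v → A₄ u v
  adjacent {u} {v} ne with u Fin.≟ v
  ... | yes e = contradiction e ne
  ... | no _  = refl

nbrs : ∀ u {v} → A₄ u v → ∃ λ i → v ≡ punchIn u i
nbrs u {v} e with u Fin.≟ v
... | no ne = punchOut ne , sym (Fin.punchIn-punchOut ne)

row-nbr : ∀ u b i → row u b (punchIn u i) ≡ punchIn u (turned b i)
row-nbr u b i with u Fin.≟ punchIn u i
... | yes e = contradiction (sym e) (Fin.punchInᵢ≢i u i)
... | no ne = cong (punchIn u ∘ turned b) (trans (Fin.punchOut-cong u refl) (Fin.punchOut-punchIn u))

three : ∀ (P : Fin 4 → Set) u → P (punchIn u zero) → P (punchIn u (suc zero)) → P (punchIn u (suc (suc zero))) →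
        ∀ {v} → A₄ u v → P v
three P u a b c e with nbrs u e
... | zero , refl           = a
... | suc zero , refl       = b
... | suc (suc zero) , refl = c

nbrs₃ : ∀ u {v} → A₄ u v → v ≡ punchIn u zero ⊎ v ≡ punchIn u (suc zero) ⊎ v ≡ punchIn u (suc (suc zero))
nbrs₃ u = three (λ v → v ≡ punchIn u zero ⊎ v ≡ punchIn u (suc zero) ⊎ v ≡ punchIn u (suc (suc zero))) u (inj₁ refl) (inj₂ (inj₁ refl)) (inj₂ (inj₂ refl))

row-rotation : ∀ u b → RotationAt (A₄ u) (row u b)
row-rotation u true = cycle₃-rotation
  (row-nbr u true zero , row-nbr u true (suc zero) , row-nbr u true (suc (suc zero)))
  (nbr-adj u zero) (nbr-adj u (suc zero)) (nbr-adj u (suc (suc zero))) (nbrs₃ u)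
row-rotation u false = cycle₃-rotation
  (row-nbr u false zero , row-nbr u false (suc (suc zero)) , row-nbr u false (suc zero))
  (nbr-adj u zero) (nbr-adj u (suc (suc zero))) (nbr-adj u (suc zero)) (Sum.map₂ Sum.swap ∘ nbrs₃ u)

rotation-row : ∀ u {f} → RotationAt (A₄ u) f → ∃ λ b → ∀ {v} → A₄ u v → f v ≡ row u b v
rotation-row u rot with rotation₃ rot (nbr-adj u zero) (nbr-adj u (suc zero)) (nbr-adj u (suc (suc zero)))
    (distinct (λ ())) (distinct (λ ())) (distinct (λ ())) (nbrs₃ u)
  where
  distinct : ∀ {i j : Fin 3} → i ≢ j → punchIn u i ≢ punchIn u j
  distinct ne e = ne (Fin.punchIn-injective u _ _ e)
... | inj₁ (e₀ , e₁ , e₂) = true , three (λ v → _ ≡ row u _ v) u (trans e₀ (sym (row-nbr u true zero)))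
        (trans e₁ (sym (row-nbr u true (suc zero)))) (trans e₂ (sym (row-nbr u true (suc (suc zero)))))
... | inj₂ (e₀ , e₂ , e₁) = false , three (λ v → _ ≡ row u _ v) u (trans e₀ (sym (row-nbr u false zero)))
        (trans e₁ (sym (row-nbr u false (suc zero)))) (trans e₂ (sym (row-nbr u false (suc (suc zero)))))

table : Bool → Bool → Bool → Bool → Fin 4 → Fin 4 → Fin 4
table b₀ b₁ b₂ b₃ zero                   = row zero b₀
table b₀ b₁ b₂ b₃ (suc zero)             = row (suc zero) b₁
table b₀ b₁ b₂ b₃ (suc (suc zero))       = row (suc (suc zero)) b₂
table b₀ b₁ b₂ b₃ (suc (suc (suc zero))) = row (suc (suc (suc zero))) b₃

table-rotation : ∀ b₀ b₁ b₂ b₃ → Rotation A₄ (table b₀ b₁ b₂ b₃)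
table-rotation b₀ b₁ b₂ b₃ zero                   = row-rotation zero b₀
table-rotation b₀ b₁ b₂ b₃ (suc zero)             = row-rotation (suc zero) b₁
table-rotation b₀ b₁ b₂ b₃ (suc (suc zero))       = row-rotation (suc (suc zero)) b₂
table-rotation b₀ b₁ b₂ b₃ (suc (suc (suc zero))) = row-rotation (suc (suc (suc zero))) b₃

-- Reduces all rotations to sixteen tables. Agreement is claimed on darts only, as a rotation is
-- arbitrary elsewhere; `Agree` transfers the results.
rotation-table : ∀ {ρ} → Rotation A₄ ρ → ∃ λ b₀ → ∃ λ b₁ → ∃ λ b₂ → ∃ λ b₃ →
                 ∀ {u v} → A₄ u v → ρ u v ≡ table b₀ b₁ b₂ b₃ u v
rotation-table {ρ} rot = _ , _ , _ , _ , agree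
  where
  agree : ∀ {u v} → A₄ u v → ρ u v ≡ table _ _ _ _ u v
  agree {zero}                   = proj₂ (rotation-row zero (rot zero))
  agree {suc zero}               = proj₂ (rotation-row (suc zero) (rot (suc zero)))
  agree {suc (suc zero)}         = proj₂ (rotation-row (suc (suc zero)) (rot (suc (suc zero))))
  agree {suc (suc (suc zero))}   = proj₂ (rotation-row (suc (suc (suc zero))) (rot (suc (suc (suc zero)))))

-- `τ v u` and `τ u v` are the apexes of the triangles on the two sides of `u v`. They are different
-- and are the only common neighbours of `u` and `v`.
Tetrahedral : (Fin 4 → Fin 4 → Fin 4) → Set
Tetrahedral τ = ∀ u v → A₄ u v → Face τ u v (τ v u) × τ v u ≢ τ u v ×
                (∀ w → A₄ u w → A₄ v w → w ≡ τ v u ⊎ w ≡ τ u v)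

A₄? : ∀ u v → Dec (A₄ u v)
A₄? u v = k4adj u v ≟ᵇ true

tetrahedral? : ∀ τ → Dec (Tetrahedral τ)
tetrahedral? τ = Fin.all? λ u → Fin.all? λ v → A₄? u v →-dec
  ((τ v u Fin.≟ τ v u) ×-dec (τ (τ v u) v Fin.≟ u) ×-dec (τ u (τ v u) Fin.≟ v)) ×-dec
  ¬? (τ v u Fin.≟ τ u v) ×-dec
  Fin.all? λ w → A₄? u w →-dec (A₄? v w →-dec ((w Fin.≟ τ v u) ⊎-dec (w Fin.≟ τ u v)))

FewOrTetrahedral : (Fin 4 → Fin 4 → Fin 4) → Set
FewOrTetrahedral τ = numFaces K4 τ ≤ 3 ⊎ numFaces K4 τ ≤ 4 × Tetrahedral τ

bool-all? : {P : Bool → Set} → (∀ b → Dec (P b)) → Dec (∀ b → P b)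
bool-all? {P} P? = map′ (λ { (t , f) true → t ; (t , f) false → f }) (λ all → all true , all false) (P? true ×-dec P? false)

few-or-tetrahedral? : ∀ τ → Dec (FewOrTetrahedral τ)
few-or-tetrahedral? τ = (numFaces K4 τ ℕ.≤? 3) ⊎-dec ((numFaces K4 τ ℕ.≤? 4) ×-dec tetrahedral? τ)

-- Evaluation of the decision procedure on all sixteen tables.
table-checked : ∀ b₀ b₁ b₂ b₃ → FewOrTetrahedral (table b₀ b₁ b₂ b₃)
table-checked = from-yes (bool-all? λ b₀ → bool-all? λ b₁ → bool-all? λ b₂ → bool-all? λ b₃ →
  few-or-tetrahedral? (table b₀ b₁ b₂ b₃))

-- Stated without numFaces, which the type checker would unfold when comparing types.
Good : (Fin 4 → Fin 4 → Fin 4) → Set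
Good τ = (∀ {k} → Colouring A₄ τ k → k ≤ 3) ⊎ (∀ {k} → Colouring A₄ τ k → k ≤ 4) × Tetrahedral τ

good : ∀ {τ} → Rotation A₄ τ → FewOrTetrahedral τ → Good τ
good {τ} rot (inj₁ few)          = inj₁ λ {k} c → ℕ.≤-trans {k} {numFaces K4 τ} (Faces.colours≤faces K4 τ rot c) few
good {τ} rot (inj₂ (four , tet)) = inj₂ ((λ {k} c → ℕ.≤-trans {k} {numFaces K4 τ} (Faces.colours≤faces K4 τ rot c) four) , tet)

table-good : ∀ b₀ b₁ b₂ b₃ → Good (table b₀ b₁ b₂ b₃)
table-good b₀ b₁ b₂ b₃ = good {table b₀ b₁ b₂ b₃} (table-rotation b₀ b₁ b₂ b₃) (table-checked b₀ b₁ b₂ b₃)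

onTriangle? : ∀ {n} (x y z u v : Fin n) → Dec (OnTriangle x y z u v)
onTriangle? x y z u v = map′
  (λ { (inj₁ (refl , refl)) → side₁ ; (inj₂ (inj₁ (refl , refl))) → side₂ ; (inj₂ (inj₂ (refl , refl))) → side₃ })
  (λ { side₁ → inj₁ (refl , refl) ; side₂ → inj₂ (inj₁ (refl , refl)) ; side₃ → inj₂ (inj₂ (refl , refl)) })
  ((u Fin.≟ x ×-dec v Fin.≟ y) ⊎-dec (u Fin.≟ y ×-dec v Fin.≟ z) ⊎-dec (u Fin.≟ z ×-dec v Fin.≟ x))

dec-sound : {P : Set} (P? : Dec P) → does P? ≡ true → P
dec-sound (yes p) _ = p

-- A triangle on `x y` has a common neighbour as its third vertex, hence one of the two apexes. As
-- four colours are the maximum, a colour occurs on one triangle only, and the two triangles along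
-- an edge have different apexes.
tetrahedral-rigid : ∀ {τ} → Rotation A₄ τ → (∀ {k} → Colouring A₄ τ k → k ≤ 4) → Tetrahedral τ →
                    (c : Colouring A₄ τ 4) → Rigid A₄ τ c
tetrahedral-rigid {τ} rot bound tet c = record { triangles = tri ; faces-meet = meets }
  where
  tri : ∀ {x y z} → A₄ x y → A₄ y z → A₄ x z → Facial τ x y z
  tri {x} {y} {z} xy yz xz with proj₂ (proj₂ (tet x y xy)) z xz yz
  ... | inj₁ refl = inj₁ (proj₁ (tet x y xy))
  ... | inj₂ refl = Sum.swap (facial-rotate τ {y} {x} {τ x y} (inj₁ (proj₁ (tet y x (A₄-sym {x} {y} xy)))))
  meets : ∀ {u v w x y} → A₄ u v → A₄ w x → A₄ w y →
         colour c w x ≡ colour c u v → colour c w y ≡ colour c v u → w ≡ u ⊎ w ≡ v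
  meets {u} {v} uv wx wy e₁ e₂ = common (on uv wx e₁) (on (A₄-sym {u} {v} uv) wy e₂)
    where
    on : ∀ {u v w x} → A₄ u v → A₄ w x → colour c w x ≡ colour c u v → OnTriangle u v (τ v u) w x
    on {u} {v} uv = face-colour (λ {u} {v} → A₄-sym {u} {v}) rot bound c (proj₁ (tet u v uv)) uv vw
      (subst (A₄ (τ v u)) (proj₁ (proj₂ (proj₁ (tet u v uv)))) (proj₁ (rot (τ v u)) (A₄-sym {v} {τ v u} vw)))
      (λ a b → does (onTriangle? u v (τ v u) a b)) (dec-true (onTriangle? u v (τ v u) _ _))
      (λ a b → dec-sound (onTriangle? u v (τ v u) a b))
      where
      vw : A₄ v (τ v u)
      vw = proj₁ (rot v) (A₄-sym {u} {v} uv)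
    common : ∀ {w x y} → OnTriangle u v (τ v u) w x → OnTriangle v u (τ u v) w y → w ≡ u ⊎ w ≡ v
    common side₁ _ = inj₁ refl
    common side₂ _ = inj₂ refl
    common {w} {x} {y} side₃ s = third-corner s refl
      where
      third-corner : ∀ {a b} → OnTriangle v u (τ u v) a b → a ≡ τ v u → τ v u ≡ u ⊎ τ v u ≡ v
      third-corner side₁ e = inj₂ (sym e)
      third-corner side₂ e = inj₁ (sym e)
      third-corner side₃ e = contradiction (sym e) (proj₁ (proj₂ (tet u v uv)))

module Agree {V : Set} {A : V → V → Set} {ρ τ : V → V → V} (symA : ∀ {u v} → A u v → A v u)
             (agree : ∀ {u v} → A u v → ρ u v ≡ τ u v) where

  agree-colouring : ∀ {k} → Colouring A ρ k → Colouring A τ k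
  agree-colouring c = record
    { colour     = colour c
    ; invariant  = λ {u} {v} e → trans (invariant c e) (cong (colour c v) (agree (symA e)))
    ; surjective = surjective c }

  agree-face : ∀ {x y z} → A x y → A y z → A x z → Face τ x y z → Face ρ x y z
  agree-face xy yz xz (e₁ , e₂ , e₃) =
    trans (agree (symA xy)) e₁ , trans (agree (symA yz)) e₂ , trans (agree xz) e₃

  agree-rigid : ∀ {k} (c : Colouring A ρ k) → Rigid A τ (agree-colouring c) → Rigid A ρ c
  agree-rigid c r = record
    { triangles  = λ xy yz xz → Sum.map (agree-face xy yz xz) (agree-face xz (symA yz) xy) (triangles r xy yz xz)
    ; faces-meet = λ uv → faces-meet r uv }

good-euler : ∀ {τ} → Good τ → ∀ {k} → Colouring A₄ τ k → k ≤ 4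
good-euler (inj₁ few)        c = ℕ.m≤n⇒m≤1+n (few c)
good-euler (inj₂ (four , _)) c = four c

good-rigid : ∀ {τ} → Rotation A₄ τ → Good τ → (c : Colouring A₄ τ 4) → Rigid A₄ τ c
good-rigid rot (inj₁ few)          c = contradiction (few c) (ℕ.<-irrefl refl)
good-rigid rot (inj₂ (four , tet)) c = tetrahedral-rigid rot four tet c

GoodCopy : (Fin 4 → Fin 4 → Fin 4) → Set
GoodCopy ρ = ∃ λ τ → Rotation A₄ τ × Good τ × (∀ u v → A₄ u v → ρ u v ≡ τ u v)

good-copy : ∀ {ρ} → Rotation A₄ ρ → GoodCopy ρ
good-copy rot with rotation-table rot
... | b₀ , b₁ , b₂ , b₃ , agree =
  table b₀ b₁ b₂ b₃ , table-rotation b₀ b₁ b₂ b₃ , table-good b₀ b₁ b₂ b₃ , λ u v → agree {u} {v}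

copy-euler : ∀ {ρ} → GoodCopy ρ → ∀ {k} → Colouring A₄ ρ k → k ≤ 4
copy-euler (τ , rot , g , agree) c =
  good-euler g (Agree.agree-colouring (λ {u} {v} → A₄-sym {u} {v}) (λ {u} {v} → agree u v) c)

copy-rigid : ∀ {ρ} → GoodCopy ρ → (c : Colouring A₄ ρ 4) → Rigid A₄ ρ c
copy-rigid (τ , rot , g , agree) c =
  Agree.agree-rigid (λ {u} {v} → A₄-sym {u} {v}) (λ {u} {v} → agree u v) c
    (good-rigid rot g (Agree.agree-colouring (λ {u} {v} → A₄-sym {u} {v}) (λ {u} {v} → agree u v) c))

-- The alternating directions are the signs in the boundary of a simplex: the face opposite to
-- vertex `i`, with increasing vertices, is oriented by the parity of `i`.
plane : Fin 4 → Fin 4 → Fin 4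
plane = table true false true false

plane-faces : numFaces K4 plane ≡ 4
plane-faces = refl

plane-colouring : Colouring A₄ plane 4
plane-colouring = subst (Colouring A₄ plane) plane-faces
  (Faces.face-colouring K4 plane (table-rotation true false true false) (λ _ _ → subst Fin (sym plane-faces) zero))

K4-whitney : Whitney A₄ 4
K4-whitney = record
  { embedding = plane , table-rotation true false true false , plane-colouring
  ; euler     = λ rot → copy-euler (good-copy rot)
  ; rigid     = λ rot → copy-rigid (good-copy rot) }

-- From graphs to labelled configurations: D3b.

record Polyhedral (G : Graph) : Set where
  field
    connected : Connected G
    K         : ℕ
    faces     : n G + K ≡ numEdges G + 2
    whitney   : Whitney (Adj G) K

open Polyhedral

adj-sym : (G : Graph) → ∀ {u v} → Adj G u v → Adj G v u
adj-sym G {u} {v} e = trans (Graph.sym G v u) e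

adj-irrefl : (G : Graph) → ∀ {u v} → Adj G u v → u ≢ v
adj-irrefl G {u} e refl = contradiction (trans (sym e) (irrefl G u)) (λ ())

not-adj : (G : Graph) → ∀ {u v} → adj G u v ≡ false → ¬ Adj G u v
not-adj G e e′ = contradiction (trans (sym e) e′) (λ ())

record PathConfig (G H : Graph) : Set where
  field
    p₀ q₀ r₀ s₀ : V G
    ψ           : V H → V G
    p-third : ∃ λ z → Adj G p₀ z × z ≢ q₀ × z ≢ s₀ × (∀ {w} → Adj G p₀ w → w ≡ q₀ ⊎ w ≡ s₀ ⊎ w ≡ z)
    r-third : ∃ λ z → Adj G r₀ z × z ≢ q₀ × z ≢ s₀ × (∀ {w} → Adj G r₀ w → w ≡ q₀ ⊎ w ≡ s₀ ⊎ w ≡ z)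
    q-nbrs₀ : ∀ {w} → Adj G q₀ w → w ≡ p₀ ⊎ w ≡ r₀ ⊎ w ≡ s₀
    pq₀     : Adj G p₀ q₀
    qr₀     : Adj G q₀ r₀
    p≢r     : p₀ ≢ r₀
    p≁r     : ¬ Adj G p₀ r₀
    sp₀     : Adj G s₀ p₀
    sq₀     : Adj G s₀ q₀
    sr₀     : Adj G s₀ r₀
    ψ-injective  : ∀ a b → ψ a ≡ ψ b → a ≡ b
    ψ≢q          : ∀ a → ψ a ≢ q₀
    ψ-surjective : ∀ u → u ≢ q₀ → ∃ λ a → ψ a ≡ u
    H-adj        : ∀ a b → Adj H a b ⇔ (Adj G (ψ a) (ψ b) ⊎ (ψ a ≡ p₀ × ψ b ≡ r₀) ⊎ (ψ a ≡ r₀ × ψ b ≡ p₀))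

module PathGraph {G H : Graph} (config : PathConfig G H) where
  open PathConfig config
  open PathReduction

  p≢q : p₀ ≢ q₀
  p≢q = adj-irrefl G pq₀
  q≢r : q₀ ≢ r₀
  q≢r = adj-irrefl G qr₀
  s≢p : s₀ ≢ p₀
  s≢p = adj-irrefl G sp₀
  s≢q : s₀ ≢ q₀
  s≢q = adj-irrefl G sq₀
  s≢r : s₀ ≢ r₀
  s≢r = adj-irrefl G sr₀

  Old : V G → Set
  Old u = u ≢ p₀ × u ≢ q₀ × u ≢ r₀ × u ≢ s₀

  R : V G → V G → Set
  R u v = Adj G u v × Old u × Old v

  S : V G → Set
  S v = Adj G s₀ v × Old v

  R-sym : ∀ {u v} → R u v → R v u
  R-sym (e , ou , ov) = adj-sym G e , ov , ou

  p° r° : V G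
  p° = proj₁ p-third
  r° = proj₁ r-third

  pp° : Adj G p₀ p°
  pp° = proj₁ (proj₂ p-third)
  rr° : Adj G r₀ r°
  rr° = proj₁ (proj₂ r-third)

  old-p° : Old p°
  old-p° = (λ e → adj-irrefl G pp° (sym e)) , proj₁ (proj₂ (proj₂ p-third))
    , (λ e → p≁r (subst (Adj G p₀) e pp°)) , proj₁ (proj₂ (proj₂ (proj₂ p-third)))

  old-r° : Old r°
  old-r° = (λ e → p≁r (adj-sym G (subst (Adj G r₀) e rr°))) , proj₁ (proj₂ (proj₂ r-third))
    , (λ e → adj-irrefl G rr° (sym e)) , proj₁ (proj₂ (proj₂ (proj₂ r-third)))

  P : Frame
  P = record { X = V G ; R = R ; S = S ; p° = p° ; r° = r° ; R-sym = R-sym }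

  place : PathG (V G) → V G
  place p       = p₀
  place q       = q₀
  place r       = r₀
  place s       = s₀
  place (old u) = u

  -- The graph of `label` as an inductive relation: matching on it determines vertex and label
  -- together, while `label` itself is stuck on four equality tests.
  data At : V G → PathG (V G) → Set where
    at-p   : At p₀ p
    at-q   : At q₀ q
    at-r   : At r₀ r
    at-s   : At s₀ s
    at-old : ∀ {u} → Old u → At u (old u)

  locate : ∀ u → ∃ (At u)
  locate u with u Fin.≟ p₀ | u Fin.≟ q₀ | u Fin.≟ r₀ | u Fin.≟ s₀
  ... | yes refl | _        | _        | _        = p , at-p
  ... | no _     | yes refl | _        | _        = q , at-q
  ... | no _     | no _     | yes refl | _        = r , at-r
  ... | no _     | no _     | no _     | yes refl = s , at-s
  ... | no ¬p    | no ¬q    | no ¬r    | no ¬s    = old u , at-old (¬p , ¬q , ¬r , ¬s)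

  label : V G → PathG (V G)
  label u = proj₁ (locate u)

  at-label : ∀ u → At u (label u)
  at-label u = proj₂ (locate u)

  at-place : ∀ {u x} → At u x → place x ≡ u
  at-place at-p       = refl
  at-place at-q       = refl
  at-place at-r       = refl
  at-place at-s       = refl
  at-place (at-old _) = refl

  at-unique : ∀ {u v x y} → At u x → At v y → u ≡ v → x ≡ y
  at-unique at-p at-p e = refl
  at-unique at-q at-q e = refl
  at-unique at-r at-r e = refl
  at-unique at-s at-s e = refl
  at-unique (at-old _) (at-old _) refl = refl
  at-unique at-p at-q e = contradiction e p≢q
  at-unique at-p at-r e = contradiction e p≢r
  at-unique at-p at-s e = contradiction (sym e) s≢p
  at-unique at-q at-p e = contradiction (sym e) p≢q
  at-unique at-q at-r e = contradiction e q≢r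
  at-unique at-q at-s e = contradiction (sym e) s≢q
  at-unique at-r at-p e = contradiction (sym e) p≢r
  at-unique at-r at-q e = contradiction (sym e) q≢r
  at-unique at-r at-s e = contradiction (sym e) s≢r
  at-unique at-s at-p e = contradiction e s≢p
  at-unique at-s at-q e = contradiction e s≢q
  at-unique at-s at-r e = contradiction e s≢r
  at-unique at-p (at-old (np , _ , _ , _)) e = contradiction (sym e) np
  at-unique at-q (at-old (_ , nq , _ , _)) e = contradiction (sym e) nq
  at-unique at-r (at-old (_ , _ , nr , _)) e = contradiction (sym e) nr
  at-unique at-s (at-old (_ , _ , _ , ns)) e = contradiction (sym e) ns
  at-unique (at-old (np , _ , _ , _)) at-p e = contradiction e np
  at-unique (at-old (_ , nq , _ , _)) at-q e = contradiction e nq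
  at-unique (at-old (_ , _ , nr , _)) at-r e = contradiction e nr
  at-unique (at-old (_ , _ , _ , ns)) at-s e = contradiction e ns

  at-G : ∀ {x y} → Path.G P x y → At (place x) x
  at-G Path.pq = at-p
  at-G Path.qp = at-q
  at-G Path.qr = at-q
  at-G Path.rq = at-r
  at-G Path.qs = at-q
  at-G Path.sq = at-s
  at-G Path.ps = at-p
  at-G Path.sp = at-s
  at-G Path.rs = at-r
  at-G Path.sr = at-s
  at-G Path.po = at-p
  at-G Path.op = at-old old-p°
  at-G Path.ro = at-r
  at-G Path.or = at-old old-r°
  at-G (Path.so e) = at-s
  at-G (Path.os (_ , o)) = at-old o
  at-G (Path.oo (_ , o , _)) = at-old o

  label-place : ∀ {x y} → Path.G P x y → label (place x) ≡ x
  label-place e = at-unique (at-label _) (at-G e) refl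

  place-adj : ∀ {x y} → Path.G P x y → Adj G (place x) (place y)
  place-adj Path.pq = pq₀
  place-adj Path.qp = adj-sym G pq₀
  place-adj Path.qr = qr₀
  place-adj Path.rq = adj-sym G qr₀
  place-adj Path.qs = adj-sym G sq₀
  place-adj Path.sq = sq₀
  place-adj Path.ps = adj-sym G sp₀
  place-adj Path.sp = sp₀
  place-adj Path.rs = adj-sym G sr₀
  place-adj Path.sr = sr₀
  place-adj Path.po = pp°
  place-adj Path.op = adj-sym G pp°
  place-adj Path.ro = rr°
  place-adj Path.or = adj-sym G rr°
  place-adj (Path.so (e , _)) = e
  place-adj (Path.os (e , _)) = adj-sym G e
  place-adj (Path.oo (e , _)) = e

  from-p : ∀ {v y} → At v y → Adj G p₀ v → Path.G P p y
  from-p a e with proj₂ (proj₂ (proj₂ (proj₂ p-third))) e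
  ... | inj₁ v≡q with at-unique a at-q v≡q
  ...   | refl = Path.pq
  from-p a e | inj₂ (inj₁ v≡s) with at-unique a at-s v≡s
  ...   | refl = Path.ps
  from-p a e | inj₂ (inj₂ v≡o) with at-unique a (at-old old-p°) v≡o
  ...   | refl = Path.po

  from-r : ∀ {v y} → At v y → Adj G r₀ v → Path.G P r y
  from-r a e with proj₂ (proj₂ (proj₂ (proj₂ r-third))) e
  ... | inj₁ v≡q with at-unique a at-q v≡q
  ...   | refl = Path.rq
  from-r a e | inj₂ (inj₁ v≡s) with at-unique a at-s v≡s
  ...   | refl = Path.rs
  from-r a e | inj₂ (inj₂ v≡o) with at-unique a (at-old old-r°) v≡o
  ...   | refl = Path.ro

  from-q : ∀ {v y} → At v y → Adj G q₀ v → Path.G P q y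
  from-q a e with q-nbrs₀ e
  ... | inj₁ v≡p with at-unique a at-p v≡p
  ...   | refl = Path.qp
  from-q a e | inj₂ (inj₁ v≡r) with at-unique a at-r v≡r
  ...   | refl = Path.qr
  from-q a e | inj₂ (inj₂ v≡s) with at-unique a at-s v≡s
  ...   | refl = Path.qs

  at-adj : ∀ {u v x y} → At u x → At v y → Adj G u v → Path.G P x y
  at-adj at-p b e = from-p b e
  at-adj at-q b e = from-q b e
  at-adj at-r b e = from-r b e
  at-adj a at-p e = Path.G-sym P (from-p a (adj-sym G e))
  at-adj a at-q e = Path.G-sym P (from-q a (adj-sym G e))
  at-adj a at-r e = Path.G-sym P (from-r a (adj-sym G e))
  at-adj at-s at-s e = contradiction refl (adj-irrefl G e)
  at-adj at-s (at-old o) e = Path.so (e , o)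
  at-adj (at-old o) at-s e = Path.os (adj-sym G e , o)
  at-adj (at-old o) (at-old o′) e = Path.oo (e , o , o′)

  G-≃ : Path.G P ≃ Adj G
  G-≃ = record
    { to = place ; from = label ; to-adj = place-adj
    ; from-adj = λ {u} {v} e → at-adj (at-label u) (at-label v) e
    ; from-to = λ e → label-place e , label-place (Path.G-sym P e)
    ; to-from = λ {u} {v} _ → at-place (at-label u) , at-place (at-label v) }

  -- Junk at q₀.
  preimage : V G → V H
  preimage u with u Fin.≟ q₀
  ... | yes _ = proj₁ (ψ-surjective p₀ p≢q)
  ... | no ne = proj₁ (ψ-surjective u ne)

  ψ-preimage : ∀ {u} → u ≢ q₀ → ψ (preimage u) ≡ u
  ψ-preimage {u} ne with u Fin.≟ q₀
  ... | yes e = contradiction e ne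
  ... | no ne = proj₂ (ψ-surjective u ne)

  preimage-ψ : ∀ a → preimage (ψ a) ≡ a
  preimage-ψ a = ψ-injective _ _ (ψ-preimage (ψ≢q a))

  -- Junk at q.
  keep : PathG (V G) → PathH (V G)
  keep p       = p
  keep q       = p
  keep r       = r
  keep s       = s
  keep (old u) = old u

  labelᴴ : V H → PathH (V G)
  labelᴴ a = keep (label (ψ a))

  placeᴴ : PathH (V G) → V H
  placeᴴ x = preimage (place (emb x))

  emb-keep : ∀ {u x} → At u x → u ≢ q₀ → emb (keep x) ≡ x
  emb-keep at-p ne       = refl
  emb-keep at-q ne       = contradiction refl ne
  emb-keep at-r ne       = refl
  emb-keep at-s ne       = refl
  emb-keep (at-old _) ne = refl

  keep-emb : ∀ x → keep (emb x) ≡ x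
  keep-emb p       = refl
  keep-emb r       = refl
  keep-emb s       = refl
  keep-emb (old _) = refl

  emb-labelᴴ : ∀ a → emb (labelᴴ a) ≡ label (ψ a)
  emb-labelᴴ a = emb-keep (at-label (ψ a)) (ψ≢q a)

  labelᴴ-at : ∀ a {x} → At (ψ a) (emb x) → labelᴴ a ≡ x
  labelᴴ-at a {x} at = trans (cong keep (at-unique (at-label (ψ a)) at refl)) (keep-emb x)

  at-H : ∀ {x y} → Path.H P x y → At (place (emb x)) (emb x)
  at-H e = at-G (Path.lift-adj P e)

  at-≢q : ∀ {u} x → At u (emb x) → u ≢ q₀
  at-≢q p at-p = p≢q
  at-≢q r at-r = q≢r ∘ sym
  at-≢q s at-s = s≢q
  at-≢q (old _) (at-old (_ , nq , _)) = nq

  ψ-placeᴴ : ∀ {x y} → Path.H P x y → ψ (placeᴴ x) ≡ place (emb x)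
  ψ-placeᴴ {x} e = ψ-preimage (at-≢q x (at-H e))

  labelᴴ-placeᴴ : ∀ {x y} → Path.H P x y → labelᴴ (placeᴴ x) ≡ x
  labelᴴ-placeᴴ {x} e = labelᴴ-at (placeᴴ x) (subst (λ u → At u (emb x)) (sym (ψ-placeᴴ e)) (at-H e))

  placeᴴ-labelᴴ : ∀ a → placeᴴ (labelᴴ a) ≡ a
  placeᴴ-labelᴴ a = trans (cong (preimage ∘ place) (emb-labelᴴ a))
    (trans (cong preimage (at-place (at-label (ψ a)))) (preimage-ψ a))

  labelᴴ-adj : ∀ {a b} → Adj H a b → Path.H P (labelᴴ a) (labelᴴ b)
  labelᴴ-adj {a} {b} e with Equivalence.to (H-adj a b) e
  ... | inj₁ e′ = Path.descend P _ _ (subst₂ (Path.G P) (sym (emb-labelᴴ a)) (sym (emb-labelᴴ b))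
                    (at-adj (at-label (ψ a)) (at-label (ψ b)) e′))
  ... | inj₂ (inj₁ (a≡p , b≡r)) = subst₂ (Path.H P)
    (sym (labelᴴ-at a {p} (subst (λ u → At u p) (sym a≡p) at-p)))
    (sym (labelᴴ-at b {r} (subst (λ u → At u r) (sym b≡r) at-r))) Path.pr
  ... | inj₂ (inj₂ (a≡r , b≡p)) = subst₂ (Path.H P)
    (sym (labelᴴ-at a {r} (subst (λ u → At u r) (sym a≡r) at-r)))
    (sym (labelᴴ-at b {p} (subst (λ u → At u p) (sym b≡p) at-p))) Path.rp

  placeᴴ-adj : ∀ {x y} → Path.H P x y → Adj H (placeᴴ x) (placeᴴ y)
  placeᴴ-adj {x} {y} e = Equivalence.from (H-adj (placeᴴ x) (placeᴴ y))
    (subst₂ (λ u v → Adj G u v ⊎ (u ≡ p₀ × v ≡ r₀) ⊎ (u ≡ r₀ × v ≡ p₀))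
      (sym (ψ-placeᴴ e)) (sym (ψ-placeᴴ (Path.H-sym P e))) (cases e))
    where
    cases : ∀ {x y} → Path.H P x y → let u = place (emb x) ; v = place (emb y) in
            Adj G u v ⊎ (u ≡ p₀ × v ≡ r₀) ⊎ (u ≡ r₀ × v ≡ p₀)
    cases Path.pr = inj₂ (inj₁ (refl , refl))
    cases Path.rp = inj₂ (inj₂ (refl , refl))
    cases Path.ps = inj₁ (place-adj Path.ps)
    cases Path.sp = inj₁ (place-adj Path.sp)
    cases Path.rs = inj₁ (place-adj Path.rs)
    cases Path.sr = inj₁ (place-adj Path.sr)
    cases Path.po = inj₁ (place-adj Path.po)
    cases Path.op = inj₁ (place-adj Path.op)
    cases Path.ro = inj₁ (place-adj Path.ro)
    cases Path.or = inj₁ (place-adj Path.or)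
    cases (Path.so e) = inj₁ (place-adj (Path.so e))
    cases (Path.os e) = inj₁ (place-adj (Path.os e))
    cases (Path.oo e) = inj₁ (place-adj (Path.oo e))

  H-≃ : Path.H P ≃ Adj H
  H-≃ = record
    { to = placeᴴ ; from = labelᴴ ; to-adj = placeᴴ-adj ; from-adj = labelᴴ-adj
    ; from-to = λ e → labelᴴ-placeᴴ e , labelᴴ-placeᴴ (Path.H-sym P e)
    ; to-from = λ {a} {b} _ → placeᴴ-labelᴴ a , placeᴴ-labelᴴ b }

  vertices : n G ≡ suc (n H)
  vertices = enumeration-unique (fin-enumeration (n G))
    (reindex f g (λ _ _ → tt) gf g-P fg (sum-enumeration (fin-enumeration 1) (fin-enumeration (n H))))
    where
    f : Fin 1 ⊎ V H → V G
    f (inj₁ _) = q₀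
    f (inj₂ a) = ψ a
    g : V G → Fin 1 ⊎ V H
    g u with u Fin.≟ q₀
    ... | yes _ = inj₁ zero
    ... | no _  = inj₂ (preimage u)
    gf : ∀ x → [ (λ _ → ⊤) , (λ _ → ⊤) ]′ x → g (f x) ≡ x
    gf (inj₁ zero) _ with q₀ Fin.≟ q₀
    ... | yes _ = refl
    ... | no ne = contradiction refl ne
    gf (inj₂ a) _ with ψ a Fin.≟ q₀
    ... | yes e = contradiction e (ψ≢q a)
    ... | no _  = cong inj₂ (preimage-ψ a)
    g-P : ∀ u → ⊤ → [ (λ _ → ⊤) , (λ _ → ⊤) ]′ (g u)
    g-P u _ with u Fin.≟ q₀
    ... | yes _ = tt
    ... | no _  = tt
    fg : ∀ u → ⊤ → f (g u) ≡ u
    fg u _ with u Fin.≟ q₀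
    ... | yes e = sym e
    ... | no ne = ψ-preimage ne

  edges : numEdges G ≡ 2 + numEdges H
  edges = double-injective (numEdges G) (2 + numEdges H) (trans
    (enumeration-unique (graph-darts G)
      (≃-darts G-≃ (Path.path-darts P (≃-darts (≃-sym H-≃) (graph-darts H)))))
    (cong (2 +_) (ℕ.+-comm (2 + numEdges H) (numEdges H))))

  -- Paths of `H` are followed in `G` with the detour `p q r` in place of the new edge; `q₀` itself
  -- is reached through `p₀`.
  connect : Connected H → Connected G
  connect conn u v = enter u ◅◅ middle (conn (preimage (base u)) (preimage (base v))) ◅◅ leave v
    where
    base : V G → V G
    base u with u Fin.≟ q₀
    ... | yes _ = p₀
    ... | no _  = u
    enter : ∀ u → Star (Adj G) u (ψ (preimage (base u)))
    enter u with u Fin.≟ q₀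
    ... | yes refl = subst (Star (Adj G) q₀) (sym (ψ-preimage p≢q)) (adj-sym G pq₀ ◅ ε)
    ... | no ne    = subst (Star (Adj G) u) (sym (ψ-preimage ne)) ε
    leave : ∀ u → Star (Adj G) (ψ (preimage (base u))) u
    leave u with u Fin.≟ q₀
    ... | yes refl = subst (λ x → Star (Adj G) x q₀) (sym (ψ-preimage p≢q)) (pq₀ ◅ ε)
    ... | no ne    = subst (λ x → Star (Adj G) x u) (sym (ψ-preimage ne)) ε
    step : ∀ {a b} → Adj H a b → Star (Adj G) (ψ a) (ψ b)
    step {a} {b} e with Equivalence.to (H-adj a b) e
    ... | inj₁ e′ = e′ ◅ ε
    ... | inj₂ (inj₁ (a≡p , b≡r)) = subst₂ (Star (Adj G)) (sym a≡p) (sym b≡r) (pq₀ ◅ qr₀ ◅ ε)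
    ... | inj₂ (inj₂ (a≡r , b≡p)) = subst₂ (Star (Adj G)) (sym a≡r) (sym b≡p) (adj-sym G qr₀ ◅ adj-sym G pq₀ ◅ ε)
    middle : ∀ {a b} → Star (Adj H) a b → Star (Adj G) (ψ a) (ψ b)
    middle ε       = ε
    middle (e ◅ es) = step e ◅◅ middle es

  polyhedral : Polyhedral H → Polyhedral G
  polyhedral PH = record
    { connected = connect (connected PH)
    ; K         = suc (K PH)
    -- One vertex, two edges and one face more.
    ; faces     = trans (cong (_+ suc (K PH)) vertices) (trans (cong suc (ℕ.+-suc (n H) (K PH)))
        (trans (cong (2 +_) (faces PH)) (cong (_+ 2) (sym edges))))
    ; whitney   = ≃-whitney (Path.G-sym P) G-≃
        (path-step P (≃-whitney (adj-sym H) (≃-sym H-≃) (whitney PH))) }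

third-neighbour : (G : Graph) (v : V G) → degree G v ≡ 3 → ∀ {x y} → Adj G v x → Adj G v y → x ≢ y →
                  ∃ λ z → Adj G v z × z ≢ x × z ≢ y × (∀ {w} → Adj G v w → w ≡ x ⊎ w ≡ y ⊎ w ≡ z)
third-neighbour G v d = third (subst (Enumeration (Adj G v)) d (neighbours G v))

d3b-polyhedral : ∀ {G H} → D3b G H → Polyhedral H → Polyhedral G
d3b-polyhedral {G} {H} (p₀ , q₀ , r₀ , s₀ , ψ ,
  (dp , dq , dr , pq₀ , qr₀ , p≢r , p≁r , sp₀ , sq₀ , sr₀) , (inj , ψ≢q , surj , H-adj)) =
  PathGraph.polyhedral record
    { p₀ = p₀ ; q₀ = q₀ ; r₀ = r₀ ; s₀ = s₀ ; ψ = ψ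
    ; p-third = third-neighbour G p₀ dp pq₀ (adj-sym G sp₀) (adj-irrefl G (adj-sym G sq₀))
    ; r-third = third-neighbour G r₀ dr (adj-sym G qr₀) (adj-sym G sr₀) (adj-irrefl G (adj-sym G sq₀))
    ; q-nbrs₀ = q-nbrs₀ ; pq₀ = pq₀ ; qr₀ = qr₀ ; p≢r = p≢r ; p≁r = not-adj G p≁r
    ; sp₀ = sp₀ ; sq₀ = sq₀ ; sr₀ = sr₀
    ; ψ-injective = inj ; ψ≢q = ψ≢q ; ψ-surjective = surj ; H-adj = H-adj }
  where
  q-nbrs₀ : ∀ {w} → Adj G q₀ w → w ≡ p₀ ⊎ w ≡ r₀ ⊎ w ≡ s₀
  q-nbrs₀ e with third-neighbour G q₀ dq (adj-sym G pq₀) qr₀ p≢r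
  ... | z , qz , z≢p , z≢r , cover with cover (adj-sym G sq₀)
  ...   | inj₁ s≡p        = contradiction s≡p (adj-irrefl G sp₀)
  ...   | inj₂ (inj₁ s≡r) = contradiction s≡r (adj-irrefl G sr₀)
  ...   | inj₂ (inj₂ refl) = cover e

-- From graphs to labelled configurations: D3a.

record TriangleConfig (G H : Graph) : Set where
  field
    p₀ q₀ r₀ : V G
    φ        : V G → V H
    p-third  : ∃ λ z → Adj G p₀ z × z ≢ q₀ × z ≢ r₀ × (∀ {w} → Adj G p₀ w → w ≡ q₀ ⊎ w ≡ r₀ ⊎ w ≡ z)
    q-third  : ∃ λ z → Adj G q₀ z × z ≢ p₀ × z ≢ r₀ × (∀ {w} → Adj G q₀ w → w ≡ p₀ ⊎ w ≡ r₀ ⊎ w ≡ z)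
    r-third  : ∃ λ z → Adj G r₀ z × z ≢ p₀ × z ≢ q₀ × (∀ {w} → Adj G r₀ w → w ≡ p₀ ⊎ w ≡ q₀ ⊎ w ≡ z)
    pq₀      : Adj G p₀ q₀
    qr₀      : Adj G q₀ r₀
    pr₀      : Adj G p₀ r₀
    distinct : ∀ w x y → In3 p₀ q₀ r₀ x → In3 p₀ q₀ r₀ y → x ≢ y → Adj G w x → Adj G w y → In3 p₀ q₀ r₀ w
    φ-surjective : ∀ h → ∃ λ u → φ u ≡ h
    φ-fibres     : ∀ u v → (φ u ≡ φ v) ⇔ (u ≡ v ⊎ (In3 p₀ q₀ r₀ u × In3 p₀ q₀ r₀ v))
    H-adj        : ∀ u v → Adj H (φ u) (φ v) ⇔ (φ u ≢ φ v × Σ (V G) λ u′ → Σ (V G) λ v′ →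
                     φ u′ ≡ φ u × φ v′ ≡ φ v × Adj G u′ v′)

module TriangleGraph {G H : Graph} (config : TriangleConfig G H) where
  open TriangleConfig config
  open TriangleReduction

  p≢q : p₀ ≢ q₀
  p≢q = adj-irrefl G pq₀
  q≢r : q₀ ≢ r₀
  q≢r = adj-irrefl G qr₀
  p≢r : p₀ ≢ r₀
  p≢r = adj-irrefl G pr₀

  In : V G → Set
  In = In3 p₀ q₀ r₀

  in-p : In p₀
  in-p = inj₁ refl
  in-q : In q₀
  in-q = inj₂ (inj₁ refl)
  in-r : In r₀
  in-r = inj₂ (inj₂ refl)

  Old : V G → Set
  Old u = ¬ In u

  R : V G → V G → Set
  R u v = Adj G u v × Old u × Old v

  R-sym : ∀ {u v} → R u v → R v u
  R-sym (e , ou , ov) = adj-sym G e , ov , ou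

  R-irrefl : ∀ {u} → ¬ R u u
  R-irrefl (e , _) = adj-irrefl G e refl

  a b c : V G
  a = proj₁ p-third
  b = proj₁ q-third
  c = proj₁ r-third

  pa₀ : Adj G p₀ a
  pa₀ = proj₁ (proj₂ p-third)
  qb₀ : Adj G q₀ b
  qb₀ = proj₁ (proj₂ q-third)
  rc₀ : Adj G r₀ c
  rc₀ = proj₁ (proj₂ r-third)

  old-a : Old a
  old-a = [ (λ e → adj-irrefl G pa₀ (sym e)) , [ proj₁ (proj₂ (proj₂ p-third)) , proj₁ (proj₂ (proj₂ (proj₂ p-third))) ]′ ]′
  old-b : Old b
  old-b = [ proj₁ (proj₂ (proj₂ q-third)) , [ (λ e → adj-irrefl G qb₀ (sym e)) , proj₁ (proj₂ (proj₂ (proj₂ q-third))) ]′ ]′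
  old-c : Old c
  old-c = [ proj₁ (proj₂ (proj₂ r-third)) , [ proj₁ (proj₂ (proj₂ (proj₂ r-third))) , (λ e → adj-irrefl G rc₀ (sym e)) ]′ ]′

  a≢b : a ≢ b
  a≢b e = old-a (distinct a p₀ q₀ in-p in-q p≢q (adj-sym G pa₀) (adj-sym G (subst (Adj G q₀) (sym e) qb₀)))
  b≢c : b ≢ c
  b≢c e = old-b (distinct b q₀ r₀ in-q in-r q≢r (adj-sym G qb₀) (adj-sym G (subst (Adj G r₀) (sym e) rc₀)))
  a≢c : a ≢ c
  a≢c e = old-a (distinct a p₀ r₀ in-p in-r p≢r (adj-sym G pa₀) (adj-sym G (subst (Adj G r₀) (sym e) rc₀)))

  P : Frame
  P = record
    { X = V G ; _≟_ = Fin._≟_ ; R = R ; a = a ; b = b ; c = c ; a≢b = a≢b ; b≢c = b≢c ; a≢c = a≢c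
    ; R-sym = R-sym ; R-irrefl = R-irrefl }

  place : TriG (V G) → V G
  place p       = p₀
  place q       = q₀
  place r       = r₀
  place (old u) = u

  data At : V G → TriG (V G) → Set where
    at-p   : At p₀ p
    at-q   : At q₀ q
    at-r   : At r₀ r
    at-old : ∀ {u} → Old u → At u (old u)

  locate : ∀ u → ∃ (At u)
  locate u with u Fin.≟ p₀ | u Fin.≟ q₀ | u Fin.≟ r₀
  ... | yes refl | _        | _        = p , at-p
  ... | no _     | yes refl | _        = q , at-q
  ... | no _     | no _     | yes refl = r , at-r
  ... | no ¬p    | no ¬q    | no ¬r    = old u , at-old [ ¬p , [ ¬q , ¬r ]′ ]′

  label : V G → TriG (V G)
  label u = proj₁ (locate u)

  at-label : ∀ u → At u (label u)
  at-label u = proj₂ (locate u)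

  at-place : ∀ {u x} → At u x → place x ≡ u
  at-place at-p       = refl
  at-place at-q       = refl
  at-place at-r       = refl
  at-place (at-old _) = refl

  at-unique : ∀ {u v x y} → At u x → At v y → u ≡ v → x ≡ y
  at-unique at-p at-p e = refl
  at-unique at-q at-q e = refl
  at-unique at-r at-r e = refl
  at-unique (at-old _) (at-old _) refl = refl
  at-unique at-p at-q e = contradiction e p≢q
  at-unique at-p at-r e = contradiction e p≢r
  at-unique at-q at-p e = contradiction (sym e) p≢q
  at-unique at-q at-r e = contradiction e q≢r
  at-unique at-r at-p e = contradiction (sym e) p≢r
  at-unique at-r at-q e = contradiction (sym e) q≢r
  at-unique at-p (at-old ou) refl = contradiction in-p ou
  at-unique at-q (at-old ou) refl = contradiction in-q ou
  at-unique at-r (at-old ou) refl = contradiction in-r ou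
  at-unique (at-old ou) at-p refl = contradiction in-p ou
  at-unique (at-old ou) at-q refl = contradiction in-q ou
  at-unique (at-old ou) at-r refl = contradiction in-r ou

  at-G : ∀ {x y} → Tri.G P x y → At (place x) x
  at-G Tri.pq = at-p
  at-G Tri.qp = at-q
  at-G Tri.qr = at-q
  at-G Tri.rq = at-r
  at-G Tri.rp = at-r
  at-G Tri.pr = at-p
  at-G Tri.pa = at-p
  at-G Tri.ap = at-old old-a
  at-G Tri.qb = at-q
  at-G Tri.bq = at-old old-b
  at-G Tri.rc = at-r
  at-G Tri.cr = at-old old-c
  at-G (Tri.oo (_ , ou , _)) = at-old ou

  label-place : ∀ {x y} → Tri.G P x y → label (place x) ≡ x
  label-place e = at-unique (at-label _) (at-G e) refl

  place-adj : ∀ {x y} → Tri.G P x y → Adj G (place x) (place y)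
  place-adj Tri.pq = pq₀
  place-adj Tri.qp = adj-sym G pq₀
  place-adj Tri.qr = qr₀
  place-adj Tri.rq = adj-sym G qr₀
  place-adj Tri.rp = adj-sym G pr₀
  place-adj Tri.pr = pr₀
  place-adj Tri.pa = pa₀
  place-adj Tri.ap = adj-sym G pa₀
  place-adj Tri.qb = qb₀
  place-adj Tri.bq = adj-sym G qb₀
  place-adj Tri.rc = rc₀
  place-adj Tri.cr = adj-sym G rc₀
  place-adj (Tri.oo (e , _)) = e

  from-p : ∀ {v y} → At v y → Adj G p₀ v → Tri.G P p y
  from-p at e with proj₂ (proj₂ (proj₂ (proj₂ p-third))) e
  ... | inj₁ v≡q with at-unique at at-q v≡q
  ...   | refl = Tri.pq
  from-p at e | inj₂ (inj₁ v≡r) with at-unique at at-r v≡r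
  ...   | refl = Tri.pr
  from-p at e | inj₂ (inj₂ v≡a) with at-unique at (at-old old-a) v≡a
  ...   | refl = Tri.pa

  from-q : ∀ {v y} → At v y → Adj G q₀ v → Tri.G P q y
  from-q at e with proj₂ (proj₂ (proj₂ (proj₂ q-third))) e
  ... | inj₁ v≡p with at-unique at at-p v≡p
  ...   | refl = Tri.qp
  from-q at e | inj₂ (inj₁ v≡r) with at-unique at at-r v≡r
  ...   | refl = Tri.qr
  from-q at e | inj₂ (inj₂ v≡b) with at-unique at (at-old old-b) v≡b
  ...   | refl = Tri.qb

  from-r : ∀ {v y} → At v y → Adj G r₀ v → Tri.G P r y
  from-r at e with proj₂ (proj₂ (proj₂ (proj₂ r-third))) e
  ... | inj₁ v≡p with at-unique at at-p v≡p
  ...   | refl = Tri.rp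
  from-r at e | inj₂ (inj₁ v≡q) with at-unique at at-q v≡q
  ...   | refl = Tri.rq
  from-r at e | inj₂ (inj₂ v≡c) with at-unique at (at-old old-c) v≡c
  ...   | refl = Tri.rc

  at-adj : ∀ {u v x y} → At u x → At v y → Adj G u v → Tri.G P x y
  at-adj at-p at e = from-p at e
  at-adj at-q at e = from-q at e
  at-adj at-r at e = from-r at e
  at-adj at at-p e = Tri.G-sym P (from-p at (adj-sym G e))
  at-adj at at-q e = Tri.G-sym P (from-q at (adj-sym G e))
  at-adj at at-r e = Tri.G-sym P (from-r at (adj-sym G e))
  at-adj (at-old o₁) (at-old o₂) e = Tri.oo (e , o₁ , o₂)

  G-≃ : Tri.G P ≃ Adj G
  G-≃ = record
    { to = place ; from = label ; to-adj = place-adj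
    ; from-adj = λ {u} {v} e → at-adj (at-label u) (at-label v) e
    ; from-to = λ e → label-place e , label-place (Tri.G-sym P e)
    ; to-from = λ {u} {v} _ → at-place (at-label u) , at-place (at-label v) }

  φ-in : ∀ {u v} → In u → In v → φ u ≡ φ v
  φ-in {u} {v} iu iv = Equivalence.from (φ-fibres u v) (inj₂ (iu , iv))

  φ-old : ∀ {u v} → Old v → φ u ≡ φ v → u ≡ v
  φ-old {u} {v} ov e with Equivalence.to (φ-fibres u v) e
  ... | inj₁ u≡v      = u≡v
  ... | inj₂ (_ , iv) = contradiction iv ov

  representative : V H → V G
  representative h = proj₁ (φ-surjective h)

  φ-representative : ∀ h → φ (representative h) ≡ h
  φ-representative h = proj₂ (φ-surjective h)

  labelᴴ : V H → TriH (V G)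
  labelᴴ h = π (label (representative h))

  placeᴴ : TriH (V G) → V H
  placeᴴ o       = φ p₀
  placeᴴ (old u) = φ u

  π-in : ∀ {u x} → At u x → In u → π x ≡ o
  π-in at-p _        = refl
  π-in at-q _        = refl
  π-in at-r _        = refl
  π-in (at-old ou) iu = contradiction iu ou

  π-φ : ∀ {u v x y} → At u x → At v y → φ u ≡ φ v → π x ≡ π y
  π-φ {u} {v} at at′ e with Equivalence.to (φ-fibres u v) e
  ... | inj₁ u≡v       = cong π (at-unique at at′ u≡v)
  ... | inj₂ (iu , iv) = trans (π-in at iu) (sym (π-in at′ iv))

  labelᴴ-φ : ∀ {u x} → At u x → labelᴴ (φ u) ≡ π x
  labelᴴ-φ {u} at = π-φ (at-label (representative (φ u))) at (φ-representative (φ u))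

  placeᴴ-π : ∀ {u x} → At u x → placeᴴ (π x) ≡ φ u
  placeᴴ-π at-p       = refl
  placeᴴ-π at-q       = φ-in in-p in-q
  placeᴴ-π at-r       = φ-in in-p in-r
  placeᴴ-π (at-old _) = refl

  placeᴴ-labelᴴ : ∀ h → placeᴴ (labelᴴ h) ≡ h
  placeᴴ-labelᴴ h = trans (placeᴴ-π (at-label (representative h))) (φ-representative h)

  labelᴴ-placeᴴ : ∀ {x y} → Tri.H P x y → labelᴴ (placeᴴ x) ≡ x
  labelᴴ-placeᴴ Tri.oa = labelᴴ-φ at-p
  labelᴴ-placeᴴ Tri.ob = labelᴴ-φ at-p
  labelᴴ-placeᴴ Tri.oc = labelᴴ-φ at-p
  labelᴴ-placeᴴ Tri.ao = labelᴴ-φ (at-old old-a)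
  labelᴴ-placeᴴ Tri.bo = labelᴴ-φ (at-old old-b)
  labelᴴ-placeᴴ Tri.co = labelᴴ-φ (at-old old-c)
  labelᴴ-placeᴴ (Tri.oo (_ , ou , _)) = labelᴴ-φ (at-old ou)

  π-adj : ∀ {u v x y} → At u x → At v y → φ u ≢ φ v → Tri.G P x y → Tri.H P (π x) (π y)
  π-adj at-p at-q ne Tri.pq = contradiction (φ-in in-p in-q) ne
  π-adj at-q at-p ne Tri.qp = contradiction (φ-in in-q in-p) ne
  π-adj at-q at-r ne Tri.qr = contradiction (φ-in in-q in-r) ne
  π-adj at-r at-q ne Tri.rq = contradiction (φ-in in-r in-q) ne
  π-adj at-r at-p ne Tri.rp = contradiction (φ-in in-r in-p) ne
  π-adj at-p at-r ne Tri.pr = contradiction (φ-in in-p in-r) ne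
  π-adj _ _ _ Tri.pa = Tri.oa
  π-adj _ _ _ Tri.ap = Tri.ao
  π-adj _ _ _ Tri.qb = Tri.ob
  π-adj _ _ _ Tri.bq = Tri.bo
  π-adj _ _ _ Tri.rc = Tri.oc
  π-adj _ _ _ Tri.cr = Tri.co
  π-adj _ _ _ (Tri.oo e) = Tri.oo e

  lift-edge : ∀ {h k} → Adj H h k → h ≢ k × ∃₂ λ u v → φ u ≡ h × φ v ≡ k × Adj G u v
  lift-edge {h} {k} e with Equivalence.to (H-adj (representative h) (representative k))
                             (subst₂ (Adj H) (sym (φ-representative h)) (sym (φ-representative k)) e)
  ... | ne , u , v , eu , ev , uv =
    (λ h≡k → ne (trans (φ-representative h) (trans h≡k (sym (φ-representative k)))))
    , u , v , trans eu (φ-representative h) , trans ev (φ-representative k) , uv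

  labelᴴ-adj : ∀ {h k} → Adj H h k → Tri.H P (labelᴴ h) (labelᴴ k)
  labelᴴ-adj e with lift-edge e
  ... | ne , u , v , refl , refl , uv = subst₂ (Tri.H P) (sym (labelᴴ-φ (at-label u))) (sym (labelᴴ-φ (at-label v)))
    (π-adj (at-label u) (at-label v) ne (at-adj (at-label u) (at-label v) uv))

  push-edge : ∀ {u v} → φ u ≢ φ v → Adj G u v → Adj H (φ u) (φ v)
  push-edge {u} {v} ne e = Equivalence.from (H-adj u v) (ne , u , v , refl , refl , e)

  φ-≢ : ∀ {u v} → Old v → u ≢ v → φ u ≢ φ v
  φ-≢ ov ne e = ne (φ-old ov e)

  corner : ∀ {u v} → In u → Old v → Adj G u v → Adj H (φ p₀) (φ v)
  corner {u} {v} iu ov e = subst (λ h → Adj H h (φ v)) (φ-in iu in-p) (push-edge (φ-≢ ov (adj-irrefl G e)) e)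

  placeᴴ-adj : ∀ {x y} → Tri.H P x y → Adj H (placeᴴ x) (placeᴴ y)
  placeᴴ-adj Tri.oa = corner in-p old-a pa₀
  placeᴴ-adj Tri.ob = corner in-q old-b qb₀
  placeᴴ-adj Tri.oc = corner in-r old-c rc₀
  placeᴴ-adj Tri.ao = adj-sym H (corner in-p old-a pa₀)
  placeᴴ-adj Tri.bo = adj-sym H (corner in-q old-b qb₀)
  placeᴴ-adj Tri.co = adj-sym H (corner in-r old-c rc₀)
  placeᴴ-adj (Tri.oo (e , _ , ou)) = push-edge (φ-≢ ou (adj-irrefl G e)) e

  H-≃ : Tri.H P ≃ Adj H
  H-≃ = record
    { to = placeᴴ ; from = labelᴴ ; to-adj = placeᴴ-adj ; from-adj = labelᴴ-adj
    ; from-to = λ e → labelᴴ-placeᴴ e , labelᴴ-placeᴴ (Tri.H-sym P e)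
    ; to-from = λ {h} {k} _ → placeᴴ-labelᴴ h , placeᴴ-labelᴴ k }

  vertices : n G ≡ 2 + n H
  vertices = enumeration-unique (fin-enumeration (n G))
    (reindex f (g ∘ label) (λ _ _ → tt) gf g-P fg (sum-enumeration (fin-enumeration 2) (fin-enumeration (n H))))
    where
    source : TriH (V G) → V G
    source o       = p₀
    source (old u) = u
    f : Fin 2 ⊎ V H → V G
    f (inj₁ zero)       = q₀
    f (inj₁ (suc zero)) = r₀
    -- `representative h` may be any corner of the triangle; passing through `labelᴴ` normalises it
    -- to `p₀`, so that exactly `q₀` and `r₀` are left over.
    f (inj₂ h)          = source (labelᴴ h)
    g : TriG (V G) → Fin 2 ⊎ V H
    g p       = inj₂ (φ p₀)
    g q       = inj₁ zero
    g r       = inj₁ (suc zero)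
    g (old u) = inj₂ (φ u)
    label-at : ∀ {u x} → At u x → label u ≡ x
    label-at at = at-unique (at-label _) at refl
    g-source : ∀ {u x} → At u x → g (label (source (π x))) ≡ inj₂ (φ u)
    g-source at-p = cong g (label-at at-p)
    g-source at-q = trans (cong g (label-at at-p)) (cong inj₂ (φ-in in-p in-q))
    g-source at-r = trans (cong g (label-at at-p)) (cong inj₂ (φ-in in-p in-r))
    g-source (at-old ou) = cong g (label-at (at-old ou))
    gf : ∀ x → [ (λ _ → ⊤) , (λ _ → ⊤) ]′ x → g (label (f x)) ≡ x
    gf (inj₁ zero) _       = cong g (label-at at-q)
    gf (inj₁ (suc zero)) _ = cong g (label-at at-r)
    gf (inj₂ h) _          = trans (g-source (at-label (representative h))) (cong inj₂ (φ-representative h))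
    g-P : ∀ u → ⊤ → [ (λ _ → ⊤) , (λ _ → ⊤) ]′ (g (label u))
    g-P u _ with g (label u)
    ... | inj₁ _ = tt
    ... | inj₂ _ = tt
    fg-at : ∀ {u x} → At u x → f (g x) ≡ u
    fg-at at-p       = cong source (labelᴴ-φ at-p)
    fg-at at-q       = refl
    fg-at at-r       = refl
    fg-at (at-old ou) = cong source (labelᴴ-φ (at-old ou))
    fg : ∀ u → ⊤ → f (g (label u)) ≡ u
    fg u _ = fg-at (at-label u)

  edges : numEdges G ≡ 3 + numEdges H
  edges = double-injective (numEdges G) (3 + numEdges H) (trans
    (enumeration-unique (graph-darts G)
      (≃-darts G-≃ (Tri.triangle-darts P (≃-darts (≃-sym H-≃) (graph-darts H)))))
    (cong (3 +_) (ℕ.+-comm (3 + numEdges H) (numEdges H))))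

  fibre-connected : ∀ {u v} → φ u ≡ φ v → Star (Adj G) u v
  fibre-connected {u} {v} e with Equivalence.to (φ-fibres u v) e
  ... | inj₁ refl      = ε
  ... | inj₂ (iu , iv) = inside iu iv
    where
    inside : ∀ {u v} → In u → In v → Star (Adj G) u v
    inside (inj₁ refl) (inj₁ refl)               = ε
    inside (inj₁ refl) (inj₂ (inj₁ refl))        = pq₀ ◅ ε
    inside (inj₁ refl) (inj₂ (inj₂ refl))        = pr₀ ◅ ε
    inside (inj₂ (inj₁ refl)) (inj₁ refl)        = adj-sym G pq₀ ◅ ε
    inside (inj₂ (inj₁ refl)) (inj₂ (inj₁ refl)) = ε
    inside (inj₂ (inj₁ refl)) (inj₂ (inj₂ refl)) = qr₀ ◅ ε
    inside (inj₂ (inj₂ refl)) (inj₁ refl)        = adj-sym G pr₀ ◅ ε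
    inside (inj₂ (inj₂ refl)) (inj₂ (inj₁ refl)) = adj-sym G qr₀ ◅ ε
    inside (inj₂ (inj₂ refl)) (inj₂ (inj₂ refl)) = ε

  lift-path : ∀ {h k u v} → Star (Adj H) h k → φ u ≡ h → φ v ≡ k → Star (Adj G) u v
  lift-path ε eu ev = fibre-connected (trans eu (sym ev))
  lift-path (e ◅ es) eu ev with lift-edge e
  ... | _ , x , y , ex , ey , xy = fibre-connected (trans eu (sym ex)) ◅◅ (xy ◅ lift-path es ey ev)

  polyhedral : Polyhedral H → Polyhedral G
  polyhedral PH = record
    { connected = λ u v → lift-path (connected PH (φ u) (φ v)) refl refl
    ; K         = suc (K PH)
    -- Two vertices, three edges and one face more.
    ; faces     = trans (cong (_+ suc (K PH)) vertices) (trans (cong (2 +_) (ℕ.+-suc (n H) (K PH)))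
        (trans (cong (3 +_) (faces PH)) (cong (_+ 2) (sym edges))))
    ; whitney   = ≃-whitney (Tri.G-sym P) G-≃
        (triangle-step P
          (≃-whitney (adj-sym H) (≃-sym H-≃) (whitney PH))) }

d3a-polyhedral : ∀ {G H} → D3a G H → Polyhedral H → Polyhedral G
d3a-polyhedral {G} {H} (p₀ , q₀ , r₀ , φ ,
  (dp , dq , dr , pq₀ , qr₀ , pr₀ , distinct) , (surj , fibres , H-adj)) =
  TriangleGraph.polyhedral record
    { p₀ = p₀ ; q₀ = q₀ ; r₀ = r₀ ; φ = φ
    ; p-third = third-neighbour G p₀ dp pq₀ pr₀ (adj-irrefl G qr₀)
    ; q-third = third-neighbour G q₀ dq (adj-sym G pq₀) qr₀ (adj-irrefl G pr₀)
    ; r-third = third-neighbour G r₀ dr (adj-sym G pr₀) (adj-sym G qr₀) (adj-irrefl G pq₀)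
    ; pq₀ = pq₀ ; qr₀ = qr₀ ; pr₀ = pr₀ ; distinct = distinct
    ; φ-surjective = surj ; φ-fibres = fibres ; H-adj = H-adj }

-- Induction along the reductions, and return to planar embeddings.

K4-polyhedral : ∀ {H} → H ≅ K4 → Polyhedral H
K4-polyhedral {H} (f , f-adj) = record
  { connected = connected′
  ; K         = 4
  ; faces     = trans (cong (_+ 4) vertices) (cong (_+ 2) (sym edges))
  ; whitney   = ≃-whitney (λ {u} {v} → A₄-sym {u} {v}) iso K4-whitney }
  where
  open Bijection f using (to; strictlySurjective) renaming (injective to to-injective)
  from : Fin 4 → V H
  from i = proj₁ (strictlySurjective i)
  to-from : ∀ i → to (from i) ≡ i
  to-from i = proj₂ (strictlySurjective i)
  from-to : ∀ u → from (to u) ≡ u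
  from-to u = to-injective (to-from (to u))
  iso : A₄ ≃ Adj H
  iso = record
    { to = from ; from = to
    ; to-adj = λ {i} {j} e → trans (sym (f-adj (from i) (from j))) (trans (cong₂ k4adj (to-from i) (to-from j)) e)
    ; from-adj = λ {u} {v} e → trans (f-adj u v) e
    ; from-to = λ {i} {j} _ → to-from i , to-from j
    ; to-from = λ {u} {v} _ → from-to u , from-to v }
  vertices : n H ≡ 4
  vertices = enumeration-unique (fin-enumeration (n H))
    (reindex from to (λ _ _ → tt) (λ i _ → to-from i) (λ _ _ → tt) (λ u _ → from-to u) (fin-enumeration 4))
  edges : numEdges H ≡ 6
  edges = double-injective (numEdges H) 6 (enumeration-unique (graph-darts H) (≃-darts iso (graph-darts K4)))
  connected′ : Connected H
  connected′ u v with u Fin.≟ v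
  ... | yes refl = ε
  ... | no ne    = trans (sym (f-adj u v)) (k4-adjacent (λ e → ne (to-injective e))) ◅ ε
    where
    k4-adjacent : ∀ {i j} → i ≢ j → k4adj i j ≡ true
    k4-adjacent {i} {j} ne with i Fin.≟ j
    ... | yes e = contradiction e ne
    ... | no _  = refl

reducible-polyhedral : ∀ {G H} → Star D3Step G H → H ≅ K4 → Polyhedral G
reducible-polyhedral ε iso             = K4-polyhedral iso
reducible-polyhedral (inj₁ a ◅ es) iso = d3a-polyhedral a (reducible-polyhedral es iso)
reducible-polyhedral (inj₂ b ◅ es) iso = d3b-polyhedral b (reducible-polyhedral es iso)

isRotation : ∀ {G ρ} → Rotation (Adj G) ρ → IsRotation G ρ
isRotation rot = (λ u v e → proj₁ (rot u) e) , λ u v w e f → star-iter (proj₂ (rot u) e f)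

rotation : ∀ {G ρ} → IsRotation G ρ → Rotation (Adj G) ρ
rotation (closed , transitive) u = (λ e → closed u _ e) ,
  λ {v} {w} e f → let k , eq = transitive u v w e f in iter-star k eq

module _ {G : Graph} (P : Polyhedral G) where

  planar : Planar G
  planar = connected P , ρ , isRotation {G} rot , trans (cong (n G +_) K-faces) (faces P)
    where
    ρ = proj₁ (embedding (whitney P))
    rot = proj₁ (proj₂ (embedding (whitney P)))
    c = proj₂ (proj₂ (embedding (whitney P)))
    module Φ = Faces G ρ rot
    le : K P ≤ numFaces G ρ
    le = Φ.colours≤faces c
    K-faces : numFaces G ρ ≡ K P
    -- The colouring by faces is itself bounded by `euler`. Its values off the darts are borrowed
    -- from `c`, embedded along `le`.
    K-faces = ℕ.≤-antisym (euler (whitney P) rot (Φ.face-colouring (λ u v → inject≤ (colour c u v) le))) le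

  triangle-is-face : ∀ ρ → IsPlanarEmbedding G ρ → ∀ a b c → Triangle G a b c → TriangleIsFace G ρ a b c
  triangle-is-face ρ (isRot , euler-formula) a b c (ab , bc , ac) =
    Sum.map face-cycle face-cycle (triangles (rigid (whitney P) rot col) ab bc ac)
    where
    rot : Rotation (Adj G) ρ
    rot = rotation {G} isRot
    K-faces : numFaces G ρ ≡ K P
    K-faces = ℕ.+-cancelˡ-≡ (n G) _ _ (trans euler-formula (sym (faces P)))
    col : Colouring (Adj G) ρ (K P)
    -- Euler's formula forces exactly `K P` faces, so the faces themselves form a colouring to which
    -- rigidity applies. The colouring of the known embedding only fills in the values off the
    -- darts.
    col = subst (Colouring (Adj G) ρ) K-faces (Faces.face-colouring G ρ rot
      (λ u v → subst Fin (sym K-faces) (colour (proj₂ (proj₂ (embedding (whitney P)))) u v)))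
    face-cycle : ∀ {x y z} → Face ρ x y z → FaceCycle G ρ x y z
    face-cycle (e₁ , e₂ , e₃) = cong (_ ,_) e₁ , cong (_ ,_) e₂ , cong (_ ,_) e₃

theorem6 : (G : Graph) → D3Reducible G →
    Planar G ×
    (∀ ρ → IsPlanarEmbedding G ρ →
    ∀ a b c → Triangle G a b c → TriangleIsFace G ρ a b c)
theorem6 G (H , steps , iso) = planar P , triangle-is-face P
  where
  P : Polyhedral G
  P = reducible-polyhedral steps iso
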